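{- Let $\mathbb{K}$ be a field and let $X,Y$ be finite simplicial complexes on the same vertex set. For a simplicial complex $Z$ write $\tilde{h}_i(Z)=\dim_{\mathbb{K}}\tilde{H}_i(Z;\mathbb{K})$. Then for every $k\geq 0$ $$\tilde{h}_{k-1}(X\cap Y)\leq \sum_{\sigma\in Y}\ \sum_{i+j=k}\tilde{h}_{i-1}(X[\sigma])\cdot \tilde{h}_{j-1}(\mathrm{lk}(Y,\sigma)).$$
   Context: For a simplicial complex $X$ on vertex set $V$ and $S\subset V$, the induced subcomplex is $X[S]=\{\sigma\in X:\sigma\subset S\}$. The void complex $\{\}$ has no faces; the empty complex $\{\emptyset\}$ has only the empty face. Every non-void complex contains $\emptyset$ as its unique $(-1)$-dimensional face; in particular the sum ranges over all faces of $Y$ including $\sigma=\emptyset$. For $A\subset V$, the star is $\mathrm{St}(X,A)=\{\tau\in X:\tau\cup A\in X\}$ and the link is $\mathrm{lk}(X,A)=\{\tau\in\mathrm{St}(X,A):\tau\cap A=\emptyset\}$ (so $\mathrm{lk}(X,A)=\{\}$ if $A\notin X$). Reduced homology conventions: $\tilde{h}_{ -1}(\{\})=0$ and $\tilde{h}_{ -1}(\{\emptyset\})=1$. -}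

module Defs where

open import Level using (Level; _⊔_; suc)
open import Data.Bool using (Bool; true; false; _∧_; _∨_; not; T; if_then_else_)
open import Data.Nat using (ℕ; zero; _∸_; _≡ᵇ_) renaming (suc to sucℕ; _+_ to _+ℕ_)
open import Data.Vec using (Vec; []; _∷_)
open import Data.List using (List; []; _∷_; _++_; map; filter; length; foldr; zipWith)
open import Data.List.Relation.Unary.All using (All)
open import Data.List.Relation.Unary.Any using (Any)
open import Data.List.Membership.Propositional using (_∈_)
open import Data.List.Relation.Binary.Sublist.Propositional using () renaming (_⊆_ to _Sublist_)
open import Data.Maybe using (Maybe; just; nothing)
open import Data.Product using (Σ; _×_; ∃; _,_)
open import Relation.Binary.PropositionalEquality using (_≡_)
open import Relation.Nullary using (¬_)
open import Algebra.Bundles using (CommutativeRing)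

record Field (c ℓ : Level) : Set (Level.suc (c ⊔ ℓ)) where
  field
    commutativeRing : CommutativeRing c ℓ
  open CommutativeRing commutativeRing public
  field
    0≉1     : ¬ (0# ≈ 1#)
    inverse : ∀ x → ¬ (x ≈ 0#) → Σ Carrier (λ y → (x * y) ≈ 1#)

-- Vertex set Fin n; a face / vertex subset is a Bool-vector of length n.

Face : ℕ → Set
Face n = Vec Bool n

allFaces : (n : ℕ) → List (Face n)
allFaces zero = [] ∷ []
allFaces (sucℕ n) = map (false ∷_) (allFaces n) ++ map (true ∷_) (allFaces n)

card : ∀ {n} → Face n → ℕ
card [] = 0
card (true ∷ σ) = sucℕ (card σ)
card (false ∷ σ) = card σ

_⊆ᵇ_ : ∀ {n} → Face n → Face n → Bool
[] ⊆ᵇ [] = true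
(a ∷ σ) ⊆ᵇ (b ∷ τ) = (not a ∨ b) ∧ (σ ⊆ᵇ τ)

_∪ᶠ_ : ∀ {n} → Face n → Face n → Face n
[] ∪ᶠ [] = []
(a ∷ σ) ∪ᶠ (b ∷ τ) = (a ∨ b) ∷ (σ ∪ᶠ τ)

disjointᵇ : ∀ {n} → Face n → Face n → Bool
disjointᵇ [] [] = true
disjointᵇ (a ∷ σ) (b ∷ τ) = not (a ∧ b) ∧ disjointᵇ σ τ

_==ᶠ_ : ∀ {n} → Face n → Face n → Bool
σ ==ᶠ τ = (σ ⊆ᵇ τ) ∧ (τ ⊆ᵇ σ)

Family : ℕ → Set
Family n = Face n → Bool

-- A finite simplicial complex on vertex set Fin n: a family of subsets
-- closed under taking subsets. (The void complex: nothing is a member;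
-- the empty complex {∅}: only the empty face is a member.)
record SimplicialComplex (n : ℕ) : Set where
  field
    mem    : Family n
    closed : ∀ σ τ → T (σ ⊆ᵇ τ) → T (mem τ) → T (mem σ)
open SimplicialComplex public

_∩ˢ_ : ∀ {n} → Family n → Family n → Family n
(X ∩ˢ Y) σ = X σ ∧ Y σ

induced : ∀ {n} → Family n → Face n → Family n
induced X S σ = (σ ⊆ᵇ S) ∧ X σ

-- link lk(Y, A) = { τ : τ ∪ A ∈ Y, τ ∩ A = ∅ }  (void if A ∉ Y)
link : ∀ {n} → Family n → Face n → Family n
link Y A τ = Y (τ ∪ᶠ A) ∧ disjointᵇ τ A

-- the faces of Z with exactly m vertices (i.e. of dimension m - 1)
facesOfSize : ∀ {n} → Family n → ℕ → List (Face n)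
facesOfSize {n} Z m = filter (λ σ → T? (Z σ ∧ (card σ ≡ᵇ m))) (allFaces n)
  where
    open import Relation.Nullary.Decidable using (Dec)
    T? : (b : Bool) → Dec (T b)
    T? b = Data.Bool.T? b
      where import Data.Bool

faces : ∀ {n} → Family n → List (Face n)
faces {n} Z = filter (λ σ → Data.Bool.T? (Z σ)) (allFaces n)
  where import Data.Bool

-- If ρ = σ ∖ {v} for a vertex v ∈ σ, returns just p where p is the
-- number of vertices of σ smaller than v; otherwise nothing.
incidence : ∀ {n} → Face n → Face n → Maybe ℕ
incidence [] [] = nothing
incidence (false ∷ ρ) (false ∷ σ) = incidence ρ σ
incidence (true ∷ ρ) (true ∷ σ) = Data.Maybe.map sucℕ (incidence ρ σ)
  where import Data.Maybe
incidence (false ∷ ρ) (true ∷ σ) = if ρ ==ᶠ σ then just 0 else nothing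
incidence (true ∷ ρ) (false ∷ σ) = nothing

module LinAlg {c ℓ} (K : Field c ℓ) where
  open Field K

  sumK : List Carrier → Carrier
  sumK = foldr _+_ 0#

  signPow : ℕ → Carrier
  signPow zero = 1#
  signPow (sucℕ p) = - signPow p

  -- simplicial boundary coefficient [σ : ρ] (vertices ordered by index)
  bdry : ∀ {n} → Face n → Face n → Carrier
  bdry ρ σ with incidence ρ σ
  ... | just p  = signPow p
  ... | nothing = 0#

  Matrix : ℕ → Set c
  Matrix n = Face n → Face n → Carrier

  CombZero : ∀ {n} → Matrix n → List (Face n) → List Carrier → List (Face n) → Set ℓ
  CombZero M R cs S = ∀ ρ → ρ ∈ R → sumK (zipWith (λ a σ → a * M ρ σ) cs S) ≈ 0#

  Independent : ∀ {n} → Matrix n → List (Face n) → List (Face n) → Set (c ⊔ ℓ)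
  Independent M R S = ∀ cs → length cs ≡ length S → CombZero M R cs S → All (λ a → a ≈ 0#) cs

  Dependent : ∀ {n} → Matrix n → List (Face n) → List (Face n) → Set (c ⊔ ℓ)
  Dependent M R S = Σ (List Carrier) λ cs →
    length cs ≡ length S × CombZero M R cs S × Any (λ a → ¬ (a ≈ 0#)) cs

  HasRank : ∀ {n} → Matrix n → List (Face n) → List (Face n) → ℕ → Set (c ⊔ ℓ)
  HasRank M R C r =
    Σ (List _) (λ S → S Sublist C × length S ≡ r × Independent M R S) ×
    (∀ S → S Sublist C → length S ≡ sucℕ r → Dependent M R S)

  -- rank of the boundary map ∂_m : C_m(Z) → C_{m-1}(Z), where C_m(Z) is
  -- spanned by the faces with m vertices (dimension m - 1); ∂_0 = 0.
  BdryRank : ∀ {n} → Family n → ℕ → ℕ → Set (c ⊔ ℓ)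
  BdryRank Z zero r = Lift (c ⊔ ℓ) (r ≡ 0)
    where open Level using (Lift)
  BdryRank Z (sucℕ m) r = HasRank bdry (facesOfSize Z m) (facesOfSize Z (sucℕ m)) r

  -- ReducedHomDim Z m d  :⇔  dim_K H̃_{m-1}(Z; K) = d
  -- (augmented chain complex, the empty face spanning C_0 when Z is non-void):
  -- d = #faces with m vertices − rank ∂_m − rank ∂_{m+1}.
  ReducedHomDim : ∀ {n} → Family n → ℕ → ℕ → Set (c ⊔ ℓ)
  ReducedHomDim Z m d = Σ ℕ λ r₁ → Σ ℕ λ r₂ →
    BdryRank Z m r₁ × BdryRank Z (sucℕ m) r₂ ×
    d ≡ length (facesOfSize Z m) ∸ r₁ ∸ r₂

{-# OPTIONS --safe #-}
-- Let D be spanned by the triples (α , σ , τ) with α ∈ X, α ⊆ σ, σ ∩ τ = ∅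
-- and σ ∪ τ ∈ Y, in degree |α| + |τ|.  It is the complex of the cubes
-- [σ , σ ∪ τ] in the face poset of Y with coefficients in the chains of X[σ].
--
-- * The chains of X ∩ Y are a retract of D: a face ρ is sent to the signed sum
--   of α ⊗ [α , ρ] over all α ⊆ ρ, and α ⊗ [σ , σ ∪ τ] is sent back to α when
--   τ = ∅, and to 0 otherwise.
-- * The differential of D only enlarges σ.  The graded piece at σ is the tensor
--   product of the chains of X[σ] and of lk(Y, σ), to which Künneth applies.
--
-- All bounds on homology are carried by identities 1 = d s + t d + P with P a
-- sum of N tensors f ⊗ v: they pass to retracts and extensions by plain linear
-- algebra, and the least such N is the dimension of the homology.  Equality in
-- K is not decidable, but the conclusion is stable under double negation, so
-- the Steinitz exchange lemma is only needed up to ¬¬.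
module Submission where

open import Defs
open import Level using (Level; _⊔_; lift)
open import Algebra.Bundles using (AbelianGroup)
open import Algebra.Module.Bundles using (LeftModule)
import Algebra.Module.Construct.TensorUnit as TensorUnit
import Algebra.Properties.CommutativeSemigroup as CommutativeSemigroupProperties
import Algebra.Properties.Group as GroupProperties
import Algebra.Properties.Monoid.Mult as Mult
open import Algebra.Properties.Ring using (-0#≈0#; -1*x≈-x; -‿distribˡ-*; -‿distribʳ-*; -‿involutive)
open import Data.Bool using (true; false; T; _∧_; if_then_else_)
import Data.Bool.Properties as Bool
open import Data.Empty using (⊥; ⊥-elim)
open import Data.Fin using (Fin; zero; suc)
open import Data.List using (List; []; _∷_; _++_; map; length; zipWith; filter; take; drop; upTo; concatMap)
open import Data.List.Properties using (length-++; length-map; length-take; length-drop; map-++; take++drop≡id; filter-accept; filter-reject)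
import Data.List.Membership.DecPropositional as DecMembership
open import Data.List.Membership.Propositional using (_∈_)
open import Data.List.Membership.Propositional.Properties using (∈-map⁺; ∈-map⁻; ∈-++⁺ˡ; ∈-++⁺ʳ; ∈-++⁻; ∈-filter⁺; ∈-filter⁻; ∈-upTo⁺; ∈-upTo⁻)
open import Data.List.Relation.Binary.Sublist.Propositional using (_∷_; _∷ʳ_) renaming (_⊆_ to _⊑_)
import Data.List.Relation.Binary.Sublist.Propositional as Sublist
open import Data.List.Relation.Unary.All as All using (All; []; _∷_)
import Data.List.Relation.Unary.All.Properties as All
import Data.List.Relation.Unary.AllPairs as AllPairs
open import Data.List.Relation.Unary.Any using (Any; here; there)
open import Data.List.Relation.Unary.Unique.Propositional using (Unique)
import Data.List.Relation.Unary.Unique.Propositional.Properties as Unique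
open import Data.Maybe as Maybe using (Maybe; just; nothing)
open import Data.Nat as ℕ using (ℕ; zero; suc; _≡ᵇ_)
open import Data.Nat.ListAction using (sum)
import Data.Nat.Properties as ℕ
open import Data.Product using (Σ; _×_; _,_; proj₁; proj₂)
open import Data.Sum using (_⊎_; inj₁; inj₂)
open import Data.Unit using (⊤; tt)
open import Data.Vec as Vec using (Vec; []; _∷_)
open import Data.Vec.Properties using (≡-dec; ∷-injectiveʳ)
open import Function using (_∘_; id)
open import Relation.Binary.PropositionalEquality as ≡ using (_≡_)
import Relation.Binary.Reasoning.Setoid as SetoidReasoning
import Relation.Binary.Reflection as Reflection
open import Relation.Nullary using (¬_; Dec; yes; no; does; contradiction)
open import Relation.Nullary.Decidable using (_×-dec_; ¬¬-excluded-middle; decidable-stable)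
open import Relation.Unary using (Decidable)

-- A spectral sequence would suggest the inequality, but over a field without decidable equality
-- neither bases of homology nor pages can be chosen. Explicit homotopies with a finite-rank error
-- survive this: a cycle on which all error functionals vanish is an explicit boundary, so the
-- number of functionals bounds the dimension, and such data are conjugated and glued by equations
-- alone. Gluing yields an inequality, not an equality, because the connecting maps are absorbed
-- into the error and never measured.
--
-- The cubes tie X to Y for the following reason. For fixed α, the faces of Y containing α form a
-- poset with least element α, empty exactly when α ∉ Y. The cubes over it form a cone or nothing,
-- so augmenting in the cube direction leaves the α in X ∩ Y.
--
-- Subsets are Bool vectors, so the differentials and comparison maps are defined by recursion on
-- all functions of faces, where their identities hold without side conditions. Membership and
-- degree are imposed afterwards by masking, and each operator is shown to respect the supports
-- involved.

module AbelianGroupSolver {c ℓ : Level} (G : AbelianGroup c ℓ) where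

  -- Reflective normalization of equations in abelian groups.

  private
    module G = AbelianGroup G
    open G using (Carrier; _≈_; _∙_; ε; _⁻¹)
    open Mult G.monoid using (×-homo-+) renaming (_×_ to _×ᴳ_)
    open CommutativeSemigroupProperties G.commutativeSemigroup using (interchange; xy∙z≈xz∙y)
    open GroupProperties G.group using (∙-cancelʳ)
    open SetoidReasoning G.setoid

  infixl 6 _⊕_ _⊝_
  infix 8 ⊖_

  data Expr (n : ℕ) : Set where
    var : Fin n → Expr n
    _⊕_ : Expr n → Expr n → Expr n
    ⊖_  : Expr n → Expr n
    ∅   : Expr n

  _⊝_ : ∀ {n} → Expr n → Expr n → Expr n
  x ⊝ y = x ⊕ ⊖ y

  private
    ⟦_⟧ : ∀ {n} → Expr n → Vec Carrier n → Carrier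
    ⟦ var i ⟧ ρ = Vec.lookup ρ i
    ⟦ x ⊕ y ⟧ ρ = ⟦ x ⟧ ρ ∙ ⟦ y ⟧ ρ
    ⟦ ⊖ x ⟧ ρ = ⟦ x ⟧ ρ ⁻¹
    ⟦ ∅ ⟧ ρ = ε

    zeros : ∀ {n} → Vec ℕ n
    zeros = Vec.replicate _ 0

    unit : ∀ {n} → Fin n → Vec ℕ n
    unit zero = 1 ∷ zeros
    unit (suc i) = 0 ∷ unit i

    -- An expression is stored as a difference of two multisets of variables.
    norm : ∀ {n} → Expr n → Vec ℕ n × Vec ℕ n
    norm (var i) = unit i , zeros
    norm (x ⊕ y) = Vec.zipWith ℕ._+_ (proj₁ (norm x)) (proj₁ (norm y)) , Vec.zipWith ℕ._+_ (proj₂ (norm x)) (proj₂ (norm y))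
    norm (⊖ x) = proj₂ (norm x) , proj₁ (norm x)
    norm ∅ = zeros , zeros

    total : ∀ {n} → Vec ℕ n → Vec Carrier n → Carrier
    total [] [] = ε
    total (m ∷ ms) (x ∷ ρ) = (m ×ᴳ x) ∙ total ms ρ

    total-zeros : ∀ {n} (ρ : Vec Carrier n) → total zeros ρ ≈ ε
    total-zeros [] = G.refl
    total-zeros (x ∷ ρ) = G.trans (G.identityˡ _) (total-zeros ρ)

    total-unit : ∀ {n} (i : Fin n) ρ → total (unit i) ρ ≈ Vec.lookup ρ i
    total-unit zero (x ∷ ρ) = G.trans (G.∙-cong (G.identityʳ x) (total-zeros ρ)) (G.identityʳ x)
    total-unit (suc i) (x ∷ ρ) = G.trans (G.identityˡ _) (total-unit i ρ)

    total-+ : ∀ {n} (p q : Vec ℕ n) ρ → total (Vec.zipWith ℕ._+_ p q) ρ ≈ total p ρ ∙ total q ρ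
    total-+ [] [] [] = G.sym (G.identityˡ ε)
    total-+ (m ∷ p) (k ∷ q) (x ∷ ρ) = begin
      ((m ℕ.+ k) ×ᴳ x) ∙ total (Vec.zipWith ℕ._+_ p q) ρ  ≈⟨ G.∙-cong (×-homo-+ x m k) (total-+ p q ρ) ⟩
      ((m ×ᴳ x) ∙ (k ×ᴳ x)) ∙ (total p ρ ∙ total q ρ)    ≈⟨ interchange _ _ _ _ ⟩
      ((m ×ᴳ x) ∙ total p ρ) ∙ ((k ×ᴳ x) ∙ total q ρ)    ∎

    -- Stated without inverses of totals, so that a sum is handled by rearrangement and negation by
    -- exchanging the two multisets.
    norm-sound : ∀ {n} (x : Expr n) ρ → ⟦ x ⟧ ρ ∙ total (proj₂ (norm x)) ρ ≈ total (proj₁ (norm x)) ρ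
    norm-sound (var i) ρ = begin
      Vec.lookup ρ i ∙ total zeros ρ  ≈⟨ G.∙-cong (G.sym (total-unit i ρ)) (total-zeros ρ) ⟩
      total (unit i) ρ ∙ ε            ≈⟨ G.identityʳ _ ⟩
      total (unit i) ρ                ∎
    norm-sound (x ⊕ y) ρ = begin
      (⟦ x ⟧ ρ ∙ ⟦ y ⟧ ρ) ∙ total (Vec.zipWith ℕ._+_ (proj₂ (norm x)) (proj₂ (norm y))) ρ
        ≈⟨ G.∙-congˡ (total-+ (proj₂ (norm x)) (proj₂ (norm y)) ρ) ⟩
      (⟦ x ⟧ ρ ∙ ⟦ y ⟧ ρ) ∙ (total (proj₂ (norm x)) ρ ∙ total (proj₂ (norm y)) ρ)
        ≈⟨ interchange _ _ _ _ ⟩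
      (⟦ x ⟧ ρ ∙ total (proj₂ (norm x)) ρ) ∙ (⟦ y ⟧ ρ ∙ total (proj₂ (norm y)) ρ)
        ≈⟨ G.∙-cong (norm-sound x ρ) (norm-sound y ρ) ⟩
      total (proj₁ (norm x)) ρ ∙ total (proj₁ (norm y)) ρ
        ≈⟨ total-+ (proj₁ (norm x)) (proj₁ (norm y)) ρ ⟨
      total (Vec.zipWith ℕ._+_ (proj₁ (norm x)) (proj₁ (norm y))) ρ ∎
    norm-sound (⊖ x) ρ = begin
      ⟦ x ⟧ ρ ⁻¹ ∙ total (proj₁ (norm x)) ρ                   ≈⟨ G.∙-congˡ (norm-sound x ρ) ⟨
      ⟦ x ⟧ ρ ⁻¹ ∙ (⟦ x ⟧ ρ ∙ total (proj₂ (norm x)) ρ)       ≈⟨ G.assoc _ _ _ ⟨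
      (⟦ x ⟧ ρ ⁻¹ ∙ ⟦ x ⟧ ρ) ∙ total (proj₂ (norm x)) ρ       ≈⟨ G.∙-congʳ (G.inverseˡ _) ⟩
      ε ∙ total (proj₂ (norm x)) ρ                            ≈⟨ G.identityˡ _ ⟩
      total (proj₂ (norm x)) ρ                                ∎
    norm-sound ∅ ρ = G.identityˡ _

    -- Both sides are the maximum of `m` and `k`.
    +-∸-exchange : ∀ m k → m ℕ.+ (k ℕ.∸ m) ≡ k ℕ.+ (m ℕ.∸ k)
    +-∸-exchange zero k = ≡.sym (≡.trans (≡.cong (k ℕ.+_) (ℕ.0∸n≡0 k)) (ℕ.+-identityʳ k))
    +-∸-exchange (suc m) zero = ≡.cong suc (ℕ.+-identityʳ m)
    +-∸-exchange (suc m) (suc k) = ≡.cong suc (+-∸-exchange m k)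

    zipWith-exchange : ∀ {n} (p q : Vec ℕ n) →
      Vec.zipWith ℕ._+_ p (Vec.zipWith ℕ._∸_ q p) ≡ Vec.zipWith ℕ._+_ q (Vec.zipWith ℕ._∸_ p q)
    zipWith-exchange [] [] = ≡.refl
    zipWith-exchange (m ∷ p) (k ∷ q) = ≡.cong₂ _∷_ (+-∸-exchange m k) (zipWith-exchange p q)

    -- Truncated subtraction in both directions cancels common occurrences. Expressions equal in
    -- every abelian group thus get the same normal form, and reflexivity closes the goal.
    ⟦_⇓⟧ : ∀ {n} → Expr n → Vec Carrier n → Carrier
    ⟦ x ⇓⟧ ρ = total (Vec.zipWith ℕ._∸_ (proj₁ (norm x)) (proj₂ (norm x))) ρ ∙
               total (Vec.zipWith ℕ._∸_ (proj₂ (norm x)) (proj₁ (norm x))) ρ ⁻¹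

    correct : ∀ {n} (x : Expr n) ρ → ⟦ x ⇓⟧ ρ ≈ ⟦ x ⟧ ρ
    correct x ρ = ∙-cancelʳ neg _ _ (∙-cancelʳ (total q ρ) _ _ (begin
      ((pos ∙ neg ⁻¹) ∙ neg) ∙ total q ρ  ≈⟨ G.∙-congʳ (G.assoc _ _ _) ⟩
      (pos ∙ (neg ⁻¹ ∙ neg)) ∙ total q ρ  ≈⟨ G.∙-congʳ (G.∙-congˡ (G.inverseˡ _)) ⟩
      (pos ∙ ε) ∙ total q ρ               ≈⟨ G.∙-congʳ (G.identityʳ _) ⟩
      pos ∙ total q ρ                     ≈⟨ G.comm _ _ ⟩
      total q ρ ∙ pos                     ≈⟨ total-+ q _ ρ ⟨
      total (Vec.zipWith ℕ._+_ q (Vec.zipWith ℕ._∸_ p q)) ρ ≡⟨ ≡.cong (λ r → total r ρ) (≡.sym (zipWith-exchange p q)) ⟩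
      total (Vec.zipWith ℕ._+_ p (Vec.zipWith ℕ._∸_ q p)) ρ ≈⟨ total-+ p _ ρ ⟩
      total p ρ ∙ neg                     ≈⟨ G.∙-congʳ (norm-sound x ρ) ⟨
      (⟦ x ⟧ ρ ∙ total q ρ) ∙ neg         ≈⟨ xy∙z≈xz∙y _ _ _ ⟩
      (⟦ x ⟧ ρ ∙ neg) ∙ total q ρ         ∎))
      where
      p q : Vec ℕ _
      p = proj₁ (norm x)
      q = proj₂ (norm x)
      pos neg : Carrier
      pos = total (Vec.zipWith ℕ._∸_ p q) ρ
      neg = total (Vec.zipWith ℕ._∸_ q p) ρ

  open Reflection G.setoid var ⟦_⟧ ⟦_⇓⟧ correct public using (solve; _⊜_)

module Homology {c ℓ : Level} (K : Field c ℓ) where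
  open Field K

  -- Linear algebra over a field without decidable equality

  Space : Set _
  Space = LeftModule ring c ℓ

  ∣_∣ : Space → Set c
  ∣ V ∣ = LeftModule.Carrierᴹ V

  𝕂 : Space
  𝕂 = TensorUnit.leftModule {R = ring}

  record Lin (A B : Space) : Set (c ⊔ ℓ) where
    private
      module A = LeftModule A
      module B = LeftModule B
    infixr 9 _⟨$⟩_
    field
      _⟨$⟩_  : ∣ A ∣ → ∣ B ∣
      cong   : ∀ {v w} → v A.≈ᴹ w → _⟨$⟩_ v B.≈ᴹ _⟨$⟩_ w
      +-homo : ∀ v w → _⟨$⟩_ (v A.+ᴹ w) B.≈ᴹ _⟨$⟩_ v B.+ᴹ _⟨$⟩_ w
      *-homo : ∀ a v → _⟨$⟩_ (a A.*ₗ v) B.≈ᴹ a B.*ₗ _⟨$⟩_ v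

    0-homo : _⟨$⟩_ A.0ᴹ B.≈ᴹ B.0ᴹ
    0-homo = B.≈ᴹ-trans (cong (A.≈ᴹ-sym (A.*ₗ-zeroˡ _))) (B.≈ᴹ-trans (*-homo 0# A.0ᴹ) (B.*ₗ-zeroˡ _))

    ≈0-homo : ∀ {v} → v A.≈ᴹ A.0ᴹ → _⟨$⟩_ v B.≈ᴹ B.0ᴹ
    ≈0-homo v≈0 = B.≈ᴹ-trans (cong v≈0) 0-homo

    -‿homo : ∀ v → _⟨$⟩_ (A.-ᴹ v) B.≈ᴹ B.-ᴹ (_⟨$⟩_ v)
    -‿homo v = B.≈ᴹ-trans (solve 2 (λ x y → x ⊜ (y ⊕ x) ⊝ y) B.≈ᴹ-refl _ _)
      (B.≈ᴹ-trans (B.+ᴹ-congʳ (B.≈ᴹ-trans (B.≈ᴹ-sym (+-homo v (A.-ᴹ v))) (≈0-homo (A.-ᴹ‿inverseʳ v)))) (B.+ᴹ-identityˡ _))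
      where open AbelianGroupSolver B.+ᴹ-abelianGroup

    −-homo : ∀ v w → _⟨$⟩_ (v A.+ᴹ A.-ᴹ w) B.≈ᴹ _⟨$⟩_ v B.+ᴹ B.-ᴹ (_⟨$⟩_ w)
    −-homo v w = B.≈ᴹ-trans (+-homo v _) (B.+ᴹ-congˡ (-‿homo w))

  open Lin public using (_⟨$⟩_)

  module ScalarProperties (V : Space) where
    open LeftModule V

    scale : Carrier → Lin V V
    scale a = record
      { _⟨$⟩_ = a *ₗ_
      ; cong = *ₗ-congˡ
      ; +-homo = *ₗ-distribˡ a
      ; *-homo = λ b v → ≈ᴹ-trans (≈ᴹ-sym (*ₗ-assoc a b v)) (≈ᴹ-trans (*ₗ-congʳ (*-comm a b)) (*ₗ-assoc b a v))
      }

    *ₗ-negʳ : ∀ a v → a *ₗ (-ᴹ v) ≈ᴹ -ᴹ (a *ₗ v)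
    *ₗ-negʳ a = Lin.-‿homo (scale a)

    *ₗ-negˡ : ∀ a v → (- a) *ₗ v ≈ᴹ -ᴹ (a *ₗ v)
    *ₗ-negˡ a v = ≈ᴹ-trans (solve 2 (λ x y → x ⊜ (y ⊕ x) ⊝ y) ≈ᴹ-refl _ _)
      (≈ᴹ-trans (+ᴹ-congʳ (≈ᴹ-trans (≈ᴹ-sym (*ₗ-distribʳ v a (- a))) (≈ᴹ-trans (*ₗ-congʳ (-‿inverseʳ a)) (*ₗ-zeroˡ v)))) (+ᴹ-identityˡ _))
      where open AbelianGroupSolver +ᴹ-abelianGroup

    *ₗ-cancel-unit : ∀ a b v → a * b ≈ 1# → b *ₗ v ≈ᴹ 0ᴹ → v ≈ᴹ 0ᴹ
    *ₗ-cancel-unit a b v ab bv≈0 = begin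
      v               ≈⟨ *ₗ-identityˡ v ⟨
      1# *ₗ v         ≈⟨ *ₗ-congʳ ab ⟨
      (a * b) *ₗ v    ≈⟨ *ₗ-assoc a b v ⟩
      a *ₗ (b *ₗ v)   ≈⟨ *ₗ-congˡ bv≈0 ⟩
      a *ₗ 0ᴹ         ≈⟨ *ₗ-zeroʳ a ⟩
      0ᴹ              ∎
      where open SetoidReasoning ≈ᴹ-setoid

  -- `f ⊗ v` stands for the map sending `w` to `f(w) v`. A list of N of them is an operator
  -- factoring through N-dimensional space, so list length takes the place of rank and dimension.
  record Tensor (A B : Space) : Set (c ⊔ ℓ) where
    constructor _⊗_
    field
      functional : Lin A 𝕂
      vector     : ∣ B ∣

  open Tensor public

  module _ {A B : Space} where
    private
      module A = LeftModule A
      module B = LeftModule B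
    open AbelianGroupSolver B.+ᴹ-abelianGroup

    0ᴸ : Lin A B
    0ᴸ = record
      { _⟨$⟩_ = λ _ → B.0ᴹ
      ; cong = λ _ → B.≈ᴹ-refl
      ; +-homo = λ _ _ → B.≈ᴹ-sym (B.+ᴹ-identityˡ _)
      ; *-homo = λ a _ → B.≈ᴹ-sym (B.*ₗ-zeroʳ a)
      }

    infixl 6 _+ᴸ_ _−ᴸ_
    _+ᴸ_ : Lin A B → Lin A B → Lin A B
    f +ᴸ g = record
      { _⟨$⟩_ = λ v → f ⟨$⟩ v B.+ᴹ g ⟨$⟩ v
      ; cong = λ e → B.+ᴹ-cong (Lin.cong f e) (Lin.cong g e)
      ; +-homo = λ v w → B.≈ᴹ-trans (B.+ᴹ-cong (Lin.+-homo f v w) (Lin.+-homo g v w))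
          (solve 4 (λ x y z w → (x ⊕ y) ⊕ (z ⊕ w) ⊜ (x ⊕ z) ⊕ (y ⊕ w)) B.≈ᴹ-refl _ _ _ _)
      ; *-homo = λ a v → B.≈ᴹ-trans (B.+ᴹ-cong (Lin.*-homo f a v) (Lin.*-homo g a v)) (B.≈ᴹ-sym (B.*ₗ-distribˡ a _ _))
      }

    -ᴸ_ : Lin A B → Lin A B
    -ᴸ f = record
      { _⟨$⟩_ = λ v → B.-ᴹ (f ⟨$⟩ v)
      ; cong = λ e → B.-ᴹ‿cong (Lin.cong f e)
      ; +-homo = λ v w → B.≈ᴹ-trans (B.-ᴹ‿cong (Lin.+-homo f v w))
          (solve 2 (λ x y → ⊖ (x ⊕ y) ⊜ ⊖ x ⊕ ⊖ y) B.≈ᴹ-refl _ _)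
      ; *-homo = λ a v → B.≈ᴹ-trans (B.-ᴹ‿cong (Lin.*-homo f a v)) (B.≈ᴹ-sym (ScalarProperties.*ₗ-negʳ B a _))
      }

    _−ᴸ_ : Lin A B → Lin A B → Lin A B
    f −ᴸ g = f +ᴸ (-ᴸ g)

    rank₁ : Lin A 𝕂 → ∣ B ∣ → Lin A B
    rank₁ f b = record
      { _⟨$⟩_ = λ v → (f ⟨$⟩ v) B.*ₗ b
      ; cong = λ e → B.*ₗ-congʳ (Lin.cong f e)
      ; +-homo = λ v w → B.≈ᴹ-trans (B.*ₗ-congʳ (Lin.+-homo f v w)) (B.*ₗ-distribʳ b _ _)
      ; *-homo = λ a v → B.≈ᴹ-trans (B.*ₗ-congʳ (Lin.*-homo f a v)) (B.*ₗ-assoc a _ b)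
      }

    Σ⊗ : List (Tensor A B) → Lin A B
    Σ⊗ [] = 0ᴸ
    Σ⊗ ((f ⊗ b) ∷ L) = rank₁ f b +ᴸ Σ⊗ L

    Σ⊗-++ : ∀ L M v → Σ⊗ (L ++ M) ⟨$⟩ v B.≈ᴹ Σ⊗ L ⟨$⟩ v B.+ᴹ Σ⊗ M ⟨$⟩ v
    Σ⊗-++ [] M v = B.≈ᴹ-sym (B.+ᴹ-identityˡ _)
    Σ⊗-++ (_ ∷ L) M v = B.≈ᴹ-trans (B.+ᴹ-congˡ (Σ⊗-++ L M v)) (B.≈ᴹ-sym (B.+ᴹ-assoc _ _ _))

    Σ⊗-vanish : ∀ (L : List (Tensor A B)) v → All (λ t → functional t ⟨$⟩ v ≈ 0#) L → Σ⊗ L ⟨$⟩ v B.≈ᴹ B.0ᴹ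
    Σ⊗-vanish [] v [] = B.≈ᴹ-refl
    Σ⊗-vanish ((f ⊗ b) ∷ L) v (fv≈0 ∷ L≈0) =
      B.≈ᴹ-trans (B.+ᴹ-cong (B.≈ᴹ-trans (B.*ₗ-congʳ fv≈0) (B.*ₗ-zeroˡ b)) (Σ⊗-vanish L v L≈0)) (B.+ᴹ-identityˡ _)

  tensors : ∀ {A} B → List (Lin A 𝕂) → List ∣ B ∣ → List (Tensor A B)
  tensors B (f ∷ fs) (b ∷ bs) = (f ⊗ b) ∷ tensors B fs bs
  tensors B _ _ = []

  idᴸ : ∀ {A} → Lin A A
  idᴸ {A} = record { _⟨$⟩_ = id ; cong = id ; +-homo = λ _ _ → ≈ᴹ-refl ; *-homo = λ _ _ → ≈ᴹ-refl }
    where open LeftModule A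

  infixr 9 _∘ᴸ_
  _∘ᴸ_ : ∀ {A B C} → Lin B C → Lin A B → Lin A C
  _∘ᴸ_ {C = C} f g = record
    { _⟨$⟩_ = λ v → f ⟨$⟩ g ⟨$⟩ v
    ; cong = λ e → Lin.cong f (Lin.cong g e)
    ; +-homo = λ v w → ≈ᴹ-trans (Lin.cong f (Lin.+-homo g v w)) (Lin.+-homo f _ _)
    ; *-homo = λ a v → ≈ᴹ-trans (Lin.cong f (Lin.*-homo g a v)) (Lin.*-homo f a _)
    }
    where open LeftModule C

  module _ {A B C : Space} where
    private
      module B = LeftModule B
      module C = LeftModule C

    pre : Lin A B → List (Tensor B C) → List (Tensor A C)
    pre T = map λ t → (functional t ∘ᴸ T) ⊗ vector t

    Σ⊗-pre : ∀ T L v → Σ⊗ (pre T L) ⟨$⟩ v C.≈ᴹ Σ⊗ L ⟨$⟩ T ⟨$⟩ v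
    Σ⊗-pre T [] v = C.≈ᴹ-refl
    Σ⊗-pre T (_ ∷ L) v = C.+ᴹ-congˡ (Σ⊗-pre T L v)

    post : Lin B C → List (Tensor A B) → List (Tensor A C)
    post T = map λ t → functional t ⊗ (T ⟨$⟩ vector t)

    Σ⊗-post : ∀ T L v → Σ⊗ (post T L) ⟨$⟩ v C.≈ᴹ T ⟨$⟩ Σ⊗ L ⟨$⟩ v
    Σ⊗-post T [] v = C.≈ᴹ-sym (Lin.0-homo T)
    Σ⊗-post T ((f ⊗ b) ∷ L) v = C.≈ᴹ-sym (C.≈ᴹ-trans (Lin.+-homo T _ _)
      (C.+ᴹ-cong (Lin.*-homo T _ b) (C.≈ᴹ-sym (Σ⊗-post T L v))))

    Σ⊗-tensors-post : ∀ (T : Lin B C) (fs : List (Lin A 𝕂)) bs v →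
      Σ⊗ (tensors C fs (map (T ⟨$⟩_) bs)) ⟨$⟩ v C.≈ᴹ T ⟨$⟩ Σ⊗ (tensors B fs bs) ⟨$⟩ v
    Σ⊗-tensors-post T [] bs v = C.≈ᴹ-sym (Lin.0-homo T)
    Σ⊗-tensors-post T (f ∷ fs) [] v = C.≈ᴹ-sym (Lin.0-homo T)
    Σ⊗-tensors-post T (f ∷ fs) (b ∷ bs) v = C.≈ᴹ-sym (C.≈ᴹ-trans (Lin.+-homo T _ _)
      (C.+ᴹ-cong (Lin.*-homo T _ b) (C.≈ᴹ-sym (Σ⊗-tensors-post T fs bs v))))

  -- Linear independence and Steinitz exchange.

  module Independence (V : Space) where
    open LeftModule V
    open ScalarProperties V
    open AbelianGroupSolver +ᴹ-abelianGroup
    open SetoidReasoning ≈ᴹ-setoid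

    comb : List Carrier → List ∣ V ∣ → ∣ V ∣
    comb [] _ = 0ᴹ
    comb (_ ∷ _) [] = 0ᴹ
    comb (a ∷ as) (v ∷ vs) = a *ₗ v +ᴹ comb as vs

    LinIndep : List ∣ V ∣ → Set (c ⊔ ℓ)
    LinIndep vs = ∀ as → length as ≡ length vs → comb as vs ≈ᴹ 0ᴹ → All (_≈ 0#) as

    LinIndep-tail : ∀ {v vs} → LinIndep (v ∷ vs) → LinIndep vs
    LinIndep-tail ind as len eq = All.tail (ind (0# ∷ as) (≡.cong suc len)
      (≈ᴹ-trans (+ᴹ-cong (*ₗ-zeroˡ _) eq) (+ᴹ-identityˡ _)))

    comb-zero : ∀ as vs → All (_≈ 0#) as → comb as vs ≈ᴹ 0ᴹ
    comb-zero [] vs _ = ≈ᴹ-refl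
    comb-zero (a ∷ as) [] _ = ≈ᴹ-refl
    comb-zero (a ∷ as) (v ∷ vs) (a≈0 ∷ as≈0) =
      ≈ᴹ-trans (+ᴹ-cong (≈ᴹ-trans (*ₗ-congʳ a≈0) (*ₗ-zeroˡ v)) (comb-zero as vs as≈0)) (+ᴹ-identityˡ _)

    comb-zip : ∀ (fs : List (Lin V 𝕂)) vs v → - 1# *ₗ Σ⊗ (tensors V fs vs) ⟨$⟩ v ≈ᴹ comb (map (λ f → - (f ⟨$⟩ v)) fs) vs
    comb-zip [] vs v = *ₗ-zeroʳ _
    comb-zip (f ∷ fs) [] v = *ₗ-zeroʳ _
    comb-zip (f ∷ fs) (w ∷ vs) v = ≈ᴹ-trans (*ₗ-distribˡ _ _ _)
      (+ᴹ-cong (≈ᴹ-trans (≈ᴹ-sym (*ₗ-assoc _ _ _)) (*ₗ-congʳ (-1*x≈-x ring _))) (comb-zip fs vs v))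

    -- The invariant of the exchange: the identity of `V` as a sum of `M` tensors, some of which
    -- carry the prescribed vectors `vs`. By `kills`, the remaining functionals vanish on the span
    -- of `vs`; for columns of a matrix this later gives a generalized inverse.
    record Split (M : ℕ) (vs : List ∣ V ∣) : Set (c ⊔ ℓ) where
      field
        fs      : List (Lin V 𝕂)
        fs-len  : length fs ≡ length vs
        rest    : List (Tensor V V)
        total   : length vs ℕ.+ length rest ≡ M
        split   : ∀ v → v ≈ᴹ Σ⊗ (tensors V fs vs) ⟨$⟩ v +ᴹ Σ⊗ rest ⟨$⟩ v
        kills   : All (λ v → All (λ t → functional t ⟨$⟩ v ≈ 0#) rest) vs

    private
      -- Excluded middle for `≈ 0#` holds under double negation, and a finite list needs it only
      -- finitely often.
      zeros-or-nonzero : ∀ (L : List (Tensor V V)) v →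
        ¬ ¬ (All (λ t → functional t ⟨$⟩ v ≈ 0#) L ⊎ Any (λ t → ¬ (functional t ⟨$⟩ v ≈ 0#)) L)
      zeros-or-nonzero [] v k = k (inj₁ [])
      zeros-or-nonzero (t ∷ L) v k = ¬¬-excluded-middle λ where
        (no t≉0) → k (inj₂ (here t≉0))
        (yes t≈0) → zeros-or-nonzero L v λ where
          (inj₁ L≈0) → k (inj₁ (t≈0 ∷ L≈0))
          (inj₂ L≉0) → k (inj₂ (there L≉0))

      Any-∃++ : ∀ {p} {A : Set (c ⊔ ℓ)} {P : A → Set p} {xs : List A} → Any P xs →
        Σ (List A) λ ys → Σ A λ x → Σ (List A) λ zs → P x × xs ≡ ys ++ x ∷ zs
      Any-∃++ (here px) = [] , _ , _ , px , ≡.refl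
      Any-∃++ (there pxs) with Any-∃++ pxs
      ... | ys , x , zs , px , ≡.refl = _ ∷ ys , x , zs , px , ≡.refl

      -- Pivoting on `l ⊗ u` with `l(w)` invertible. The functional `λw` is `l` scaled to take the
      -- value 1 at `w`; each other `f` becomes `f - f(w) λw`, which vanishes at `w`. The tensor
      -- `λw ⊗ w` replaces `l ⊗ u`, so the total number is unchanged.
      exchange : ∀ {M w vs} (S : Split M vs) → Any (λ t → ¬ (functional t ⟨$⟩ w ≈ 0#)) (Split.rest S) → Split M (w ∷ vs)
      exchange {M} {w} {vs} S any≉0 with Any-∃++ any≉0
      ... | xs , (l ⊗ u) , ys , lw≉0 , rest≡ = record
        { fs = λw ∷ map upd fs
        ; fs-len = ≡.cong suc (≡.trans (length-map upd fs) fs-len)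
        ; rest = map updᵗ (xs ++ ys)
        ; total = total′
        ; split = split′
        ; kills = All.map⁺ (All.tabulate λ {t} _ → upd-w (functional t)) ∷ All.map kills′ kills
        }
        where
        open Split S
        b : Carrier
        b = proj₁ (inverse _ lw≉0)
        λw : Lin V 𝕂
        λw = rank₁ {V} {𝕂} l b
        λw-w : λw ⟨$⟩ w ≈ 1#
        λw-w = proj₂ (inverse _ lw≉0)
        upd : Lin V 𝕂 → Lin V 𝕂
        upd f = f −ᴸ rank₁ {V} {𝕂} λw (f ⟨$⟩ w)
        updᵗ : Tensor V V → Tensor V V
        updᵗ t = upd (functional t) ⊗ vector t
        upd-w : ∀ f → upd f ⟨$⟩ w ≈ 0#
        upd-w f = trans (+-congˡ (-‿cong (trans (*-congʳ λw-w) (*-identityˡ _)))) (-‿inverseʳ _)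
        total′ : suc (length vs) ℕ.+ length (map updᵗ (xs ++ ys)) ≡ M
        total′ = ≡.trans (≡.cong (suc (length vs) ℕ.+_) (≡.trans (length-map updᵗ (xs ++ ys)) (length-++ xs)))
          (≡.trans (≡.sym (ℕ.+-suc (length vs) _))
          (≡.trans (≡.cong (length vs ℕ.+_) (≡.trans (≡.sym (ℕ.+-suc (length xs) (length ys))) (≡.sym (length-++ xs))))
          (≡.trans (≡.cong (λ r → length vs ℕ.+ length r) (≡.sym rest≡)) total)))
        kills′ : ∀ {v} → All (λ t → functional t ⟨$⟩ v ≈ 0#) rest → All (λ t → functional t ⟨$⟩ v ≈ 0#) (map updᵗ (xs ++ ys))
        kills′ {v} z = All.map⁺ (All.map (λ {t} → upd≈0 {t}) (All.++⁺ (All.++⁻ˡ xs z′) (All.tail (All.++⁻ʳ xs z′))))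
          where
          z′ : All (λ t → functional t ⟨$⟩ v ≈ 0#) (xs ++ (l ⊗ u) ∷ ys)
          z′ = ≡.subst (All _) rest≡ z
          lv≈0 : l ⟨$⟩ v ≈ 0#
          lv≈0 = All.head (All.++⁻ʳ xs z′)
          upd≈0 : ∀ {t : Tensor V V} → functional t ⟨$⟩ v ≈ 0# → upd (functional t) ⟨$⟩ v ≈ 0#
          upd≈0 tv≈0 = trans (+-cong tv≈0 (-‿cong (trans (*-congʳ (trans (*-congʳ lv≈0) (zeroˡ b))) (zeroˡ _)))) (-‿inverseʳ 0#)
        term : ∀ f x v → upd f ⟨$⟩ v *ₗ x ≈ᴹ f ⟨$⟩ v *ₗ x +ᴹ -ᴹ (λw ⟨$⟩ v *ₗ (f ⟨$⟩ w *ₗ x))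
        term f x v = begin
          (f ⟨$⟩ v + - (λw ⟨$⟩ v * f ⟨$⟩ w)) *ₗ x               ≈⟨ *ₗ-distribʳ _ _ _ ⟩
          f ⟨$⟩ v *ₗ x +ᴹ (- (λw ⟨$⟩ v * f ⟨$⟩ w)) *ₗ x         ≈⟨ +ᴹ-congˡ (*ₗ-negˡ _ x) ⟩
          f ⟨$⟩ v *ₗ x +ᴹ -ᴹ ((λw ⟨$⟩ v * f ⟨$⟩ w) *ₗ x)        ≈⟨ +ᴹ-congˡ (-ᴹ‿cong (*ₗ-assoc _ _ x)) ⟩
          f ⟨$⟩ v *ₗ x +ᴹ -ᴹ (λw ⟨$⟩ v *ₗ (f ⟨$⟩ w *ₗ x))       ∎
        step : ∀ f x v y z → y ≈ᴹ z +ᴹ -ᴹ (λw ⟨$⟩ v *ₗ x) → ∀ x′ →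
          upd f ⟨$⟩ v *ₗ x′ +ᴹ y ≈ᴹ (f ⟨$⟩ v *ₗ x′ +ᴹ z) +ᴹ -ᴹ (λw ⟨$⟩ v *ₗ (f ⟨$⟩ w *ₗ x′ +ᴹ x))
        step f x v y z e x′ = ≈ᴹ-trans (+ᴹ-cong (term f x′ v) e) (≈ᴹ-trans
          (solve 4 (λ a b c d → (a ⊝ b) ⊕ (c ⊝ d) ⊜ (a ⊕ c) ⊝ (b ⊕ d)) ≈ᴹ-refl _ _ _ _)
          (+ᴹ-congˡ (-ᴹ‿cong (≈ᴹ-sym (*ₗ-distribˡ _ _ _)))))
        nil : ∀ v → 0ᴹ ≈ᴹ 0ᴹ +ᴹ -ᴹ (λw ⟨$⟩ v *ₗ 0ᴹ)
        nil v = ≈ᴹ-trans (≈ᴹ-sym (-ᴹ‿inverseʳ 0ᴹ)) (+ᴹ-congˡ (-ᴹ‿cong (≈ᴹ-sym (*ₗ-zeroʳ _))))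
        Σ⊗-upd : ∀ L v → Σ⊗ (map updᵗ L) ⟨$⟩ v ≈ᴹ Σ⊗ L ⟨$⟩ v +ᴹ -ᴹ (λw ⟨$⟩ v *ₗ Σ⊗ L ⟨$⟩ w)
        Σ⊗-upd [] v = nil v
        Σ⊗-upd ((f ⊗ x) ∷ L) v = step f _ v _ _ (Σ⊗-upd L v) x
        Σ⊗-zip-upd : ∀ gs xs v → Σ⊗ (tensors V (map upd gs) xs) ⟨$⟩ v ≈ᴹ Σ⊗ (tensors V gs xs) ⟨$⟩ v +ᴹ -ᴹ (λw ⟨$⟩ v *ₗ Σ⊗ (tensors V gs xs) ⟨$⟩ w)
        Σ⊗-zip-upd [] xs v = nil v
        Σ⊗-zip-upd (f ∷ gs) [] v = nil v
        Σ⊗-zip-upd (f ∷ gs) (x ∷ xs) v = step f _ v _ _ (Σ⊗-zip-upd gs xs v) x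
        split-at : ∀ v → v ≈ᴹ Σ⊗ (tensors V fs vs) ⟨$⟩ v +ᴹ (Σ⊗ (xs ++ ys) ⟨$⟩ v +ᴹ l ⟨$⟩ v *ₗ u)
        split-at v = begin
          v ≈⟨ split v ⟩
          Σ⊗ (tensors V fs vs) ⟨$⟩ v +ᴹ Σ⊗ rest ⟨$⟩ v
            ≡⟨ ≡.cong (λ r → Σ⊗ (tensors V fs vs) ⟨$⟩ v +ᴹ Σ⊗ r ⟨$⟩ v) rest≡ ⟩
          Σ⊗ (tensors V fs vs) ⟨$⟩ v +ᴹ Σ⊗ (xs ++ (l ⊗ u) ∷ ys) ⟨$⟩ v
            ≈⟨ +ᴹ-congˡ (Σ⊗-++ xs ((l ⊗ u) ∷ ys) v) ⟩
          Σ⊗ (tensors V fs vs) ⟨$⟩ v +ᴹ (Σ⊗ xs ⟨$⟩ v +ᴹ (l ⟨$⟩ v *ₗ u +ᴹ Σ⊗ ys ⟨$⟩ v))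
            ≈⟨ +ᴹ-congˡ (solve 3 (λ x y z → x ⊕ (y ⊕ z) ⊜ (x ⊕ z) ⊕ y) ≈ᴹ-refl _ _ _) ⟩
          Σ⊗ (tensors V fs vs) ⟨$⟩ v +ᴹ ((Σ⊗ xs ⟨$⟩ v +ᴹ Σ⊗ ys ⟨$⟩ v) +ᴹ l ⟨$⟩ v *ₗ u)
            ≈⟨ +ᴹ-congˡ (+ᴹ-congʳ (Σ⊗-++ xs ys v)) ⟨
          Σ⊗ (tensors V fs vs) ⟨$⟩ v +ᴹ (Σ⊗ (xs ++ ys) ⟨$⟩ v +ᴹ l ⟨$⟩ v *ₗ u) ∎
        unscale : ∀ v → λw ⟨$⟩ v *ₗ (l ⟨$⟩ w *ₗ u) ≈ᴹ l ⟨$⟩ v *ₗ u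
        unscale v = begin
          (l ⟨$⟩ v * b) *ₗ (l ⟨$⟩ w *ₗ u)   ≈⟨ *ₗ-assoc _ _ u ⟨
          ((l ⟨$⟩ v * b) * l ⟨$⟩ w) *ₗ u    ≈⟨ *ₗ-congʳ (trans (*-assoc _ _ _) (*-congˡ (trans (*-comm _ _) λw-w))) ⟩
          (l ⟨$⟩ v * 1#) *ₗ u               ≈⟨ *ₗ-congʳ (*-identityʳ _) ⟩
          l ⟨$⟩ v *ₗ u                      ∎
        split′ : ∀ v → v ≈ᴹ (λw ⟨$⟩ v *ₗ w +ᴹ Σ⊗ (tensors V (map upd fs) vs) ⟨$⟩ v) +ᴹ Σ⊗ (map updᵗ (xs ++ ys)) ⟨$⟩ v
        -- Expanding `w` by the old identity produces exactly the terms that `upd` subtracts, and in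
        -- addition the lost pivot term, by `unscale`.
        split′ v = ≈ᴹ-sym (begin
          (k *ₗ w +ᴹ Σ⊗ (tensors V (map upd fs) vs) ⟨$⟩ v) +ᴹ Σ⊗ (map updᵗ (xs ++ ys)) ⟨$⟩ v
            ≈⟨ +ᴹ-cong (+ᴹ-cong (*ₗ-congˡ (split-at w)) (Σ⊗-zip-upd fs vs v)) (Σ⊗-upd (xs ++ ys) v) ⟩
          (k *ₗ (Fw +ᴹ (Rw +ᴹ l ⟨$⟩ w *ₗ u)) +ᴹ (Fv +ᴹ -ᴹ (k *ₗ Fw))) +ᴹ (Rv +ᴹ -ᴹ (k *ₗ Rw))
            ≈⟨ +ᴹ-congʳ (+ᴹ-congʳ (≈ᴹ-trans (*ₗ-distribˡ _ _ _) (+ᴹ-congˡ (≈ᴹ-trans (*ₗ-distribˡ _ _ _) (+ᴹ-congˡ (unscale v)))))) ⟩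
          ((k *ₗ Fw +ᴹ (k *ₗ Rw +ᴹ l ⟨$⟩ v *ₗ u)) +ᴹ (Fv +ᴹ -ᴹ (k *ₗ Fw))) +ᴹ (Rv +ᴹ -ᴹ (k *ₗ Rw))
            ≈⟨ solve 5 (λ a b c d e → ((a ⊕ (b ⊕ c)) ⊕ (d ⊝ a)) ⊕ (e ⊝ b) ⊜ d ⊕ (e ⊕ c)) ≈ᴹ-refl _ _ _ _ _ ⟩
          Fv +ᴹ (Rv +ᴹ l ⟨$⟩ v *ₗ u)
            ≈⟨ split-at v ⟨
          v ∎)
          where
          k : Carrier
          k = λw ⟨$⟩ v
          Fv Fw Rv Rw : ∣ V ∣
          Fv = Σ⊗ (tensors V fs vs) ⟨$⟩ v
          Fw = Σ⊗ (tensors V fs vs) ⟨$⟩ w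
          Rv = Σ⊗ (xs ++ ys) ⟨$⟩ v
          Rw = Σ⊗ (xs ++ ys) ⟨$⟩ w

    -- The vectors are absorbed from the last to the first. If all remaining functionals vanished at
    -- the next vector `w`, then `w` would lie in the span of `vs`; hence one of them is a pivot. In
    -- particular `length vs` is at most `length U`.
    steinitz : ∀ (U : List (Tensor V V)) → (∀ v → v ≈ᴹ Σ⊗ U ⟨$⟩ v) → ∀ vs → LinIndep vs → ¬ ¬ Split (length U) vs
    steinitz U id≈U [] ind k = k record
      { fs = []
      ; fs-len = ≡.refl
      ; rest = U
      ; total = ≡.refl
      ; split = λ v → ≈ᴹ-trans (id≈U v) (≈ᴹ-sym (+ᴹ-identityˡ _))
      ; kills = []
      }
    steinitz U id≈U (w ∷ vs) ind k = steinitz U id≈U vs (LinIndep-tail ind) λ S →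
      zeros-or-nonzero (Split.rest S) w λ where
        (inj₂ any≉0) → k (exchange S any≉0)
        (inj₁ all≈0) → spanned S all≈0
      where
      spanned : (S : Split (length U) vs) → All (λ t → functional t ⟨$⟩ w ≈ 0#) (Split.rest S) → ⊥
      -- The relation is `w` minus its expansion in `vs`; its leading coefficient is 1.
      spanned S all≈0 = 0≉1 (sym (All.head (ind (1# ∷ map (λ f → - (f ⟨$⟩ w)) fs)
        (≡.cong suc (≡.trans (length-map _ fs) fs-len)) (begin
          1# *ₗ w +ᴹ comb (map (λ f → - (f ⟨$⟩ w)) fs) vs
            ≈⟨ +ᴹ-cong (*ₗ-identityˡ w) (≈ᴹ-sym (comb-zip fs vs w)) ⟩
          w +ᴹ - 1# *ₗ Σ⊗ (tensors V fs vs) ⟨$⟩ w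
            ≈⟨ +ᴹ-congˡ (≈ᴹ-trans (*ₗ-negˡ 1# _) (-ᴹ‿cong (*ₗ-identityˡ _))) ⟩
          w +ᴹ -ᴹ (Σ⊗ (tensors V fs vs) ⟨$⟩ w)
            ≈⟨ +ᴹ-congʳ (≈ᴹ-trans (split w) (≈ᴹ-trans (+ᴹ-congˡ (Σ⊗-vanish rest w all≈0)) (+ᴹ-identityʳ _))) ⟩
          Σ⊗ (tensors V fs vs) ⟨$⟩ w +ᴹ -ᴹ (Σ⊗ (tensors V fs vs) ⟨$⟩ w)
            ≈⟨ -ᴹ‿inverseʳ _ ⟩
          0ᴹ ∎))))
        where open Split S

  -- Concerns the single spot `C₁`: `s` and `t` may come from unrelated homotopies. A cycle on which
  -- the functionals of `residue` vanish equals `d₂ s v`, so homology at `C₁` has dimension at most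
  -- `N`.
  record Contraction {C₂ C₁ C₀ : Space} (d₂ : Lin C₂ C₁) (d₁ : Lin C₁ C₀) (N : ℕ) : Set (c ⊔ ℓ) where
    open LeftModule C₁
    field
      s        : Lin C₁ C₂
      t        : Lin C₀ C₁
      residue  : List (Tensor C₁ C₁)
      size     : length residue ≡ N
      homotopy : ∀ v → v ≈ᴹ (d₂ ⟨$⟩ s ⟨$⟩ v +ᴹ t ⟨$⟩ d₁ ⟨$⟩ v) +ᴹ Σ⊗ residue ⟨$⟩ v

  module _ {C₂ C₁ C₀ E₂ E₁ E₀ : Space}
    {d₂ : Lin C₂ C₁} {d₁ : Lin C₁ C₀} {e₂ : Lin E₂ E₁} {e₁ : Lin E₁ E₀}
    where
    private
      module C₁ = LeftModule C₁
      module C₀ = LeftModule C₀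
      module E₁ = LeftModule E₁
      module E₀ = LeftModule E₀

    -- The identity for E is sandwiched between `ψ₁` and `φ₁`. The squares out of `C₁` move `φ` past
    -- `e₁`, and those into `C₁` move `ψ` past `e₂`.
    retract : (φ₁ : Lin C₁ E₁) (φ₀ : Lin C₀ E₀) (ψ₂ : Lin E₂ C₂) (ψ₁ : Lin E₁ C₁) →
      (∀ v → e₁ ⟨$⟩ φ₁ ⟨$⟩ v E₀.≈ᴹ φ₀ ⟨$⟩ d₁ ⟨$⟩ v) →
      (∀ v → d₂ ⟨$⟩ ψ₂ ⟨$⟩ v C₁.≈ᴹ ψ₁ ⟨$⟩ e₂ ⟨$⟩ v) →
      (∀ v → ψ₁ ⟨$⟩ φ₁ ⟨$⟩ v C₁.≈ᴹ v) →
      ∀ {N} → Contraction e₂ e₁ N → Contraction d₂ d₁ N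
    retract φ₁ φ₀ ψ₂ ψ₁ φ-chain ψ-chain ψφ≈id con = record
      { s = ψ₂ ∘ᴸ s ∘ᴸ φ₁
      ; t = ψ₁ ∘ᴸ t ∘ᴸ φ₀
      ; residue = post ψ₁ (pre φ₁ residue)
      ; size = ≡.trans (length-map _ (pre φ₁ residue)) (≡.trans (length-map _ residue) size)
      ; homotopy = λ v → begin
          v ≈⟨ ψφ≈id v ⟨
          ψ₁ ⟨$⟩ φ₁ ⟨$⟩ v
            ≈⟨ Lin.cong ψ₁ (homotopy (φ₁ ⟨$⟩ v)) ⟩
          ψ₁ ⟨$⟩ ((e₂ ⟨$⟩ s ⟨$⟩ φ₁ ⟨$⟩ v E₁.+ᴹ t ⟨$⟩ e₁ ⟨$⟩ φ₁ ⟨$⟩ v) E₁.+ᴹ Σ⊗ residue ⟨$⟩ φ₁ ⟨$⟩ v)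
            ≈⟨ C₁.≈ᴹ-trans (Lin.+-homo ψ₁ _ _) (C₁.+ᴹ-congʳ (Lin.+-homo ψ₁ _ _)) ⟩
          (ψ₁ ⟨$⟩ e₂ ⟨$⟩ s ⟨$⟩ φ₁ ⟨$⟩ v C₁.+ᴹ ψ₁ ⟨$⟩ t ⟨$⟩ e₁ ⟨$⟩ φ₁ ⟨$⟩ v) C₁.+ᴹ ψ₁ ⟨$⟩ Σ⊗ residue ⟨$⟩ φ₁ ⟨$⟩ v
            ≈⟨ C₁.+ᴹ-cong (C₁.+ᴹ-cong (C₁.≈ᴹ-sym (ψ-chain _)) (Lin.cong (ψ₁ ∘ᴸ t) (φ-chain v)))
                 (C₁.≈ᴹ-sym (C₁.≈ᴹ-trans (Σ⊗-post ψ₁ (pre φ₁ residue) v) (Lin.cong ψ₁ (Σ⊗-pre φ₁ residue v)))) ⟩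
          (d₂ ⟨$⟩ ψ₂ ⟨$⟩ s ⟨$⟩ φ₁ ⟨$⟩ v C₁.+ᴹ ψ₁ ⟨$⟩ t ⟨$⟩ φ₀ ⟨$⟩ d₁ ⟨$⟩ v) C₁.+ᴹ Σ⊗ (post ψ₁ (pre φ₁ residue)) ⟨$⟩ v ∎
      }
      where
      open Contraction con
      open SetoidReasoning C₁.≈ᴹ-setoid

  -- A degreewise split extension of complexes, 0 → A → C → B → 0.
  record Extension
    {A₂ A₁ A₀ C₂ C₁ C₀ B₂ B₁ B₀ : Space}
    (a₂ : Lin A₂ A₁) (a₁ : Lin A₁ A₀)
    (d₂ : Lin C₂ C₁) (d₁ : Lin C₁ C₀)
    (b₂ : Lin B₂ B₁) (b₁ : Lin B₁ B₀) : Set (c ⊔ ℓ) where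
    private
      module A₁ = LeftModule A₁
      module A₀ = LeftModule A₀
      module C₁ = LeftModule C₁
      module C₀ = LeftModule C₀
      module B₂ = LeftModule B₂
      module B₁ = LeftModule B₁
      module B₀ = LeftModule B₀
    field
      dd≈0 : ∀ v → d₁ ⟨$⟩ d₂ ⟨$⟩ v C₀.≈ᴹ C₀.0ᴹ
      i₂ : Lin A₂ C₂
      i₁ : Lin A₁ C₁
      i₀ : Lin A₀ C₀
      p₂ : Lin C₂ B₂
      p₁ : Lin C₁ B₁
      p₀ : Lin C₀ B₀
      r₁ : Lin C₁ A₁
      r₀ : Lin C₀ A₀
      j₂ : Lin B₂ C₂
      j₁ : Lin B₁ C₁
      i-chain₂ : ∀ v → d₂ ⟨$⟩ i₂ ⟨$⟩ v C₁.≈ᴹ i₁ ⟨$⟩ a₂ ⟨$⟩ v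
      i-chain₁ : ∀ v → d₁ ⟨$⟩ i₁ ⟨$⟩ v C₀.≈ᴹ i₀ ⟨$⟩ a₁ ⟨$⟩ v
      p-chain₂ : ∀ v → p₁ ⟨$⟩ d₂ ⟨$⟩ v B₁.≈ᴹ b₂ ⟨$⟩ p₂ ⟨$⟩ v
      p-chain₁ : ∀ v → p₀ ⟨$⟩ d₁ ⟨$⟩ v B₀.≈ᴹ b₁ ⟨$⟩ p₁ ⟨$⟩ v
      p₂j₂ : ∀ v → p₂ ⟨$⟩ j₂ ⟨$⟩ v B₂.≈ᴹ v
      p₁j₁ : ∀ v → p₁ ⟨$⟩ j₁ ⟨$⟩ v B₁.≈ᴹ v
      ir+jp : ∀ v → v C₁.≈ᴹ i₁ ⟨$⟩ r₁ ⟨$⟩ v C₁.+ᴹ j₁ ⟨$⟩ p₁ ⟨$⟩ v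
      r₀i₀ : ∀ v → r₀ ⟨$⟩ i₀ ⟨$⟩ v A₀.≈ᴹ v

    -- A perturbation argument. Lifting the contraction of B along `j` leaves an error `x` with
    -- `p₁ x = 0`, so `x = i₁ y`, and the contraction of A applies to `y`. In it, `a₁ y` is
    -- expressed by `d₁ x`: the terms ending in `d₁` go into `T′`, and the other one factors through
    -- the residue of B. It only modifies vectors there, so the sizes simply add.
    extend : ∀ {N N′} → Contraction a₂ a₁ N → Contraction b₂ b₁ N′ → Contraction d₂ d₁ (N′ ℕ.+ N)
    extend {N} {N′} con con′ = record
      { s = S
      ; t = T′
      ; residue = resB ++ resA
      ; size = ≡.trans (length-++ resB) (≡.cong₂ ℕ._+_
          (≡.trans (length-map _ (pre p₁ B.residue)) (≡.trans (length-map _ B.residue) B.size))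
          (≡.trans (length-map _ (pre y A.residue)) (≡.trans (length-map _ A.residue) A.size)))
      ; homotopy = λ v → C₁.≈ᴹ-trans (main v) (C₁.+ᴹ-congˡ (C₁.≈ᴹ-sym
          (C₁.≈ᴹ-trans (Σ⊗-++ resB resA v) (C₁.+ᴹ-cong
            (C₁.≈ᴹ-trans (Σ⊗-post (j₁ −ᴸ i₁ ∘ᴸ corr ∘ᴸ j₁) (pre p₁ B.residue) v) (Lin.cong (j₁ −ᴸ i₁ ∘ᴸ corr ∘ᴸ j₁) (Σ⊗-pre p₁ B.residue v)))
            (C₁.≈ᴹ-trans (Σ⊗-post i₁ (pre y A.residue) v) (Lin.cong i₁ (Σ⊗-pre y A.residue v)))))))
      }
      where
      module A = Contraction con
      module B = Contraction con′
      -- The error left in C by the contraction of B; it comes from A.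
      x : Lin C₁ C₁
      x = idᴸ −ᴸ d₂ ∘ᴸ j₂ ∘ᴸ B.s ∘ᴸ p₁ −ᴸ j₁ ∘ᴸ B.t ∘ᴸ p₀ ∘ᴸ d₁ −ᴸ j₁ ∘ᴸ Σ⊗ B.residue ∘ᴸ p₁
      y : Lin C₁ A₁
      y = r₁ ∘ᴸ x
      -- `r₀ d₁ j₁` represents the connecting map from B to A on cycles; `corr ∘ᴸ j₁` composes it
      -- with the homotopy of A.
      corr : Lin C₁ A₁
      corr = A.t ∘ᴸ r₀ ∘ᴸ d₁
      S : Lin C₁ C₂
      S = i₂ ∘ᴸ A.s ∘ᴸ y +ᴸ j₂ ∘ᴸ B.s ∘ᴸ p₁
      T′ : Lin C₀ C₁
      T′ = j₁ ∘ᴸ B.t ∘ᴸ p₀ +ᴸ i₁ ∘ᴸ A.t ∘ᴸ r₀ −ᴸ i₁ ∘ᴸ corr ∘ᴸ j₁ ∘ᴸ B.t ∘ᴸ p₀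
      resA resB : List (Tensor C₁ C₁)
      resA = post i₁ (pre y A.residue)
      resB = post (j₁ −ᴸ i₁ ∘ᴸ corr ∘ᴸ j₁) (pre p₁ B.residue)

      px≈0 : ∀ v → p₁ ⟨$⟩ x ⟨$⟩ v B₁.≈ᴹ B₁.0ᴹ
      px≈0 v = begin
        p₁ ⟨$⟩ x ⟨$⟩ v
          ≈⟨ B₁.≈ᴹ-trans (Lin.−-homo p₁ _ _) (B₁.+ᴹ-congʳ (B₁.≈ᴹ-trans (Lin.−-homo p₁ _ _) (B₁.+ᴹ-congʳ (Lin.−-homo p₁ _ _)))) ⟩
        ((p₁ ⟨$⟩ v B₁.+ᴹ B₁.-ᴹ (p₁ ⟨$⟩ d₂ ⟨$⟩ j₂ ⟨$⟩ B.s ⟨$⟩ p₁ ⟨$⟩ v)) B₁.+ᴹ B₁.-ᴹ (p₁ ⟨$⟩ j₁ ⟨$⟩ B.t ⟨$⟩ p₀ ⟨$⟩ d₁ ⟨$⟩ v))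
          B₁.+ᴹ B₁.-ᴹ (p₁ ⟨$⟩ j₁ ⟨$⟩ Σ⊗ B.residue ⟨$⟩ p₁ ⟨$⟩ v)
          ≈⟨ B₁.+ᴹ-cong (B₁.+ᴹ-cong (B₁.+ᴹ-cong (B.homotopy (p₁ ⟨$⟩ v))
               (B₁.-ᴹ‿cong (B₁.≈ᴹ-trans (p-chain₂ _) (Lin.cong b₂ (p₂j₂ _)))))
               (B₁.-ᴹ‿cong (B₁.≈ᴹ-trans (p₁j₁ _) (Lin.cong B.t (p-chain₁ v)))))
               (B₁.-ᴹ‿cong (p₁j₁ _)) ⟩
        ((((b₂ ⟨$⟩ B.s ⟨$⟩ p₁ ⟨$⟩ v B₁.+ᴹ B.t ⟨$⟩ b₁ ⟨$⟩ p₁ ⟨$⟩ v) B₁.+ᴹ Σ⊗ B.residue ⟨$⟩ p₁ ⟨$⟩ v)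
          B₁.+ᴹ B₁.-ᴹ (b₂ ⟨$⟩ B.s ⟨$⟩ p₁ ⟨$⟩ v)) B₁.+ᴹ B₁.-ᴹ (B.t ⟨$⟩ b₁ ⟨$⟩ p₁ ⟨$⟩ v)) B₁.+ᴹ B₁.-ᴹ (Σ⊗ B.residue ⟨$⟩ p₁ ⟨$⟩ v)
          ≈⟨ solve 3 (λ a b c → ((((a ⊕ b) ⊕ c) ⊝ a) ⊝ b) ⊝ c ⊜ ∅) B₁.≈ᴹ-refl _ _ _ ⟩
        B₁.0ᴹ ∎
        where
        open SetoidReasoning B₁.≈ᴹ-setoid
        open AbelianGroupSolver B₁.+ᴹ-abelianGroup

      x≈iy : ∀ v → x ⟨$⟩ v C₁.≈ᴹ i₁ ⟨$⟩ y ⟨$⟩ v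
      x≈iy v = C₁.≈ᴹ-trans (ir+jp (x ⟨$⟩ v)) (C₁.≈ᴹ-trans (C₁.+ᴹ-congˡ (Lin.≈0-homo j₁ (px≈0 v))) (C₁.+ᴹ-identityʳ _))

      -- This is `d₁ x` after `dd≈0` has removed the term through `d₂`.
      dx : Lin C₁ C₀
      dx = d₁ −ᴸ d₁ ∘ᴸ j₁ ∘ᴸ B.t ∘ᴸ p₀ ∘ᴸ d₁ −ᴸ d₁ ∘ᴸ j₁ ∘ᴸ Σ⊗ B.residue ∘ᴸ p₁

      dx-correct : ∀ v → d₁ ⟨$⟩ x ⟨$⟩ v C₀.≈ᴹ dx ⟨$⟩ v
      dx-correct v = C₀.≈ᴹ-trans (Lin.−-homo d₁ _ _) (C₀.+ᴹ-congʳ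
        (C₀.≈ᴹ-trans (Lin.−-homo d₁ _ _) (C₀.+ᴹ-congʳ
        (C₀.≈ᴹ-trans (Lin.−-homo d₁ _ _) (C₀.≈ᴹ-trans (C₀.+ᴹ-congˡ (C₀.-ᴹ‿cong (dd≈0 _)))
          (solve 1 (λ a → a ⊝ ∅ ⊜ a) C₀.≈ᴹ-refl _))))))
        where open AbelianGroupSolver C₀.+ᴹ-abelianGroup

      a₁y : ∀ v → a₁ ⟨$⟩ y ⟨$⟩ v A₀.≈ᴹ r₀ ⟨$⟩ dx ⟨$⟩ v
      a₁y v = A₀.≈ᴹ-trans (A₀.≈ᴹ-sym (r₀i₀ _)) (Lin.cong r₀
        (C₀.≈ᴹ-trans (C₀.≈ᴹ-sym (i-chain₁ _)) (C₀.≈ᴹ-trans (Lin.cong d₁ (C₁.≈ᴹ-sym (x≈iy v))) (dx-correct v))))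

      t-part : ∀ v → i₁ ⟨$⟩ A.t ⟨$⟩ a₁ ⟨$⟩ y ⟨$⟩ v C₁.≈ᴹ
        ((i₁ ∘ᴸ A.t ∘ᴸ r₀) ⟨$⟩ d₁ ⟨$⟩ v C₁.+ᴹ C₁.-ᴹ ((i₁ ∘ᴸ corr) ⟨$⟩ j₁ ⟨$⟩ B.t ⟨$⟩ p₀ ⟨$⟩ d₁ ⟨$⟩ v))
        C₁.+ᴹ C₁.-ᴹ ((i₁ ∘ᴸ corr) ⟨$⟩ j₁ ⟨$⟩ Σ⊗ B.residue ⟨$⟩ p₁ ⟨$⟩ v)
      t-part v = C₁.≈ᴹ-trans (Lin.cong (i₁ ∘ᴸ A.t) (a₁y v))
        (C₁.≈ᴹ-trans (Lin.−-homo (i₁ ∘ᴸ A.t ∘ᴸ r₀) _ _) (C₁.+ᴹ-congʳ (Lin.−-homo (i₁ ∘ᴸ A.t ∘ᴸ r₀) _ _)))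

      main : ∀ v → v C₁.≈ᴹ (d₂ ⟨$⟩ S ⟨$⟩ v C₁.+ᴹ T′ ⟨$⟩ d₁ ⟨$⟩ v)
        C₁.+ᴹ ((j₁ −ᴸ i₁ ∘ᴸ corr ∘ᴸ j₁) ⟨$⟩ Σ⊗ B.residue ⟨$⟩ p₁ ⟨$⟩ v C₁.+ᴹ i₁ ⟨$⟩ Σ⊗ A.residue ⟨$⟩ y ⟨$⟩ v)
      main v = begin
        v
          ≈⟨ solve 4 (λ v a b c → v ⊜ ((((v ⊝ a) ⊝ b) ⊝ c) ⊕ ((a ⊕ b) ⊕ c))) C₁.≈ᴹ-refl v DS TD J ⟩
        x ⟨$⟩ v C₁.+ᴹ ((DS C₁.+ᴹ TD) C₁.+ᴹ J)
          ≈⟨ C₁.+ᴹ-congʳ (C₁.≈ᴹ-trans (x≈iy v) (C₁.≈ᴹ-trans (Lin.cong i₁ (A.homotopy (y ⟨$⟩ v)))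
               (C₁.≈ᴹ-trans (Lin.+-homo i₁ _ _) (C₁.+ᴹ-congʳ (Lin.+-homo i₁ _ _))))) ⟩
        ((i₁ ⟨$⟩ a₂ ⟨$⟩ A.s ⟨$⟩ y ⟨$⟩ v C₁.+ᴹ i₁ ⟨$⟩ A.t ⟨$⟩ a₁ ⟨$⟩ y ⟨$⟩ v) C₁.+ᴹ I) C₁.+ᴹ ((DS C₁.+ᴹ TD) C₁.+ᴹ J)
          ≈⟨ C₁.+ᴹ-congʳ (C₁.+ᴹ-congʳ (C₁.+ᴹ-cong (C₁.≈ᴹ-sym (i-chain₂ _)) (t-part v))) ⟩
        ((d₂ ⟨$⟩ i₂ ⟨$⟩ A.s ⟨$⟩ y ⟨$⟩ v C₁.+ᴹ ((E C₁.+ᴹ C₁.-ᴹ F) C₁.+ᴹ C₁.-ᴹ G)) C₁.+ᴹ I) C₁.+ᴹ ((DS C₁.+ᴹ TD) C₁.+ᴹ J)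
          ≈⟨ solve 8 (λ a e f g i ds td j → ((a ⊕ ((e ⊝ f) ⊝ g)) ⊕ i) ⊕ ((ds ⊕ td) ⊕ j) ⊜
               ((a ⊕ ds) ⊕ ((td ⊕ e) ⊝ f)) ⊕ ((j ⊝ g) ⊕ i)) C₁.≈ᴹ-refl _ _ _ _ _ _ _ _ ⟩
        ((d₂ ⟨$⟩ i₂ ⟨$⟩ A.s ⟨$⟩ y ⟨$⟩ v C₁.+ᴹ DS) C₁.+ᴹ T′ ⟨$⟩ d₁ ⟨$⟩ v) C₁.+ᴹ ((j₁ −ᴸ i₁ ∘ᴸ corr ∘ᴸ j₁) ⟨$⟩ Σ⊗ B.residue ⟨$⟩ p₁ ⟨$⟩ v C₁.+ᴹ I)
          ≈⟨ C₁.+ᴹ-congʳ (C₁.+ᴹ-congʳ (C₁.≈ᴹ-sym (Lin.+-homo d₂ _ _))) ⟩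
        (d₂ ⟨$⟩ S ⟨$⟩ v C₁.+ᴹ T′ ⟨$⟩ d₁ ⟨$⟩ v) C₁.+ᴹ ((j₁ −ᴸ i₁ ∘ᴸ corr ∘ᴸ j₁) ⟨$⟩ Σ⊗ B.residue ⟨$⟩ p₁ ⟨$⟩ v C₁.+ᴹ I) ∎
        where
        open SetoidReasoning C₁.≈ᴹ-setoid
        open AbelianGroupSolver C₁.+ᴹ-abelianGroup
        DS TD J I E F G : ∣ C₁ ∣
        DS = d₂ ⟨$⟩ j₂ ⟨$⟩ B.s ⟨$⟩ p₁ ⟨$⟩ v
        TD = j₁ ⟨$⟩ B.t ⟨$⟩ p₀ ⟨$⟩ d₁ ⟨$⟩ v
        J = j₁ ⟨$⟩ Σ⊗ B.residue ⟨$⟩ p₁ ⟨$⟩ v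
        I = i₁ ⟨$⟩ Σ⊗ A.residue ⟨$⟩ y ⟨$⟩ v
        E = (i₁ ∘ᴸ A.t ∘ᴸ r₀) ⟨$⟩ d₁ ⟨$⟩ v
        F = (i₁ ∘ᴸ corr) ⟨$⟩ j₁ ⟨$⟩ B.t ⟨$⟩ p₀ ⟨$⟩ d₁ ⟨$⟩ v
        G = (i₁ ∘ᴸ corr) ⟨$⟩ j₁ ⟨$⟩ Σ⊗ B.residue ⟨$⟩ p₁ ⟨$⟩ v

  -- Ranks of maps versus sizes of contractions.

  open Independence using (comb; comb-zero; LinIndep; steinitz; Split; module Split)

  module _ (V : Space) where
    open LeftModule V

    comb-++ : ∀ as vs ws → length as ≡ length vs ℕ.+ length ws →
      comb V as (vs ++ ws) ≈ᴹ comb V (take (length vs) as) vs +ᴹ comb V (drop (length vs) as) ws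
    comb-++ as [] ws _ = ≈ᴹ-sym (+ᴹ-identityˡ _)
    comb-++ (a ∷ as) (v ∷ vs) ws len =
      ≈ᴹ-trans (+ᴹ-congˡ (comb-++ as vs ws (ℕ.suc-injective len))) (≈ᴹ-sym (+ᴹ-assoc _ _ _))

  module _ {A B : Space} (T : Lin A B) where
    open LeftModule B

    comb-map : ∀ as vs → T ⟨$⟩ comb A as vs ≈ᴹ comb B as (map (T ⟨$⟩_) vs)
    comb-map [] vs = Lin.0-homo T
    comb-map (a ∷ as) [] = Lin.0-homo T
    comb-map (a ∷ as) (v ∷ vs) = ≈ᴹ-trans (Lin.+-homo T _ _) (+ᴹ-cong (Lin.*-homo T a v) (comb-map as vs))

    comb-kernel : ∀ as vs → All (λ v → T ⟨$⟩ v ≈ᴹ 0ᴹ) vs → T ⟨$⟩ comb A as vs ≈ᴹ 0ᴹ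
    comb-kernel [] vs _ = Lin.0-homo T
    comb-kernel (a ∷ as) [] _ = Lin.0-homo T
    comb-kernel (a ∷ as) (v ∷ vs) (Tv≈0 ∷ Tvs≈0) = ≈ᴹ-trans (Lin.+-homo T _ _)
      (≈ᴹ-trans (+ᴹ-cong (≈ᴹ-trans (Lin.*-homo T a v) (≈ᴹ-trans (*ₗ-congˡ Tv≈0) (*ₗ-zeroʳ a))) (comb-kernel as vs Tvs≈0))
      (+ᴹ-identityˡ _))

    Σ⊗-kernel : ∀ {E} (L : List (Tensor E A)) → All (λ t → T ⟨$⟩ vector t ≈ᴹ 0ᴹ) L → ∀ x → T ⟨$⟩ Σ⊗ L ⟨$⟩ x ≈ᴹ 0ᴹ
    Σ⊗-kernel [] _ x = Lin.0-homo T
    Σ⊗-kernel ((f ⊗ v) ∷ L) (Tv≈0 ∷ TL≈0) x = ≈ᴹ-trans (Lin.+-homo T _ _)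
      (≈ᴹ-trans (+ᴹ-cong (≈ᴹ-trans (Lin.*-homo T _ v) (≈ᴹ-trans (*ₗ-congˡ Tv≈0) (*ₗ-zeroʳ _))) (Σ⊗-kernel L TL≈0 x))
      (+ᴹ-identityˡ _))

  All-tensors : ∀ {p A B} {P : ∣ B ∣ → Set p} (fs : List (Lin A 𝕂)) {vs} → All P vs → All (λ t → P (vector t)) (tensors B fs vs)
  All-tensors [] _ = []
  All-tensors (f ∷ fs) [] = []
  All-tensors (f ∷ fs) (pv ∷ pvs) = pv ∷ All-tensors fs pvs

  -- Applying `T` to a relation erases `vs`, so the coefficients of `ws` vanish; a relation among
  -- `vs` remains.
  LinIndep-lift : ∀ {A B : Space} (T : Lin A B) vs ws → All (λ v → LeftModule._≈ᴹ_ B (T ⟨$⟩ v) (LeftModule.0ᴹ B)) vs →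
    LinIndep A vs → LinIndep B (map (T ⟨$⟩_) ws) → LinIndep A (vs ++ ws)
  LinIndep-lift {A} {B} T vs ws Tvs≈0 ind-vs ind-ws as len comb≈0 =
    ≡.subst (All (_≈ 0#)) (take++drop≡id (length vs) as) (All.++⁺ first≈0 last≈0)
    where
    module A = LeftModule A
    module B = LeftModule B
    as₁ as₂ : List Carrier
    as₁ = take (length vs) as
    as₂ = drop (length vs) as
    len′ : length as ≡ length vs ℕ.+ length ws
    len′ = ≡.trans len (length-++ vs)
    sum≈0 : comb A as₁ vs A.+ᴹ comb A as₂ ws A.≈ᴹ A.0ᴹ
    sum≈0 = A.≈ᴹ-trans (A.≈ᴹ-sym (comb-++ A as vs ws len′)) comb≈0
    last≈0 : All (_≈ 0#) as₂
    last≈0 = ind-ws as₂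
      (≡.trans (length-drop (length vs) as) (≡.trans (≡.cong (ℕ._∸ length vs) len′)
        (≡.trans (ℕ.m+n∸m≡n (length vs) (length ws)) (≡.sym (length-map _ ws)))))
      (begin
        comb B as₂ (map (T ⟨$⟩_) ws)                      ≈⟨ comb-map T as₂ ws ⟨
        T ⟨$⟩ comb A as₂ ws                               ≈⟨ B.+ᴹ-identityˡ _ ⟨
        B.0ᴹ B.+ᴹ T ⟨$⟩ comb A as₂ ws                     ≈⟨ B.+ᴹ-congʳ (comb-kernel T as₁ vs Tvs≈0) ⟨
        T ⟨$⟩ comb A as₁ vs B.+ᴹ T ⟨$⟩ comb A as₂ ws      ≈⟨ Lin.+-homo T _ _ ⟨
        T ⟨$⟩ (comb A as₁ vs A.+ᴹ comb A as₂ ws)          ≈⟨ Lin.≈0-homo T sum≈0 ⟩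
        B.0ᴹ                                              ∎)
      where open SetoidReasoning B.≈ᴹ-setoid
    first≈0 : All (_≈ 0#) as₁
    first≈0 = ind-vs as₁
      (≡.trans (length-take (length vs) as) (≡.trans (≡.cong (length vs ℕ.⊓_) len′) (ℕ.m≤n⇒m⊓n≡m (ℕ.m≤m+n _ _))))
      (A.≈ᴹ-trans (A.≈ᴹ-sym (A.+ᴹ-identityʳ _))
        (A.≈ᴹ-trans (A.+ᴹ-congˡ (A.≈ᴹ-sym (comb-zero A as₂ ws last≈0))) sum≈0))

  -- A map of rank r, witnessed by r vectors with independent images and a
  -- generalized inverse landing in their span.
  record Rank {A B : Space} (d : Lin A B) (r : ℕ) : Set (c ⊔ ℓ) where
    open LeftModule B
    field
      inv       : List (Tensor B A)
      size      : length inv ≡ r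
      quasi-inv : ∀ v → d ⟨$⟩ Σ⊗ inv ⟨$⟩ d ⟨$⟩ v ≈ᴹ d ⟨$⟩ v
      indep     : LinIndep B (map (d ⟨$⟩_) (map vector inv))

  module _ {C₂ C₁ C₀ : Space} {d₂ : Lin C₂ C₁} {d₁ : Lin C₁ C₀} where
    private
      module C₁ = LeftModule C₁
      module C₀ = LeftModule C₀
    open SetoidReasoning C₁.≈ᴹ-setoid
    open AbelianGroupSolver C₁.+ᴹ-abelianGroup

    -- The projection `P = 1 - d₂ h - u d₁` kills the `r₂` vectors `d₂ w` and the `r₁` vectors
    -- `u d₁ w`, which are jointly independent. Steinitz exchanges them into `U`, and `P` applied to
    -- the rest is a residue of length dim `C₁` minus both ranks. The generalized inverses are
    -- separate arguments so that neighbouring degrees can share them.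
    residue-rank : (∀ v → d₁ ⟨$⟩ d₂ ⟨$⟩ v C₀.≈ᴹ C₀.0ᴹ) →
      ∀ {r₁ r₂} → Rank d₁ r₁ → Rank d₂ r₂ →
      (u₂ : Lin C₁ C₂) → (∀ v → d₂ ⟨$⟩ u₂ ⟨$⟩ d₂ ⟨$⟩ v C₁.≈ᴹ d₂ ⟨$⟩ v) →
      (u : Lin C₀ C₁) → (∀ v → d₁ ⟨$⟩ u ⟨$⟩ d₁ ⟨$⟩ v C₀.≈ᴹ d₁ ⟨$⟩ v) →
      (U : List (Tensor C₁ C₁)) → (∀ v → v C₁.≈ᴹ Σ⊗ U ⟨$⟩ v) →
      ¬ ¬ (Σ (List (Tensor C₁ C₁)) λ L → (r₂ ℕ.+ r₁) ℕ.+ length L ≡ length U ×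
        (∀ v → v C₁.≈ᴹ (d₂ ⟨$⟩ (u₂ −ᴸ u₂ ∘ᴸ u ∘ᴸ d₁) ⟨$⟩ v C₁.+ᴹ u ⟨$⟩ d₁ ⟨$⟩ v) C₁.+ᴹ Σ⊗ L ⟨$⟩ v))
    residue-rank dd≈0 {r₁} {r₂} R₁ R₂ u₂ dud₂ u dud U id≈U k = steinitz C₁ U id≈U (vs₂ ++ vs₁) indep λ S →
      let open Split S in
      k (post P rest
        , ≡.trans (≡.cong₂ ℕ._+_ (≡.sym vs-len) (length-map _ rest)) total
        , λ v → begin
            v ≈⟨ solve 3 (λ v a b → v ⊜ (a ⊕ b) ⊕ ((v ⊝ a) ⊝ b)) C₁.≈ᴹ-refl _ _ _ ⟩
            (d₂ ⟨$⟩ h ⟨$⟩ v C₁.+ᴹ u ⟨$⟩ d₁ ⟨$⟩ v) C₁.+ᴹ P ⟨$⟩ v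
              ≈⟨ C₁.+ᴹ-congˡ (C₁.≈ᴹ-trans (Lin.cong P (split v)) (Lin.+-homo P _ _)) ⟩
            (d₂ ⟨$⟩ h ⟨$⟩ v C₁.+ᴹ u ⟨$⟩ d₁ ⟨$⟩ v) C₁.+ᴹ (P ⟨$⟩ Σ⊗ (tensors C₁ fs (vs₂ ++ vs₁)) ⟨$⟩ v C₁.+ᴹ P ⟨$⟩ Σ⊗ rest ⟨$⟩ v)
              ≈⟨ C₁.+ᴹ-congˡ (C₁.≈ᴹ-trans (C₁.+ᴹ-cong (Σ⊗-kernel P (tensors C₁ fs (vs₂ ++ vs₁)) (All-tensors {B = C₁} fs Pvs≈0) v) (C₁.≈ᴹ-sym (Σ⊗-post P rest v))) (C₁.+ᴹ-identityˡ _)) ⟩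
            (d₂ ⟨$⟩ h ⟨$⟩ v C₁.+ᴹ u ⟨$⟩ d₁ ⟨$⟩ v) C₁.+ᴹ Σ⊗ (post P rest) ⟨$⟩ v ∎)
      where
      module R₁ = Rank R₁
      module R₂ = Rank R₂
      -- The subtracted term makes `d₂ h` vanish on the image of `u d₁`, which `P` has to kill as
      -- well.
      h : Lin C₁ C₂
      h = u₂ −ᴸ u₂ ∘ᴸ u ∘ᴸ d₁
      P : Lin C₁ C₁
      P = idᴸ −ᴸ d₂ ∘ᴸ h −ᴸ u ∘ᴸ d₁
      vs₂ vs₁ : List ∣ C₁ ∣
      vs₂ = map (d₂ ⟨$⟩_) (map vector R₂.inv)
      vs₁ = map (λ w → u ⟨$⟩ d₁ ⟨$⟩ w) (map vector R₁.inv)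
      vs-len : length (vs₂ ++ vs₁) ≡ r₂ ℕ.+ r₁
      vs-len = ≡.trans (length-++ vs₂) (≡.cong₂ ℕ._+_
        (≡.trans (length-map _ (map vector R₂.inv)) (≡.trans (length-map vector R₂.inv) R₂.size))
        (≡.trans (length-map _ (map vector R₁.inv)) (≡.trans (length-map vector R₁.inv) R₁.size)))
      indep-congʳ : ∀ ws → LinIndep C₀ (map (d₁ ⟨$⟩_) ws) → LinIndep C₀ (map (d₁ ⟨$⟩_) (map (λ w → u ⟨$⟩ d₁ ⟨$⟩ w) ws))
      indep-congʳ ws ind as len eq = ind as (≡.trans len (≡.trans (length-map _ (map _ ws)) (≡.trans (length-map _ ws) (≡.sym (length-map _ ws)))))
        (C₀.≈ᴹ-trans (same as ws) eq)
        where
        same : ∀ as ws → comb C₀ as (map (d₁ ⟨$⟩_) ws) C₀.≈ᴹ comb C₀ as (map (d₁ ⟨$⟩_) (map (λ w → u ⟨$⟩ d₁ ⟨$⟩ w) ws))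
        same [] ws = C₀.≈ᴹ-refl
        same (a ∷ as) [] = C₀.≈ᴹ-refl
        same (a ∷ as) (w ∷ ws) = C₀.+ᴹ-cong (C₀.*ₗ-congˡ (C₀.≈ᴹ-sym (dud w))) (same as ws)
      indep : LinIndep C₁ (vs₂ ++ vs₁)
      indep = LinIndep-lift d₁ vs₂ vs₁ (All.map⁺ (All.tabulate λ _ → dd≈0 _)) R₂.indep (indep-congʳ (map vector R₁.inv) R₁.indep)
      Pd₂≈0 : ∀ w → P ⟨$⟩ d₂ ⟨$⟩ w C₁.≈ᴹ C₁.0ᴹ
      Pd₂≈0 w = begin
        (d₂ ⟨$⟩ w C₁.+ᴹ C₁.-ᴹ (d₂ ⟨$⟩ h ⟨$⟩ d₂ ⟨$⟩ w)) C₁.+ᴹ C₁.-ᴹ (u ⟨$⟩ d₁ ⟨$⟩ d₂ ⟨$⟩ w)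
          ≈⟨ C₁.+ᴹ-cong (C₁.+ᴹ-congˡ (C₁.-ᴹ‿cong (C₁.≈ᴹ-trans (Lin.−-homo d₂ _ _) (C₁.+ᴹ-cong (dud₂ w)
               (C₁.-ᴹ‿cong (Lin.≈0-homo (d₂ ∘ᴸ u₂ ∘ᴸ u) (dd≈0 w))))))) (C₁.-ᴹ‿cong (Lin.≈0-homo u (dd≈0 w))) ⟩
        (d₂ ⟨$⟩ w C₁.+ᴹ C₁.-ᴹ (d₂ ⟨$⟩ w C₁.+ᴹ C₁.-ᴹ C₁.0ᴹ)) C₁.+ᴹ C₁.-ᴹ C₁.0ᴹ
          ≈⟨ solve 1 (λ a → (a ⊝ (a ⊝ ∅)) ⊝ ∅ ⊜ ∅) C₁.≈ᴹ-refl _ ⟩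
        C₁.0ᴹ ∎
      Pud₁≈0 : ∀ w → P ⟨$⟩ u ⟨$⟩ d₁ ⟨$⟩ w C₁.≈ᴹ C₁.0ᴹ
      Pud₁≈0 w = begin
        (x C₁.+ᴹ C₁.-ᴹ (d₂ ⟨$⟩ h ⟨$⟩ x)) C₁.+ᴹ C₁.-ᴹ (u ⟨$⟩ d₁ ⟨$⟩ x)
          ≈⟨ C₁.+ᴹ-cong (C₁.+ᴹ-congˡ (C₁.-ᴹ‿cong (C₁.≈ᴹ-trans (Lin.−-homo d₂ _ _) (C₁.+ᴹ-congˡ
               (C₁.-ᴹ‿cong (Lin.cong (d₂ ∘ᴸ u₂ ∘ᴸ u) (dud w))))))) (C₁.-ᴹ‿cong (Lin.cong u (dud w))) ⟩
        (x C₁.+ᴹ C₁.-ᴹ (d₂ ⟨$⟩ u₂ ⟨$⟩ x C₁.+ᴹ C₁.-ᴹ (d₂ ⟨$⟩ u₂ ⟨$⟩ x))) C₁.+ᴹ C₁.-ᴹ x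
          ≈⟨ solve 2 (λ a b → (a ⊝ (b ⊝ b)) ⊝ a ⊜ ∅) C₁.≈ᴹ-refl _ _ ⟩
        C₁.0ᴹ ∎
        where
        x : ∣ C₁ ∣
        x = u ⟨$⟩ d₁ ⟨$⟩ w
      Pvs≈0 : All (λ v → P ⟨$⟩ v C₁.≈ᴹ C₁.0ᴹ) (vs₂ ++ vs₁)
      Pvs≈0 = All.++⁺ {xs = vs₂} (All.map⁺ (All.tabulate λ {w} _ → Pd₂≈0 w)) (All.map⁺ (All.tabulate λ {w} _ → Pud₁≈0 w))

    -- Inserting generalized inverses, `t d₁` becomes a sum of `r₁` tensors and `d₂ s` one of `r₂`
    -- tensors. With the residue they express the identity of `C₁`, and Steinitz bounds every
    -- independent family.
    contraction-bound : ∀ {r₁ r₂ N} → Rank d₁ r₁ → Rank d₂ r₂ → Contraction d₂ d₁ N →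
      ∀ vs → LinIndep C₁ vs → ¬ ¬ (length vs ℕ.≤ r₁ ℕ.+ (r₂ ℕ.+ N))
    contraction-bound {r₁} {r₂} {N} R₁ R₂ con vs ind k = steinitz C₁ U id≈U vs ind λ S →
      k (≡.subst (length vs ℕ.≤_) (≡.trans (Split.total S) U-len) (ℕ.m≤m+n _ _))
      where
      module R₁ = Rank R₁
      module R₂ = Rank R₂
      open Contraction con
      L₁ L₂ U : List (Tensor C₁ C₁)
      L₁ = post (t ∘ᴸ d₁) (pre d₁ R₁.inv)
      L₂ = post d₂ (pre (d₂ ∘ᴸ s) R₂.inv)
      U = L₁ ++ (L₂ ++ residue)
      U-len : length U ≡ r₁ ℕ.+ (r₂ ℕ.+ N)
      U-len = ≡.trans (length-++ L₁) (≡.cong₂ ℕ._+_ (≡.trans (length-map _ (pre d₁ R₁.inv)) (≡.trans (length-map _ R₁.inv) R₁.size))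
        (≡.trans (length-++ L₂) (≡.cong₂ ℕ._+_ (≡.trans (length-map _ (pre (d₂ ∘ᴸ s) R₂.inv)) (≡.trans (length-map _ R₂.inv) R₂.size)) size)))
      id≈U : ∀ v → v C₁.≈ᴹ Σ⊗ U ⟨$⟩ v
      id≈U v = begin
        v ≈⟨ homotopy v ⟩
        (d₂ ⟨$⟩ s ⟨$⟩ v C₁.+ᴹ t ⟨$⟩ d₁ ⟨$⟩ v) C₁.+ᴹ Σ⊗ residue ⟨$⟩ v
          ≈⟨ solve 3 (λ a b c → (a ⊕ b) ⊕ c ⊜ b ⊕ (a ⊕ c)) C₁.≈ᴹ-refl _ _ _ ⟩
        t ⟨$⟩ d₁ ⟨$⟩ v C₁.+ᴹ (d₂ ⟨$⟩ s ⟨$⟩ v C₁.+ᴹ Σ⊗ residue ⟨$⟩ v)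
          ≈⟨ C₁.+ᴹ-cong (C₁.≈ᴹ-sym (Lin.cong t (R₁.quasi-inv v))) (C₁.+ᴹ-congʳ (C₁.≈ᴹ-sym (R₂.quasi-inv _))) ⟩
        t ⟨$⟩ d₁ ⟨$⟩ Σ⊗ R₁.inv ⟨$⟩ d₁ ⟨$⟩ v C₁.+ᴹ (d₂ ⟨$⟩ Σ⊗ R₂.inv ⟨$⟩ d₂ ⟨$⟩ s ⟨$⟩ v C₁.+ᴹ Σ⊗ residue ⟨$⟩ v)
          ≈⟨ C₁.+ᴹ-cong (C₁.≈ᴹ-sym (C₁.≈ᴹ-trans (Σ⊗-post (t ∘ᴸ d₁) (pre d₁ R₁.inv) v) (Lin.cong (t ∘ᴸ d₁) (Σ⊗-pre d₁ R₁.inv v))))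
               (C₁.+ᴹ-congʳ (C₁.≈ᴹ-sym (C₁.≈ᴹ-trans (Σ⊗-post d₂ (pre (d₂ ∘ᴸ s) R₂.inv) v) (Lin.cong d₂ (Σ⊗-pre (d₂ ∘ᴸ s) R₂.inv v))))) ⟩
        Σ⊗ L₁ ⟨$⟩ v C₁.+ᴹ (Σ⊗ L₂ ⟨$⟩ v C₁.+ᴹ Σ⊗ residue ⟨$⟩ v)
          ≈⟨ C₁.+ᴹ-congˡ (Σ⊗-++ L₂ residue v) ⟨
        Σ⊗ L₁ ⟨$⟩ v C₁.+ᴹ Σ⊗ (L₂ ++ residue) ⟨$⟩ v
          ≈⟨ Σ⊗-++ L₁ (L₂ ++ residue) v ⟨
        Σ⊗ U ⟨$⟩ v ∎

  -- Simplicial chains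

  open LinAlg K
  open AbelianGroupSolver +-abelianGroup

  -0≈0 : - 0# ≈ 0#
  -0≈0 = -0#≈0# ring

  -- Functions I → K, identified when they agree on P: the space with basis P.
  Fun : (I : Set) → (I → Set) → Space
  Fun I P = record
    { Carrierᴹ = I → Carrier
    ; _≈ᴹ_ = λ v w → ∀ x → P x → v x ≈ w x
    ; _+ᴹ_ = λ v w x → v x + w x
    ; _*ₗ_ = λ a v x → a * v x
    ; 0ᴹ = λ _ → 0#
    ; -ᴹ_ = λ v x → - v x
    ; isLeftModule = record
      { isLeftSemimodule = record
        { +ᴹ-isCommutativeMonoid = record
          { isMonoid = record
            { isSemigroup = record
              { isMagma = record
                { isEquivalence = record
                  { refl = λ _ _ → refl
                  ; sym = λ e x p → sym (e x p)
                  ; trans = λ e f x p → trans (e x p) (f x p)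
                  }
                ; ∙-cong = λ e f x p → +-cong (e x p) (f x p)
                }
              ; assoc = λ _ _ _ _ _ → +-assoc _ _ _
              }
            ; identity = (λ _ _ _ → +-identityˡ _) , (λ _ _ _ → +-identityʳ _)
            }
          ; comm = λ _ _ _ _ → +-comm _ _
          }
        ; isPreleftSemimodule = record
          { *ₗ-cong = λ e f x p → *-cong e (f x p)
          ; *ₗ-zeroˡ = λ _ _ _ → zeroˡ _
          ; *ₗ-distribʳ = λ _ _ _ _ _ → distribʳ _ _ _
          ; *ₗ-identityˡ = λ _ _ _ → *-identityˡ _
          ; *ₗ-assoc = λ _ _ _ _ _ → *-assoc _ _ _
          ; *ₗ-zeroʳ = λ _ _ _ → zeroʳ _
          ; *ₗ-distribˡ = λ _ _ _ _ _ → distribˡ _ _ _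
          }
        }
      ; -ᴹ‿cong = λ e x p → -‿cong (e x p)
      ; -ᴹ‿inverse = (λ _ _ _ → -‿inverseˡ _) , (λ _ _ _ → -‿inverseʳ _)
      }
    }

  -- Operators on all functions, before any support condition; `onSupport` turns them into maps
  -- between the spaces spanned by faces.
  Op : Set → Set → Set _
  Op I J = Lin (Fun I (λ _ → ⊤)) (Fun J (λ _ → ⊤))

  module _ {I J : Set} (T : Op I J) where
    op-cong : ∀ {v w} → (∀ x → v x ≈ w x) → ∀ y → (T ⟨$⟩ v) y ≈ (T ⟨$⟩ w) y
    op-cong e y = Lin.cong T (λ x _ → e x) y tt
    op-+ : ∀ v w y → (T ⟨$⟩ (λ x → v x + w x)) y ≈ (T ⟨$⟩ v) y + (T ⟨$⟩ w) y
    op-+ v w y = Lin.+-homo T v w y tt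
    op-* : ∀ a v y → (T ⟨$⟩ (λ x → a * v x)) y ≈ a * (T ⟨$⟩ v) y
    op-* a v y = Lin.*-homo T a v y tt
    op-neg : ∀ v y → (T ⟨$⟩ (λ x → - v x)) y ≈ - (T ⟨$⟩ v) y
    op-neg v y = Lin.-‿homo T v y tt
    op-0 : ∀ {v} → (∀ x → v x ≈ 0#) → ∀ y → (T ⟨$⟩ v) y ≈ 0#
    op-0 e y = Lin.≈0-homo T (λ x _ → e x) y tt

  module _ {I : Set} {P : I → Set} (P? : Decidable P) where
    mask : (I → Carrier) → I → Carrier
    mask v x = if does (P? x) then v x else 0#

    mask-elim : ∀ {p} (C : Carrier → Set p) v x → (P x → C (v x)) → (¬ P x → C 0#) → C (mask v x)
    mask-elim C v x inside outside with P? x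
    ... | yes px = inside px
    ... | no ¬px = outside ¬px

    mask-in : ∀ v x → P x → mask v x ≈ v x
    mask-in v x px = mask-elim (_≈ v x) v x (λ _ → refl) (contradiction px)

    mask-out : ∀ v x → ¬ P x → mask v x ≈ 0#
    mask-out v x ¬px = mask-elim (_≈ 0#) v x (λ px → contradiction px ¬px) (λ _ → refl)

    mask-≈0 : ∀ v x → (P x → v x ≈ 0#) → mask v x ≈ 0#
    mask-≈0 v x v≈0 = mask-elim (_≈ 0#) v x v≈0 (λ _ → refl)

    Supp : (I → Carrier) → Set ℓ
    Supp v = ∀ x → ¬ P x → v x ≈ 0#

    mask-supp : ∀ {v} → Supp v → ∀ x → mask v x ≈ v x
    mask-supp {v} supp x = mask-elim (_≈ v x) v x (λ _ → refl) (λ ¬px → sym (supp x ¬px))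

    mask-cong : ∀ v w x → (P x → v x ≈ w x) → mask v x ≈ mask w x
    mask-cong v w x e = mask-elim (_≈ mask w x) v x (λ px → trans (e px) (sym (mask-in w x px))) (λ ¬px → sym (mask-out w x ¬px))

    mask-+ : ∀ u v w x → (P x → u x ≈ v x + w x) → mask u x ≈ mask v x + mask w x
    mask-+ u v w x e = mask-elim (_≈ mask v x + mask w x) u x
      (λ px → trans (e px) (sym (+-cong (mask-in v x px) (mask-in w x px))))
      (λ ¬px → sym (trans (+-cong (mask-out v x ¬px) (mask-out w x ¬px)) (+-identityˡ 0#)))

    mask-* : ∀ u a v x → (P x → u x ≈ a * v x) → mask u x ≈ a * mask v x
    mask-* u a v x e = mask-elim (_≈ a * mask v x) u x
      (λ px → trans (e px) (*-congˡ (sym (mask-in v x px))))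
      (λ ¬px → sym (trans (*-congˡ (mask-out v x ¬px)) (zeroʳ a)))

    -- Values off `P` are invisible to the equality of `Fun I P`, hence arbitrary; masking the input
    -- makes `T` respect this equality. The output stays unmasked, since `Fun J Q` ignores its
    -- values off `Q`.
    onSupport : ∀ {J Q} → Op I J → Lin (Fun I P) (Fun J Q)
    onSupport T = record
      { _⟨$⟩_ = λ v → T ⟨$⟩ mask v
      ; cong = λ {v} {w} e y _ → op-cong T (λ x → mask-cong v w x (e x)) y
      ; +-homo = λ v w y _ → trans (op-cong T (λ x → mask-+ (λ x → v x + w x) v w x (λ _ → refl)) y) (op-+ T _ _ y)
      ; *-homo = λ a v y _ → trans (op-cong T (λ x → mask-* (λ x → a * v x) a v x (λ _ → refl)) y) (op-* T a _ y)
      }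

    maskOp : Op I I
    maskOp = record
      { _⟨$⟩_ = mask
      ; cong = λ {v} {w} e x _ → mask-cong v w x (λ _ → e x tt)
      ; +-homo = λ v w x _ → mask-+ (λ x → v x + w x) v w x (λ _ → refl)
      ; *-homo = λ a v x _ → mask-* (λ x → a * v x) a v x (λ _ → refl)
      }

  mask-≗ : ∀ {I : Set} {P Q : I → Set} (P? : Decidable P) (Q? : Decidable Q) v w x →
    (P x → Q x) → (Q x → P x) → (P x → v x ≈ w x) → mask P? v x ≈ mask Q? w x
  mask-≗ P? Q? v w x to from e = mask-elim P? (_≈ mask Q? w x) v x
    (λ px → trans (e px) (sym (mask-in Q? w x (to px)))) (λ ¬px → sym (mask-out Q? w x (¬px ∘ from)))

  infix 4 _⋖_
  data _⋖_ : ∀ {n} → Face n → Face n → Set where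
    here  : ∀ {n} {ρ : Face n} → (false ∷ ρ) ⋖ (true ∷ ρ)
    there : ∀ {n b} {ρ σ : Face n} → ρ ⋖ σ → (b ∷ ρ) ⋖ (b ∷ σ)

  ⋖-card : ∀ {n} {ρ σ : Face n} → ρ ⋖ σ → card σ ≡ suc (card ρ)
  ⋖-card here = ≡.refl
  ⋖-card (there {b = true} c) = ≡.cong suc (⋖-card c)
  ⋖-card (there {b = false} c) = ⋖-card c

  ⊆-refl : ∀ {n} (σ : Face n) → T (σ ⊆ᵇ σ)
  ⊆-refl [] = tt
  ⊆-refl (true ∷ σ) = ⊆-refl σ
  ⊆-refl (false ∷ σ) = ⊆-refl σ

  ⋖⇒⊆ : ∀ {n} {ρ σ : Face n} → ρ ⋖ σ → T (ρ ⊆ᵇ σ)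
  ⋖⇒⊆ {ρ = false ∷ ρ} here = ⊆-refl ρ
  ⋖⇒⊆ (there {b = true} c) = ⋖⇒⊆ c
  ⋖⇒⊆ (there {b = false} c) = ⋖⇒⊆ c

  private
    -- In coordinates, the value at `ρ` is the signed sum of `f` over `ρ` with one vertex added. The
    -- head is the smallest vertex: adding it has sign +, and its presence in `ρ` flips every later
    -- sign.
    ∂₀ : ∀ {n} → (Face n → Carrier) → Face n → Carrier
    ∂₀ f [] = 0#
    ∂₀ f (false ∷ ρ) = ∂₀ (λ σ → f (false ∷ σ)) ρ + f (true ∷ ρ)
    ∂₀ f (true ∷ ρ) = - ∂₀ (λ σ → f (true ∷ σ)) ρ

    ∂₀-cong : ∀ {n} {f g : Face n → Carrier} → (∀ σ → f σ ≈ g σ) → ∀ ρ → ∂₀ f ρ ≈ ∂₀ g ρ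
    ∂₀-cong e [] = refl
    ∂₀-cong e (false ∷ ρ) = +-cong (∂₀-cong (λ σ → e (false ∷ σ)) ρ) (e (true ∷ ρ))
    ∂₀-cong e (true ∷ ρ) = -‿cong (∂₀-cong (λ σ → e (true ∷ σ)) ρ)

    ∂₀-+ : ∀ {n} (f g : Face n → Carrier) ρ → ∂₀ (λ σ → f σ + g σ) ρ ≈ ∂₀ f ρ + ∂₀ g ρ
    ∂₀-+ f g [] = sym (+-identityˡ 0#)
    ∂₀-+ f g (false ∷ ρ) = trans (+-congʳ (∂₀-+ _ _ ρ))
      (solve 4 (λ a b c d → (a ⊕ b) ⊕ (c ⊕ d) ⊜ (a ⊕ c) ⊕ (b ⊕ d)) refl _ _ _ _)
    ∂₀-+ f g (true ∷ ρ) = trans (-‿cong (∂₀-+ _ _ ρ)) (solve 2 (λ a b → ⊖ (a ⊕ b) ⊜ ⊖ a ⊕ ⊖ b) refl _ _)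

    ∂₀-* : ∀ {n} a (f : Face n → Carrier) ρ → ∂₀ (λ σ → a * f σ) ρ ≈ a * ∂₀ f ρ
    ∂₀-* a f [] = sym (zeroʳ a)
    ∂₀-* a f (false ∷ ρ) = trans (+-congʳ (∂₀-* a _ ρ)) (sym (distribˡ a _ _))
    ∂₀-* a f (true ∷ ρ) = trans (-‿cong (∂₀-* a _ ρ)) (-‿distribʳ-* ring a _)

  ∂ : ∀ {n} → Op (Face n) (Face n)
  ∂ = record
    { _⟨$⟩_ = ∂₀
    ; cong = λ e ρ _ → ∂₀-cong (λ σ → e σ tt) ρ
    ; +-homo = λ f g ρ _ → ∂₀-+ f g ρ
    ; *-homo = λ a f ρ _ → ∂₀-* a f ρ
    }

  ∂∂≈0 : ∀ {n} (f : Face n → Carrier) ρ → (∂ ⟨$⟩ ∂ ⟨$⟩ f) ρ ≈ 0#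
  ∂∂≈0 f [] = refl
  ∂∂≈0 f (false ∷ ρ) = trans (+-congʳ (trans (op-+ ∂ _ _ ρ) (+-congʳ (∂∂≈0 _ ρ))))
    (solve 1 (λ a → (∅ ⊕ a) ⊝ a ⊜ ∅) refl _)
  ∂∂≈0 f (true ∷ ρ) = trans (-‿cong (trans (op-neg ∂ _ ρ) (-‿cong (∂∂≈0 _ ρ)))) (solve 0 (⊖ (⊖ ∅) ⊜ ∅) refl)

  ∂-local : ∀ {n} (f : Face n → Carrier) ρ → (∀ σ → ρ ⋖ σ → f σ ≈ 0#) → (∂ ⟨$⟩ f) ρ ≈ 0#
  ∂-local f [] _ = refl
  ∂-local f (false ∷ ρ) f≈0 = trans (+-cong (∂-local _ ρ (λ σ c → f≈0 _ (there c))) (f≈0 _ here)) (+-identityˡ 0#)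
  ∂-local f (true ∷ ρ) f≈0 = trans (-‿cong (∂-local _ ρ (λ σ c → f≈0 _ (there c)))) -0≈0

  δ : ∀ {n} → Face n → Face n → Carrier
  δ [] [] = 1#
  δ (false ∷ σ) (false ∷ ρ) = δ σ ρ
  δ (true ∷ σ) (true ∷ ρ) = δ σ ρ
  δ (false ∷ σ) (true ∷ ρ) = 0#
  δ (true ∷ σ) (false ∷ ρ) = 0#

  δ-off : ∀ {n} (σ ρ : Face n) → ¬ (σ ≡ ρ) → δ σ ρ ≈ 0#
  δ-off [] [] σ≢ρ = contradiction ≡.refl σ≢ρ
  δ-off (false ∷ σ) (false ∷ ρ) σ≢ρ = δ-off σ ρ (λ e → σ≢ρ (≡.cong (false ∷_) e))
  δ-off (true ∷ σ) (true ∷ ρ) σ≢ρ = δ-off σ ρ (λ e → σ≢ρ (≡.cong (true ∷_) e))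
  δ-off (false ∷ σ) (true ∷ ρ) σ≢ρ = refl
  δ-off (true ∷ σ) (false ∷ ρ) σ≢ρ = refl

  private
    coefficient : Maybe ℕ → Carrier
    coefficient (just p) = signPow p
    coefficient nothing = 0#

    bdry≡ : ∀ {n} (ρ σ : Face n) → bdry ρ σ ≡ coefficient (incidence ρ σ)
    bdry≡ ρ σ with incidence ρ σ
    ... | just p = ≡.refl
    ... | nothing = ≡.refl

    coefficient-suc : ∀ m → coefficient (Maybe.map suc m) ≈ - coefficient m
    coefficient-suc (just p) = refl
    coefficient-suc nothing = sym -0≈0

    δ-==ᶠ : ∀ {n} (σ ρ : Face n) → δ σ ρ ≈ coefficient (if ρ ==ᶠ σ then just 0 else nothing)
    δ-==ᶠ [] [] = refl
    δ-==ᶠ (false ∷ σ) (false ∷ ρ) = δ-==ᶠ σ ρ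
    δ-==ᶠ (true ∷ σ) (true ∷ ρ) = δ-==ᶠ σ ρ
    δ-==ᶠ (false ∷ σ) (true ∷ ρ) = refl
    δ-==ᶠ (true ∷ σ) (false ∷ ρ) rewrite Bool.∧-zeroʳ (ρ ⊆ᵇ σ) = refl

  -- Links the recursive boundary to the matrix `bdry` in which ranks are specified.
  ∂δ : ∀ {n} (σ ρ : Face n) → (∂ ⟨$⟩ δ σ) ρ ≈ bdry ρ σ
  ∂δ σ ρ = trans (go σ ρ) (reflexive (≡.sym (bdry≡ ρ σ)))
    where
    go : ∀ {n} (σ ρ : Face n) → (∂ ⟨$⟩ δ σ) ρ ≈ coefficient (incidence ρ σ)
    go [] [] = refl
    go (false ∷ σ) (false ∷ ρ) = trans (+-identityʳ _) (go σ ρ)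
    go (true ∷ σ) (true ∷ ρ) = trans (-‿cong (go σ ρ)) (sym (coefficient-suc (incidence ρ σ)))
    go (false ∷ σ) (true ∷ ρ) = trans (-‿cong (op-0 ∂ (λ _ → refl) ρ)) -0≈0
    go (true ∷ σ) (false ∷ ρ) = trans (+-cong (op-0 ∂ (λ _ → refl) ρ) (δ-==ᶠ σ ρ)) (+-identityˡ _)

  Σᴸ : ∀ {A : Set} → List A → (A → Carrier) → Carrier
  Σᴸ [] g = 0#
  Σᴸ (x ∷ xs) g = g x + Σᴸ xs g

  module _ {A : Set} where
    Σᴸ-++ : ∀ (xs ys : List A) g → Σᴸ (xs ++ ys) g ≈ Σᴸ xs g + Σᴸ ys g
    Σᴸ-++ [] ys g = sym (+-identityˡ _)
    Σᴸ-++ (x ∷ xs) ys g = trans (+-congˡ (Σᴸ-++ xs ys g)) (sym (+-assoc _ _ _))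

    Σᴸ-0 : ∀ (xs : List A) g → (∀ x → g x ≈ 0#) → Σᴸ xs g ≈ 0#
    Σᴸ-0 [] g e = refl
    Σᴸ-0 (x ∷ xs) g e = trans (+-cong (e x) (Σᴸ-0 xs g e)) (+-identityˡ 0#)

    Σᴸ-map : ∀ {B : Set} (h : B → A) xs g → Σᴸ (map h xs) g ≡ Σᴸ xs (λ x → g (h x))
    Σᴸ-map h [] g = ≡.refl
    Σᴸ-map h (x ∷ xs) g = ≡.cong (g (h x) +_) (Σᴸ-map h xs g)

    Σᴸ-filter : ∀ {P : A → Set} (P? : Decidable P) xs g → (∀ x → ¬ P x → g x ≈ 0#) → Σᴸ (filter P? xs) g ≈ Σᴸ xs g
    Σᴸ-filter P? [] g e = refl
    Σᴸ-filter P? (x ∷ xs) g e with P? x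
    ... | yes _ = +-congˡ (Σᴸ-filter P? xs g e)
    ... | no ¬px = trans (Σᴸ-filter P? xs g e) (sym (trans (+-congʳ (e x ¬px)) (+-identityˡ _)))

  δ-expansion : ∀ {n} (f : Face n → Carrier) ρ → Σᴸ (allFaces n) (λ σ → f σ * δ σ ρ) ≈ f ρ
  δ-expansion f [] = trans (+-identityʳ _) (*-identityʳ _)
  δ-expansion {suc n} f (b ∷ ρ) = trans (Σᴸ-++ (map (false ∷_) (allFaces n)) _ _)
    (trans (+-cong (reflexive (Σᴸ-map (false ∷_) (allFaces n) _)) (reflexive (Σᴸ-map (true ∷_) (allFaces n) _))) (go b))
    where
    go : ∀ b → Σᴸ (allFaces n) (λ σ → f (false ∷ σ) * δ (false ∷ σ) (b ∷ ρ)) + Σᴸ (allFaces n) (λ σ → f (true ∷ σ) * δ (true ∷ σ) (b ∷ ρ)) ≈ f (b ∷ ρ)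
    go false = trans (+-cong (δ-expansion _ ρ) (Σᴸ-0 (allFaces n) _ (λ _ → zeroʳ _))) (+-identityʳ _)
    go true = trans (+-cong (Σᴸ-0 (allFaces n) _ (λ _ → zeroʳ _)) (δ-expansion _ ρ)) (+-identityˡ _)

  ∈-allFaces : ∀ {n} (σ : Face n) → σ ∈ allFaces n
  ∈-allFaces [] = here ≡.refl
  ∈-allFaces (false ∷ σ) = ∈-++⁺ˡ (∈-map⁺ (false ∷_) (∈-allFaces σ))
  ∈-allFaces {suc n} (true ∷ σ) = ∈-++⁺ʳ (map (false ∷_) (allFaces n)) (∈-map⁺ (true ∷_) (∈-allFaces σ))

  evalAt : ∀ {I Q} x → Q x → Lin (Fun I Q) 𝕂
  evalAt x qx = record
    { _⟨$⟩_ = λ v → v x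
    ; cong = λ e → e x qx
    ; +-homo = λ _ _ → refl
    ; *-homo = λ _ _ → refl
    }

  T-∧ : ∀ {a b} → T a → T b → T (a ∧ b)
  T-∧ {true} _ b = b

  T-∧⁻ : ∀ {a b} → T (a ∧ b) → T a × T b
  T-∧⁻ {true} b = tt , b

  InC : ∀ {n} → Family n → ℕ → Face n → Set
  InC Z m ρ = T (Z ρ) × suc (card ρ) ≡ m

  InC? : ∀ {n} (Z : Family n) m → Decidable (InC Z m)
  InC? Z m ρ = Bool.T? (Z ρ) ×-dec (suc (card ρ) ℕ.≟ m)

  -- The augmented chain complex, shifted so that degree 0 is the zero space:
  -- Chains Z (suc m) is spanned by the faces with m vertices.
  Chains : ∀ {n} → Family n → ℕ → Space
  Chains {n} Z m = Fun (Face n) (InC Z m)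

  boundary : ∀ {n} (Z : Family n) m → Lin (Chains Z (suc m)) (Chains Z m)
  boundary Z m = onSupport (InC? Z (suc m)) ∂

  module _ {n} (Z : Family n) where
    ∈-facesOfSize⁺ : ∀ {m σ} → InC Z (suc m) σ → σ ∈ facesOfSize Z m
    ∈-facesOfSize⁺ {m} {σ} (Zσ , eq) = ∈-filter⁺ (λ σ → Bool.T? (Z σ ∧ (card σ ≡ᵇ m))) (∈-allFaces σ)
      (T-∧ Zσ (ℕ.≡⇒≡ᵇ _ _ (ℕ.suc-injective eq)))

    size⇒InC : ∀ {m σ} → T (Z σ ∧ (card σ ≡ᵇ m)) → InC Z (suc m) σ
    size⇒InC {m} {σ} t with T-∧⁻ {Z σ} t
    ... | Zσ , eq = Zσ , ≡.cong suc (ℕ.≡ᵇ⇒≡ _ _ eq)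

    ∈-facesOfSize⁻ : ∀ {m σ} → σ ∈ facesOfSize Z m → InC Z (suc m) σ
    ∈-facesOfSize⁻ {m} {σ} σ∈ = size⇒InC (proj₂ (∈-filter⁻ (λ σ → Bool.T? (Z σ ∧ (card σ ≡ᵇ m))) {xs = allFaces n} σ∈))

    coordinate : ∀ m → Face n → Lin (Chains Z m) 𝕂
    coordinate m σ = evalAt {Q = λ _ → ⊤} σ tt ∘ᴸ onSupport (InC? Z m) idᴸ

    unit : ∀ m → Face n → Tensor (Chains Z (suc m)) (Chains Z (suc m))
    unit m σ = coordinate (suc m) σ ⊗ δ σ

    basis : ∀ m → List (Tensor (Chains Z (suc m)) (Chains Z (suc m)))
    basis m = map (unit m) (facesOfSize Z m)

    basis-spans : ∀ m v → LeftModule._≈ᴹ_ (Chains Z (suc m)) v (Σ⊗ (basis m) ⟨$⟩ v)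
    basis-spans m v ρ ρ∈ = sym (begin
      (Σ⊗ (basis m) ⟨$⟩ v) ρ                                    ≡⟨ unfold (facesOfSize Z m) ⟩
      Σᴸ (facesOfSize Z m) (λ σ → mask (InC? Z (suc m)) v σ * δ σ ρ)
        ≈⟨ Σᴸ-filter _ (allFaces n) _ (λ σ ¬σ → trans (*-congʳ (mask-out (InC? Z (suc m)) v σ (λ (Zσ , eq) → ¬σ (T-∧ Zσ (ℕ.≡⇒≡ᵇ _ _ (ℕ.suc-injective eq)))))) (zeroˡ _)) ⟩
      Σᴸ (allFaces n) (λ σ → mask (InC? Z (suc m)) v σ * δ σ ρ)  ≈⟨ δ-expansion (mask (InC? Z (suc m)) v) ρ ⟩
      mask (InC? Z (suc m)) v ρ                                  ≈⟨ mask-in (InC? Z (suc m)) v ρ ρ∈ ⟩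
      v ρ                                                        ∎)
      where
      open SetoidReasoning setoid
      unfold : ∀ L → (Σ⊗ (map (unit m) L) ⟨$⟩ v) ρ ≡ Σᴸ L (λ σ → mask (InC? Z (suc m)) v σ * δ σ ρ)
      unfold [] = ≡.refl
      unfold (σ ∷ L) = ≡.cong (mask (InC? Z (suc m)) v σ * δ σ ρ +_) (unfold L)

    boundary-δ : ∀ {m σ} → σ ∈ facesOfSize Z m → ∀ ρ → (boundary Z m ⟨$⟩ δ σ) ρ ≈ bdry ρ σ
    boundary-δ {m} {σ} σ∈ ρ = trans (op-cong ∂ (mask-supp (InC? Z (suc m)) {δ σ} supp) ρ) (∂δ σ ρ)
      where
      supp : Supp (InC? Z (suc m)) (δ σ)
      supp τ ¬τ = δ-off σ τ (λ where ≡.refl → ¬τ (∈-facesOfSize⁻ σ∈))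

    comb-boundary : ∀ {m} as S → (∀ {σ} → σ ∈ S → σ ∈ facesOfSize Z m) → ∀ ρ →
      comb (Chains Z m) as (map (boundary Z m ⟨$⟩_) (map δ S)) ρ ≈ sumK (zipWith (λ a σ → a * bdry ρ σ) as S)
    comb-boundary [] S _ ρ = refl
    comb-boundary (a ∷ as) [] _ ρ = refl
    comb-boundary (a ∷ as) (σ ∷ S) S⊆ ρ = +-cong (*-congˡ (boundary-δ (S⊆ (here ≡.refl)) ρ)) (comb-boundary as S (S⊆ ∘ there) ρ)

  -- Maximality in `HasRank` speaks of sublists of the columns in their given order, so a new column
  -- has to enter at its own place.
  insert : ∀ {A : Set} {x : A} {S C} → S ⊑ C → x ∈ C →
    x ∈ S ⊎ Σ (List A) λ S₁ → Σ (List A) λ S₂ → S ≡ S₁ ++ S₂ × (S₁ ++ x ∷ S₂) ⊑ C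
  insert (y ∷ʳ p) (here ≡.refl) = inj₂ ([] , _ , ≡.refl , (≡.refl ∷ p))
  insert (y ∷ʳ p) (there x∈) with insert p x∈
  ... | inj₁ x∈S = inj₁ x∈S
  ... | inj₂ (S₁ , S₂ , eq , q) = inj₂ (S₁ , S₂ , eq , y ∷ʳ q)
  insert (≡.refl ∷ p) (here ≡.refl) = inj₁ (here ≡.refl)
  insert (≡.refl ∷ p) (there x∈) with insert p x∈
  ... | inj₁ x∈S = inj₁ (there x∈S)
  ... | inj₂ (S₁ , S₂ , ≡.refl , q) = inj₂ (_ ∷ S₁ , S₂ , ≡.refl , (≡.refl ∷ q))

  module _ (V : Space) where
    open LeftModule V
    open AbelianGroupSolver +ᴹ-abelianGroup using () renaming (solve to solveᴹ; _⊕_ to _⊕ᴹ_; _⊜_ to _⊜ᴹ_)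

    -- Brings the coefficient of the inserted column to the front. The last component carries
    -- vanishing of the rearranged coefficients back to `as`.
    comb-pivot : ∀ as xs x ys → length as ≡ length (xs ++ x ∷ ys) →
      Σ Carrier λ a → Σ (List Carrier) λ bs → length bs ≡ length (xs ++ ys) ×
      comb V as (xs ++ x ∷ ys) ≈ᴹ a *ₗ x +ᴹ comb V bs (xs ++ ys) ×
      (a ≈ 0# → All (_≈ 0#) bs → All (_≈ 0#) as)
    comb-pivot (a ∷ as) [] x ys len = a , as , ℕ.suc-injective len , ≈ᴹ-refl , _∷_
    comb-pivot (b ∷ as) (y ∷ xs) x ys len with comb-pivot as xs x ys (ℕ.suc-injective len)
    ... | a , bs , len′ , eq , zeros = a , b ∷ bs , ≡.cong suc len′
      , ≈ᴹ-trans (+ᴹ-congˡ eq) (solveᴹ 3 (λ x y z → x ⊕ᴹ (y ⊕ᴹ z) ⊜ᴹ y ⊕ᴹ (x ⊕ᴹ z)) ≈ᴹ-refl _ _ _)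
      , λ { a≈0 (b≈0 ∷ bs≈0) → b≈0 ∷ zeros a≈0 bs≈0 }

  tensors-length : ∀ {A B} (fs : List (Lin A 𝕂)) vs → length fs ≡ length vs → length (tensors B fs vs) ≡ length vs
  tensors-length [] [] _ = ≡.refl
  tensors-length {A} {B} (f ∷ fs) (v ∷ vs) len = ≡.cong suc (tensors-length {A} {B} fs vs (ℕ.suc-injective len))

  tensors-vectors : ∀ {A B} (fs : List (Lin A 𝕂)) vs → length fs ≡ length vs → map vector (tensors B fs vs) ≡ vs
  tensors-vectors [] [] _ = ≡.refl
  tensors-vectors {A} {B} (f ∷ fs) (v ∷ vs) len = ≡.cong (v ∷_) (tensors-vectors {A} {B} fs vs (ℕ.suc-injective len))

  -- Steinitz applied to the `r` independent columns. The remaining functionals vanish on these, and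
  -- on every other column by maximality, hence on the image of `d`. There the identity is the sum
  -- of the `fs ⊗ vs`; replacing each column by its face gives the generalized inverse.
  HasRank⇒Rank : ∀ {n} (Z : Family n) m {r} →
    HasRank bdry (facesOfSize Z m) (facesOfSize Z (suc m)) r → ¬ ¬ Rank (boundary Z (suc m)) r
  HasRank⇒Rank {n} Z m {r} ((S , S⊑ , S-len , S-ind) , dep) k = steinitz V (basis Z m) (basis-spans Z m) vs ind λ split → k (rank split)
    where
    V W : Space
    V = Chains Z (suc m)
    W = Chains Z (suc (suc m))
    module V = LeftModule V
    d : Lin W V
    d = boundary Z (suc m)
    vs : List ∣ V ∣
    vs = map (d ⟨$⟩_) (map δ S)
    S⊆ : ∀ {σ} → σ ∈ S → σ ∈ facesOfSize Z (suc m)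
    S⊆ = Sublist.lookup S⊑
    vs-len : length vs ≡ length S
    vs-len = ≡.trans (length-map _ (map δ S)) (length-map δ S)
    ind : LinIndep V vs
    ind as len eq = S-ind as (≡.trans len vs-len) λ ρ ρ∈ →
      trans (sym (comb-boundary Z as S S⊆ ρ)) (eq ρ (∈-facesOfSize⁻ Z ρ∈))

    annihilates-columns : ∀ (l : Lin V 𝕂) → All (λ v → l ⟨$⟩ v ≈ 0#) vs → ∀ {σ} → σ ∈ facesOfSize Z (suc m) → l ⟨$⟩ d ⟨$⟩ δ σ ≈ 0#
    annihilates-columns l l≈0 {σ} σ∈ with insert S⊑ σ∈
    ... | inj₁ σ∈S = All.lookup l≈0 (∈-map⁺ (d ⟨$⟩_) (∈-map⁺ δ σ∈S))
    ... | inj₂ (S₁ , S₂ , ≡.refl , S′⊑) with dep (S₁ ++ σ ∷ S₂) S′⊑ (≡.trans (length-insert S₁) (≡.cong suc S-len))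
      where
      length-insert : ∀ (xs : List (Face n)) {x ys} → length (xs ++ x ∷ ys) ≡ suc (length (xs ++ ys))
      length-insert [] = ≡.refl
      length-insert (_ ∷ xs) = ≡.cong suc (length-insert xs)
    ... | as , len , zero-comb , nonzero = ScalarProperties.*ₗ-cancel-unit 𝕂 _ a _ (trans (*-comm _ _) (proj₂ (inverse a a≉0))) (begin
        a * l ⟨$⟩ d ⟨$⟩ δ σ                                   ≈⟨ +-identityʳ _ ⟨
        a * l ⟨$⟩ d ⟨$⟩ δ σ + 0#                              ≈⟨ +-cong (Lin.*-homo l a _) (comb-kernel l bs (g S₁ ++ g S₂) l≈0′) ⟨
        l ⟨$⟩ (a V.*ₗ d ⟨$⟩ δ σ) + l ⟨$⟩ comb V bs (g S₁ ++ g S₂) ≈⟨ Lin.+-homo l _ _ ⟨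
        l ⟨$⟩ (a V.*ₗ d ⟨$⟩ δ σ V.+ᴹ comb V bs (g S₁ ++ g S₂))  ≈⟨ Lin.cong l pivot-eq ⟨
        l ⟨$⟩ comb V as (g S₁ ++ d ⟨$⟩ δ σ ∷ g S₂)            ≈⟨ Lin.≈0-homo l comb≈0 ⟩
        0#                                                    ∎)
      where
      open SetoidReasoning setoid
      g : List (Face n) → List ∣ V ∣
      g L = map (d ⟨$⟩_) (map δ L)
      g-++ : ∀ L M → g (L ++ M) ≡ g L ++ g M
      g-++ L M = ≡.trans (≡.cong (map (d ⟨$⟩_)) (map-++ δ L M)) (map-++ (d ⟨$⟩_) (map δ L) (map δ M))
      g-length : ∀ L → length (g L) ≡ length L
      g-length L = ≡.trans (length-map _ (map δ L)) (length-map δ L)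
      l≈0′ : All (λ v → l ⟨$⟩ v ≈ 0#) (g S₁ ++ g S₂)
      l≈0′ = ≡.subst (All _) (g-++ S₁ S₂) l≈0
      pivot = comb-pivot V as (g S₁) (d ⟨$⟩ δ σ) (g S₂)
        (≡.trans len (≡.trans (≡.sym (g-length (S₁ ++ σ ∷ S₂))) (≡.cong length (g-++ S₁ (σ ∷ S₂)))))
      a : Carrier
      a = proj₁ pivot
      bs : List Carrier
      bs = proj₁ (proj₂ pivot)
      pivot-eq : comb V as (g S₁ ++ d ⟨$⟩ δ σ ∷ g S₂) V.≈ᴹ a V.*ₗ d ⟨$⟩ δ σ V.+ᴹ comb V bs (g S₁ ++ g S₂)
      pivot-eq = proj₁ (proj₂ (proj₂ (proj₂ pivot)))
      comb≈0 : comb V as (g S₁ ++ d ⟨$⟩ δ σ ∷ g S₂) V.≈ᴹ V.0ᴹ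
      comb≈0 = ≡.subst (λ L → comb V as L V.≈ᴹ V.0ᴹ) (g-++ S₁ (σ ∷ S₂)) λ ρ ρ∈ →
        trans (comb-boundary Z as (S₁ ++ σ ∷ S₂) (Sublist.lookup S′⊑) ρ) (zero-comb ρ (∈-facesOfSize⁺ Z ρ∈))
      -- With coefficient zero at the new column, the dependence would be one among the independent
      -- columns.
      a≉0 : ¬ (a ≈ 0#)
      a≉0 a≈0 = all≈0⇒¬any (proj₂ (proj₂ (proj₂ (proj₂ pivot))) a≈0 bs≈0) nonzero
        where
        all≈0⇒¬any : ∀ {xs} → All (_≈ 0#) xs → ¬ Any (λ x → ¬ (x ≈ 0#)) xs
        all≈0⇒¬any (x≈0 ∷ _) (here x≉0) = x≉0 x≈0
        all≈0⇒¬any (_ ∷ xs≈0) (there any) = all≈0⇒¬any xs≈0 any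
        bs≈0 : All (_≈ 0#) bs
        bs≈0 = ind bs (≡.trans (proj₁ (proj₂ (proj₂ pivot))) (≡.cong length (≡.sym (g-++ S₁ S₂))))
          (≡.subst (λ L → comb V bs L V.≈ᴹ V.0ᴹ) (≡.sym (g-++ S₁ S₂)) λ ρ ρ∈ →
            trans (sym (trans (+-congʳ (trans (*-congʳ a≈0) (zeroˡ _))) (+-identityˡ _))) (trans (sym (pivot-eq ρ ρ∈)) (comb≈0 ρ ρ∈)))

    annihilates : ∀ (l : Lin V 𝕂) → All (λ v → l ⟨$⟩ v ≈ 0#) vs → ∀ v → l ⟨$⟩ d ⟨$⟩ v ≈ 0#
    annihilates l l≈0 v = trans (Lin.cong (l ∘ᴸ d) (basis-spans Z (suc m) v))
      (Σ⊗-kernel (l ∘ᴸ d) (basis Z (suc m)) (All.map⁺ (All.tabulate (annihilates-columns l l≈0))) v)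

    rank : Split V (length (basis Z m)) vs → Rank d r
    rank split = record
      { inv = inv
      ; size = ≡.trans (tensors-length {V} {W} fs (map δ S) fs-len′) (≡.trans (length-map δ S) S-len)
      ; quasi-inv = λ v → V.≈ᴹ-sym (V.≈ᴹ-trans (Split.split split (d ⟨$⟩ v)) (V.≈ᴹ-trans
          (V.+ᴹ-cong (Σ⊗-tensors-post d fs (map δ S) (d ⟨$⟩ v))
            (Σ⊗-vanish (Split.rest split) (d ⟨$⟩ v) (kill-all (Split.rest split) (Split.kills split) v)))
          (V.+ᴹ-identityʳ (d ⟨$⟩ Σ⊗ inv ⟨$⟩ d ⟨$⟩ v))))
      ; indep = ≡.subst (λ L → LinIndep V (map (d ⟨$⟩_) L)) (≡.sym (tensors-vectors {V} {W} fs (map δ S) fs-len′)) ind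
      }
      where
      fs : List (Lin V 𝕂)
      fs = Split.fs split
      fs-len′ : length fs ≡ length (map δ S)
      fs-len′ = ≡.trans (Split.fs-len split) (length-map _ (map δ S))
      inv : List (Tensor V W)
      inv = tensors W fs (map δ S)
      kill-all : ∀ (R : List (Tensor V V)) → All (λ v → All (λ t → functional t ⟨$⟩ v ≈ 0#) R) vs → ∀ v → All (λ t → functional t ⟨$⟩ d ⟨$⟩ v ≈ 0#) R
      kill-all [] _ v = []
      kill-all (t ∷ R) k v = annihilates (functional t) (All.map All.head k) v ∷ kill-all R (All.map All.tail k) v

  BdryRank⇒Rank : ∀ {n} (Z : Family n) m {r} → BdryRank Z m r → ¬ ¬ Rank (boundary Z m) r
  BdryRank⇒Rank Z (suc m) has = HasRank⇒Rank Z m has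
  -- No face satisfies `InC Z 0`, so the target is the zero space.
  BdryRank⇒Rank Z zero (lift ≡.refl) k = k record
    { inv = []
    ; size = ≡.refl
    ; quasi-inv = λ { v ρ (_ , ()) }
    ; indep = λ { [] _ _ → [] }
    }

  -- The bound makes this a finite conjunction; double negation does not commute with unbounded
  -- quantifiers constructively.
  ¬¬-∀≤ : ∀ {p} {P : ℕ → Set p} k → (∀ i → i ℕ.≤ k → ¬ ¬ P i) → ¬ ¬ (∀ i → i ℕ.≤ k → P i)
  ¬¬-∀≤ zero ps k = ps 0 ℕ.z≤n λ p → k λ { zero _ → p }
  ¬¬-∀≤ {P = P} (suc m) ps k = ps (suc m) ℕ.≤-refl λ p → ¬¬-∀≤ m (λ i i≤m → ps i (ℕ.m≤n⇒m≤1+n i≤m)) λ q →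
    k λ i i≤ → case (ℕ.m≤n⇒m<n∨m≡n i≤) p q
    where
    case : ∀ {i} → i ℕ.< suc m ⊎ i ≡ suc m → P (suc m) → (∀ i → i ℕ.≤ m → P i) → P i
    case (inj₁ (ℕ.s≤s i≤m)) p q = q _ i≤m
    case (inj₂ ≡.refl) p q = p

  -- Homotopies realizing the homology dimensions.

  Closed : ∀ {n} → Family n → Set
  Closed Z = ∀ σ τ → T (σ ⊆ᵇ τ) → T (Z τ) → T (Z σ)

  module _ {n} (Z : Family n) (closedZ : Closed Z) where
    ∂-supp : ∀ {m f} → Supp (InC? Z (suc m)) f → Supp (InC? Z m) (∂ ⟨$⟩ f)
    ∂-supp supp ρ ρ∉ = ∂-local _ ρ λ σ ρ⋖σ → supp σ λ (Zσ , eq) →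
      ρ∉ (closedZ ρ σ (⋖⇒⊆ ρ⋖σ) Zσ , ≡.trans (≡.sym (⋖-card ρ⋖σ)) (ℕ.suc-injective eq))

    boundary² : ∀ m v → LeftModule._≈ᴹ_ (Chains Z m) (boundary Z m ⟨$⟩ boundary Z (suc m) ⟨$⟩ v) (λ _ → 0#)
    boundary² m v ρ _ = trans
      (op-cong ∂ (mask-supp (InC? Z (suc m)) (∂-supp (mask-out (InC? Z (suc (suc m))) v))) ρ) (∂∂≈0 _ ρ)

  -- In contrast to `Contraction`, one family `h` serves all degrees up to `k`. The Künneth argument
  -- needs this, as it composes homotopy and differential across adjacent degrees.
  record Homotopy {n} (Z : Family n) (k : ℕ) (a : ℕ → ℕ) : Set (c ⊔ ℓ) where
    field
      h        : ∀ m → Lin (Chains Z m) (Chains Z (suc m))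
      residue  : ∀ i → List (Tensor (Chains Z (suc i)) (Chains Z (suc i)))
      size     : ∀ i → i ℕ.≤ k → length (residue i) ≡ a i
      homotopy : ∀ i → i ℕ.≤ k → ∀ v → LeftModule._≈ᴹ_ (Chains Z (suc i)) v
        (λ ρ → ((boundary Z (suc i) ⟨$⟩ h (suc i) ⟨$⟩ v) ρ + (h i ⟨$⟩ boundary Z i ⟨$⟩ v) ρ) + (Σ⊗ (residue i) ⟨$⟩ v) ρ)

  -- In each degree `residue-rank` yields a homotopy with `h` on one side and `u` on the other. They
  -- differ by a term containing two consecutive boundaries once composed with the boundary, so `h`
  -- can replace `u` throughout.
  ReducedHomDim⇒Homotopy : ∀ {n} (Z : Family n) → Closed Z → ∀ k a →
    (∀ i → i ℕ.≤ k → ReducedHomDim Z i (a i)) → ¬ ¬ Homotopy Z k a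
  ReducedHomDim⇒Homotopy Z closedZ k a dims goal = ¬¬-∀≤ k ranks λ R → ¬¬-∀≤ k (residues R) λ L →
    goal record
      { h = h R
      ; residue = λ i → proj₁ (total R L i)
      ; size = λ i → proj₁ (proj₂ (total R L i))
      ; homotopy = λ i → proj₂ (proj₂ (total R L i))
      }
    where
    Ranks : ℕ → Set (c ⊔ ℓ)
    Ranks i = Σ ℕ λ r₁ → Σ ℕ λ r₂ → Rank (boundary Z i) r₁ × Rank (boundary Z (suc i)) r₂ × a i ≡ length (facesOfSize Z i) ℕ.∸ r₁ ℕ.∸ r₂
    ranks : ∀ i → i ℕ.≤ k → ¬ ¬ Ranks i
    ranks i i≤k next with dims i i≤k
    ... | r₁ , r₂ , b₁ , b₂ , eq = BdryRank⇒Rank Z i b₁ λ R₁ → BdryRank⇒Rank Z (suc i) b₂ λ R₂ → next (r₁ , r₂ , R₁ , R₂ , eq)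
    sizes : ∀ r₁ r₂ l N a → (r₂ ℕ.+ r₁) ℕ.+ l ≡ N → a ≡ N ℕ.∸ r₁ ℕ.∸ r₂ → l ≡ a
    sizes r₁ r₂ l N a ≡.refl ≡.refl = ≡.sym (≡.trans (≡.cong (λ m → m ℕ.+ l ℕ.∸ r₁ ℕ.∸ r₂) (ℕ.+-comm r₂ r₁))
      (≡.trans (ℕ.∸-+-assoc ((r₁ ℕ.+ r₂) ℕ.+ l) r₁ r₂) (ℕ.m+n∸m≡n (r₁ ℕ.+ r₂) l)))
    module _ (R : ∀ i → i ℕ.≤ k → Ranks i) where
      -- The inverse of the boundary out of degree `suc (suc i)` is always taken from the data of
      -- degree `i`, even when used in the next one, so that the two homotopies match.
      u : ∀ m → Lin (Chains Z m) (Chains Z (suc m))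
      u zero = 0ᴸ
      u (suc i) with i ℕ.≤? k
      ... | yes i≤k = let (_ , _ , _ , R₂ , _) = R i i≤k in Σ⊗ (Rank.inv R₂)
      ... | no _ = 0ᴸ
      u-quasi : ∀ m → m ℕ.≤ suc k → ∀ v → LeftModule._≈ᴹ_ (Chains Z m) (boundary Z m ⟨$⟩ u m ⟨$⟩ boundary Z m ⟨$⟩ v) (boundary Z m ⟨$⟩ v)
      u-quasi zero _ v ρ (_ , ())
      u-quasi (suc i) (ℕ.s≤s i≤k) v with i ℕ.≤? k
      ... | yes i≤k′ = let (_ , _ , _ , R₂ , _) = R i i≤k′ in Rank.quasi-inv R₂ v
      ... | no i≰k = contradiction i≤k i≰k
      h : ∀ m → Lin (Chains Z m) (Chains Z (suc m))
      h zero = 0ᴸ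
      h (suc i) = u (suc i) −ᴸ u (suc i) ∘ᴸ u i ∘ᴸ boundary Z i
      h-boundary : ∀ m v → LeftModule._≈ᴹ_ (Chains Z (suc m)) (h m ⟨$⟩ boundary Z m ⟨$⟩ v) (u m ⟨$⟩ boundary Z m ⟨$⟩ v)
      h-boundary zero v ρ _ = refl
      h-boundary (suc i) v ρ ρ∈ = trans (+-congˡ (-‿cong (Lin.≈0-homo (u (suc i) ∘ᴸ u i) {boundary Z i ⟨$⟩ boundary Z (suc i) ⟨$⟩ v} (boundary² Z closedZ i v) ρ ρ∈)))
        (solve 1 (λ a → a ⊝ ∅ ⊜ a) refl _)

      Residue : ℕ → Set (c ⊔ ℓ)
      Residue i = Σ (List (Tensor (Chains Z (suc i)) (Chains Z (suc i)))) λ L → length L ≡ a i ×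
        (∀ v → LeftModule._≈ᴹ_ (Chains Z (suc i)) v
          (λ ρ → ((boundary Z (suc i) ⟨$⟩ h (suc i) ⟨$⟩ v) ρ + (h i ⟨$⟩ boundary Z i ⟨$⟩ v) ρ) + (Σ⊗ L ⟨$⟩ v) ρ))
      residues : ∀ i → i ℕ.≤ k → ¬ ¬ Residue i
      residues i i≤k next with R i i≤k
      ... | r₁ , r₂ , R₁ , R₂ , a≡ =
        residue-rank (boundary² Z closedZ i) R₁ R₂ (u (suc i)) (u-quasi (suc i) (ℕ.s≤s i≤k)) (u i) (u-quasi i (ℕ.m≤n⇒m≤1+n i≤k))
          (basis Z i) (basis-spans Z i) λ (L , len , eq) → next
            ( L
            , sizes r₁ r₂ _ _ _ (≡.trans len (length-map (unit Z i) (facesOfSize Z i))) a≡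
            , λ v ρ ρ∈ → trans (eq v ρ ρ∈) (+-congʳ (+-congˡ (sym (h-boundary i v ρ ρ∈)))))
      Total : ℕ → Set (c ⊔ ℓ)
      Total i = Σ (List (Tensor (Chains Z (suc i)) (Chains Z (suc i)))) λ L →
        (i ℕ.≤ k → length L ≡ a i) × (i ℕ.≤ k → ∀ v → LeftModule._≈ᴹ_ (Chains Z (suc i)) v
          (λ ρ → ((boundary Z (suc i) ⟨$⟩ h (suc i) ⟨$⟩ v) ρ + (h i ⟨$⟩ boundary Z i ⟨$⟩ v) ρ) + (Σ⊗ L ⟨$⟩ v) ρ))
      total : (∀ i → i ℕ.≤ k → Residue i) → ∀ i → Total i
      total L i = pick (i ℕ.≤? k)
        where
        pick : Dec (i ℕ.≤ k) → Total i
        pick (yes i≤k) = proj₁ (L i i≤k) , (λ _ → proj₁ (proj₂ (L i i≤k))) , λ _ → proj₂ (proj₂ (L i i≤k))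
        -- The residue is a function of all degrees; those above `k` are filled with the empty list.
        pick (no i≰k) = [] , (λ i≤k → contradiction i≤k i≰k) , λ i≤k → contradiction i≤k i≰k

  -- The Künneth formula

  module _ (W : Space) where
    open LeftModule W
    open SetoidReasoning ≈ᴹ-setoid
    private module S = AbelianGroupSolver +ᴹ-abelianGroup
    open S using () renaming (solve to solveᴹ; _⊕_ to infixl 6 _⊕ᴹ_; _⊝_ to infixl 6 _⊝ᴹ_; ⊖_ to infix 8 ⊖ᴹ_; _⊜_ to infix 4 _⊜ᴹ_; ∅ to ∅ᴹ)

    private
      Anticommute : Lin W W → Lin W W → Set (c ⊔ ℓ)
      Anticommute f g = ∀ v → f ⟨$⟩ g ⟨$⟩ v ≈ᴹ -ᴹ (g ⟨$⟩ f ⟨$⟩ v)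

    -- 1 ≃ PA via hA and 1 ≃ PB via hB give 1 ≃ PA PB.
    künneth : ∀ (dA dB hA hB : Lin W W) → (∀ v → dA ⟨$⟩ dA ⟨$⟩ v ≈ᴹ 0ᴹ) →
      Anticommute dA dB → Anticommute hA dB → Anticommute dA hB →
      let PA = idᴸ −ᴸ dA ∘ᴸ hA −ᴸ hA ∘ᴸ dA
          PB = idᴸ −ᴸ dB ∘ᴸ hB −ᴸ hB ∘ᴸ dB
          d = dA +ᴸ dB
          H = hA +ᴸ PA ∘ᴸ hB
      in ∀ v → v ≈ᴹ (d ⟨$⟩ H ⟨$⟩ v +ᴹ H ⟨$⟩ d ⟨$⟩ v) +ᴹ PA ⟨$⟩ PB ⟨$⟩ v
    künneth dA dB hA hB dAdA dAdB hAdB dAhB v = begin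
      v
        -- The cross terms `z = hA dB v` and `w = PA hB dA v` occur with both signs: anticommutation
        -- produces the negative ones in `dH`, and `Hd` contains the positive ones.
        ≈⟨ solveᴹ 7 (λ v x y z w p q → v ⊜ᴹ (((x ⊕ᴹ ⊖ᴹ z) ⊕ᴹ (⊖ᴹ w ⊕ᴹ p)) ⊕ᴹ ((y ⊕ᴹ z) ⊕ᴹ (w ⊕ᴹ q))) ⊕ᴹ ((((v ⊝ᴹ x) ⊝ᴹ y) ⊝ᴹ p) ⊝ᴹ q)) ≈ᴹ-refl
             v (dA ⟨$⟩ hA ⟨$⟩ v) (hA ⟨$⟩ dA ⟨$⟩ v) (hA ⟨$⟩ dB ⟨$⟩ v) (PA ⟨$⟩ hB ⟨$⟩ dA ⟨$⟩ v) (PA ⟨$⟩ dB ⟨$⟩ hB ⟨$⟩ v) (PA ⟨$⟩ hB ⟨$⟩ dB ⟨$⟩ v) ⟩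
      (((dA ⟨$⟩ hA ⟨$⟩ v +ᴹ -ᴹ (hA ⟨$⟩ dB ⟨$⟩ v)) +ᴹ (-ᴹ (PA ⟨$⟩ hB ⟨$⟩ dA ⟨$⟩ v) +ᴹ PA ⟨$⟩ dB ⟨$⟩ hB ⟨$⟩ v))
        +ᴹ ((hA ⟨$⟩ dA ⟨$⟩ v +ᴹ hA ⟨$⟩ dB ⟨$⟩ v) +ᴹ (PA ⟨$⟩ hB ⟨$⟩ dA ⟨$⟩ v +ᴹ PA ⟨$⟩ hB ⟨$⟩ dB ⟨$⟩ v)))
        +ᴹ ((PA ⟨$⟩ v +ᴹ -ᴹ (PA ⟨$⟩ dB ⟨$⟩ hB ⟨$⟩ v)) +ᴹ -ᴹ (PA ⟨$⟩ hB ⟨$⟩ dB ⟨$⟩ v))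
        ≈⟨ +ᴹ-cong (+ᴹ-cong dH Hd) PAPB ⟨
      (d ⟨$⟩ H ⟨$⟩ v +ᴹ H ⟨$⟩ d ⟨$⟩ v) +ᴹ PA ⟨$⟩ PB ⟨$⟩ v ∎
      where
      PA PB d H : Lin W W
      PA = idᴸ −ᴸ dA ∘ᴸ hA −ᴸ hA ∘ᴸ dA
      PB = idᴸ −ᴸ dB ∘ᴸ hB −ᴸ hB ∘ᴸ dB
      d = dA +ᴸ dB
      H = hA +ᴸ PA ∘ᴸ hB
      dBhA : Anticommute dB hA
      dBhA w = ≈ᴹ-trans (solveᴹ 1 (λ x → x ⊜ᴹ ⊖ᴹ (⊖ᴹ x)) ≈ᴹ-refl _) (-ᴹ‿cong (≈ᴹ-sym (hAdB w)))
      dBdA : Anticommute dB dA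
      dBdA w = ≈ᴹ-trans (solveᴹ 1 (λ x → x ⊜ᴹ ⊖ᴹ (⊖ᴹ x)) ≈ᴹ-refl _) (-ᴹ‿cong (≈ᴹ-sym (dAdB w)))
      PA-dA : ∀ w → dA ⟨$⟩ PA ⟨$⟩ w ≈ᴹ PA ⟨$⟩ dA ⟨$⟩ w
      PA-dA w = begin
        dA ⟨$⟩ PA ⟨$⟩ w
          ≈⟨ ≈ᴹ-trans (Lin.−-homo dA _ _) (+ᴹ-congʳ (Lin.−-homo dA _ _)) ⟩
        (dA ⟨$⟩ w +ᴹ -ᴹ (dA ⟨$⟩ dA ⟨$⟩ hA ⟨$⟩ w)) +ᴹ -ᴹ (dA ⟨$⟩ hA ⟨$⟩ dA ⟨$⟩ w)
          ≈⟨ +ᴹ-congʳ (+ᴹ-congˡ (-ᴹ‿cong (dAdA _))) ⟩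
        (dA ⟨$⟩ w +ᴹ -ᴹ 0ᴹ) +ᴹ -ᴹ (dA ⟨$⟩ hA ⟨$⟩ dA ⟨$⟩ w)
          ≈⟨ solveᴹ 2 (λ x y → (x ⊝ᴹ ∅ᴹ) ⊝ᴹ y ⊜ᴹ (x ⊝ᴹ y) ⊝ᴹ ∅ᴹ) ≈ᴹ-refl _ _ ⟩
        (dA ⟨$⟩ w +ᴹ -ᴹ (dA ⟨$⟩ hA ⟨$⟩ dA ⟨$⟩ w)) +ᴹ -ᴹ 0ᴹ
          ≈⟨ +ᴹ-congˡ (-ᴹ‿cong (Lin.≈0-homo hA (dAdA w))) ⟨
        PA ⟨$⟩ dA ⟨$⟩ w ∎
      PA-dB : ∀ w → dB ⟨$⟩ PA ⟨$⟩ w ≈ᴹ PA ⟨$⟩ dB ⟨$⟩ w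
      PA-dB w = ≈ᴹ-trans (Lin.−-homo dB _ _) (+ᴹ-cong (≈ᴹ-trans (Lin.−-homo dB _ _) (+ᴹ-congˡ (-ᴹ‿cong
        (commute dA hA dBdA dBhA)))) (-ᴹ‿cong (commute hA dA dBhA dBdA)))
        where
        commute : ∀ f g → Anticommute dB f → Anticommute dB g → dB ⟨$⟩ f ⟨$⟩ g ⟨$⟩ w ≈ᴹ f ⟨$⟩ g ⟨$⟩ dB ⟨$⟩ w
        commute f g af ag = begin
          dB ⟨$⟩ f ⟨$⟩ g ⟨$⟩ w          ≈⟨ af _ ⟩
          -ᴹ (f ⟨$⟩ dB ⟨$⟩ g ⟨$⟩ w)     ≈⟨ -ᴹ‿cong (Lin.cong f (ag w)) ⟩
          -ᴹ (f ⟨$⟩ (-ᴹ (g ⟨$⟩ dB ⟨$⟩ w))) ≈⟨ -ᴹ‿cong (Lin.-‿homo f _) ⟩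
          -ᴹ (-ᴹ (f ⟨$⟩ g ⟨$⟩ dB ⟨$⟩ w)) ≈⟨ solveᴹ 1 (λ x → ⊖ᴹ (⊖ᴹ x) ⊜ᴹ x) ≈ᴹ-refl _ ⟩
          f ⟨$⟩ g ⟨$⟩ dB ⟨$⟩ w          ∎
      dH : d ⟨$⟩ H ⟨$⟩ v ≈ᴹ (dA ⟨$⟩ hA ⟨$⟩ v +ᴹ -ᴹ (hA ⟨$⟩ dB ⟨$⟩ v)) +ᴹ (-ᴹ (PA ⟨$⟩ hB ⟨$⟩ dA ⟨$⟩ v) +ᴹ PA ⟨$⟩ dB ⟨$⟩ hB ⟨$⟩ v)
      dH = ≈ᴹ-trans (Lin.+-homo d _ _) (+ᴹ-cong (+ᴹ-congˡ (dBhA v))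
        (+ᴹ-cong (≈ᴹ-trans (PA-dA _) (≈ᴹ-trans (Lin.cong PA (dAhB v)) (Lin.-‿homo PA _))) (PA-dB _)))
      Hd : H ⟨$⟩ d ⟨$⟩ v ≈ᴹ (hA ⟨$⟩ dA ⟨$⟩ v +ᴹ hA ⟨$⟩ dB ⟨$⟩ v) +ᴹ (PA ⟨$⟩ hB ⟨$⟩ dA ⟨$⟩ v +ᴹ PA ⟨$⟩ hB ⟨$⟩ dB ⟨$⟩ v)
      Hd = +ᴹ-cong (Lin.+-homo hA _ _) (Lin.+-homo (PA ∘ᴸ hB) _ _)
      PAPB : PA ⟨$⟩ PB ⟨$⟩ v ≈ᴹ (PA ⟨$⟩ v +ᴹ -ᴹ (PA ⟨$⟩ dB ⟨$⟩ hB ⟨$⟩ v)) +ᴹ -ᴹ (PA ⟨$⟩ hB ⟨$⟩ dB ⟨$⟩ v)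
      PAPB = ≈ᴹ-trans (Lin.−-homo PA _ _) (+ᴹ-congʳ (Lin.−-homo PA _ _))

  signPow² : ∀ p → signPow p * signPow p ≈ 1#
  signPow² zero = *-identityˡ 1#
  signPow² (suc p) = trans (sym (-‿distribˡ-* ring _ _)) (trans (-‿cong (sym (-‿distribʳ-* ring _ _))) (trans (-‿involutive ring _) (signPow² p)))

  scaleOp : ∀ {I} → (I → Carrier) → Op I I
  scaleOp s = record
    { _⟨$⟩_ = λ v x → s x * v x
    ; cong = λ e x _ → *-congˡ (e x tt)
    ; +-homo = λ v w x _ → distribˡ _ _ _
    ; *-homo = λ a v x _ → trans (sym (*-assoc _ _ _)) (trans (*-congʳ (*-comm _ _)) (*-assoc _ _ _))
    }

  op-Σ : ∀ {I J A : Set} (T : Op I J) (L : List A) (cs : A → Carrier) (v : A → I → Carrier) y →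
    (T ⟨$⟩ (λ x → Σᴸ L (λ s → cs s * v s x))) y ≈ Σᴸ L (λ s → cs s * (T ⟨$⟩ v s) y)
  op-Σ T [] cs v y = op-0 T (λ _ → refl) y
  op-Σ T (s ∷ L) cs v y = trans (op-+ T _ _ y) (+-cong (op-* T _ _ y) (op-Σ T L cs v y))

  Σᴸ-cong : ∀ {A : Set} (L : List A) {f g : A → Carrier} → (∀ x → f x ≈ g x) → Σᴸ L f ≈ Σᴸ L g
  Σᴸ-cong [] e = refl
  Σᴸ-cong (x ∷ L) e = +-cong (e x) (Σᴸ-cong L e)

  op-expansion : ∀ {n J} (S : Op (Face n) J) f y → (S ⟨$⟩ f) y ≈ Σᴸ (allFaces n) (λ σ → f σ * (S ⟨$⟩ δ σ) y)
  op-expansion {n} S f y = trans (op-cong S (λ ρ → sym (δ-expansion f ρ)) y) (op-Σ S (allFaces n) f δ y)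

  -- One of the two operators has to be given by a finite matrix.
  interchange : ∀ {n I J J′} (S : Op (Face n) J) (T : Op I J′) (g : Face n → I → Carrier) y z →
    (S ⟨$⟩ (λ σ → (T ⟨$⟩ g σ) z)) y ≈ (T ⟨$⟩ (λ x → (S ⟨$⟩ (λ σ → g σ x)) y)) z
  interchange {n} S T g y z = begin
    (S ⟨$⟩ (λ σ → (T ⟨$⟩ g σ) z)) y
      ≈⟨ op-expansion S _ y ⟩
    Σᴸ (allFaces n) (λ σ → (T ⟨$⟩ g σ) z * (S ⟨$⟩ δ σ) y)
      ≈⟨ Σᴸ-cong (allFaces n) (λ _ → *-comm _ _) ⟩
    Σᴸ (allFaces n) (λ σ → (S ⟨$⟩ δ σ) y * (T ⟨$⟩ g σ) z)
      ≈⟨ op-Σ T (allFaces n) _ g z ⟨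
    (T ⟨$⟩ (λ x → Σᴸ (allFaces n) (λ σ → (S ⟨$⟩ δ σ) y * g σ x))) z
      ≈⟨ op-cong T (λ x → trans (op-expansion S _ y) (Σᴸ-cong (allFaces n) (λ _ → *-comm _ _))) z ⟨
    (T ⟨$⟩ (λ x → (S ⟨$⟩ (λ σ → g σ x)) y)) z ∎
    where open SetoidReasoning setoid

  -- The grading involution, source of the Koszul sign in tensor products.
  ε : ∀ {n} → Op (Face n) (Face n)
  ε = scaleOp (λ σ → signPow (card σ))

  ∂-ε : ∀ {n} (f : Face n → Carrier) ρ → (∂ ⟨$⟩ ε ⟨$⟩ f) ρ ≈ - (ε ⟨$⟩ ∂ ⟨$⟩ f) ρ
  ∂-ε f [] = sym (trans (-‿cong (zeroʳ _)) -0≈0)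
  ∂-ε f (false ∷ ρ) = trans (+-cong (∂-ε _ ρ) (sym (-‿distribˡ-* ring _ _)))
    (trans (solve 2 (λ x y → ⊖ x ⊕ ⊖ y ⊜ ⊖ (x ⊕ y)) refl _ _) (-‿cong (sym (distribˡ _ _ _))))
  ∂-ε f (true ∷ ρ) = -‿cong (begin
    (∂ ⟨$⟩ (λ σ → (- signPow (card σ)) * f (true ∷ σ))) ρ   ≈⟨ op-cong ∂ (λ σ → sym (-‿distribˡ-* ring _ _)) ρ ⟩
    (∂ ⟨$⟩ (λ σ → - (signPow (card σ) * f (true ∷ σ)))) ρ   ≈⟨ op-neg ∂ _ ρ ⟩
    - (∂ ⟨$⟩ ε ⟨$⟩ (λ σ → f (true ∷ σ))) ρ                   ≈⟨ -‿cong (∂-ε _ ρ) ⟩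
    - - (signPow (card ρ) * (∂ ⟨$⟩ (λ σ → f (true ∷ σ))) ρ)  ≈⟨ -‿cong (-‿distribʳ-* ring _ _) ⟩
    - (signPow (card ρ) * - (∂ ⟨$⟩ (λ σ → f (true ∷ σ))) ρ)  ≈⟨ -‿distribˡ-* ring _ _ ⟩
    (- signPow (card ρ)) * - (∂ ⟨$⟩ (λ σ → f (true ∷ σ))) ρ  ∎)
    where open SetoidReasoning setoid

  ∂-cong-local : ∀ {n} {f g : Face n → Carrier} ρ → (∀ σ → ρ ⋖ σ → f σ ≈ g σ) → (∂ ⟨$⟩ f) ρ ≈ (∂ ⟨$⟩ g) ρ
  ∂-cong-local {f = f} {g} ρ e = begin
    (∂ ⟨$⟩ f) ρ                                             ≈⟨ op-cong ∂ (λ σ → solve 2 (λ x y → x ⊜ y ⊕ (x ⊝ y)) refl (f σ) (g σ)) ρ ⟩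
    (∂ ⟨$⟩ (λ σ → g σ + (f σ + - g σ))) ρ                   ≈⟨ op-+ ∂ _ _ ρ ⟩
    (∂ ⟨$⟩ g) ρ + (∂ ⟨$⟩ (λ σ → f σ + - g σ)) ρ             ≈⟨ +-congˡ (∂-local _ ρ (λ σ c → trans (+-congʳ (e σ c)) (-‿inverseʳ _))) ⟩
    (∂ ⟨$⟩ g) ρ + 0#                                        ≈⟨ +-identityʳ _ ⟩
    (∂ ⟨$⟩ g) ρ                                             ∎
    where open SetoidReasoning setoid

  -- `künneth` concerns operators on one space, so the degreewise homotopy is assembled into
  -- operators on all functions of faces. The degree is recovered from `Local`.
  module TotalOperators {n} (Z : Family n) (closedZ : Closed Z) {k a} (H : Homotopy Z k a) where
    open Homotopy H

    member? : Decidable (λ σ → T (Z σ))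
    member? σ = Bool.T? (Z σ)

    private
      m : (Face n → Carrier) → Face n → Carrier
      m = mask member?

    ∂ᶻ : Op (Face n) (Face n)
    ∂ᶻ = maskOp member? ∘ᴸ ∂ ∘ᴸ maskOp member?

    -- A face `σ` is a basis element of `Chains Z (suc (card σ))`, the target of `h (card σ)`; this
    -- component determines the value at `σ`.
    hᶻ : Op (Face n) (Face n)
    hᶻ = record
      { _⟨$⟩_ = λ f → m (λ σ → (h (card σ) ⟨$⟩ f) σ)
      ; cong = λ {f} {g} e σ _ → mask-cong member? (λ σ → (h (card σ) ⟨$⟩ f) σ) (λ σ → (h (card σ) ⟨$⟩ g) σ) σ (λ σ∈ → Lin.cong (h (card σ)) (λ x _ → e x tt) σ (σ∈ , ≡.refl))
      ; +-homo = λ f g σ _ → mask-+ member? (λ σ → (h (card σ) ⟨$⟩ (λ x → f x + g x)) σ) (λ σ → (h (card σ) ⟨$⟩ f) σ) (λ σ → (h (card σ) ⟨$⟩ g) σ) σ (λ σ∈ → Lin.+-homo (h (card σ)) f g σ (σ∈ , ≡.refl))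
      ; *-homo = λ x f σ _ → mask-* member? (λ σ → (h (card σ) ⟨$⟩ (λ y → x * f y)) σ) x (λ σ → (h (card σ) ⟨$⟩ f) σ) σ (λ σ∈ → Lin.*-homo (h (card σ)) x f σ (σ∈ , ≡.refl))
      }

    Pᶻ : Op (Face n) (Face n)
    Pᶻ = idᴸ −ᴸ ∂ᶻ ∘ᴸ hᶻ −ᴸ hᶻ ∘ᴸ ∂ᶻ

    ∂-members : ∀ {f} → Supp member? f → Supp member? (∂ ⟨$⟩ f)
    ∂-members supp ρ ρ∉ = ∂-local _ ρ λ σ ρ⋖σ → supp σ λ Zσ → ρ∉ (closedZ ρ σ (⋖⇒⊆ ρ⋖σ) Zσ)

    ∂ᶻ≈∂ : ∀ {f} → Supp member? f → ∀ ρ → (∂ᶻ ⟨$⟩ f) ρ ≈ (∂ ⟨$⟩ f) ρ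
    ∂ᶻ≈∂ {f} supp ρ = trans (op-cong (maskOp member? ∘ᴸ ∂) (mask-supp member? supp) ρ) (mask-supp member? (∂-members supp) ρ)

    ∂ᶻ∂ᶻ≈0 : ∀ f ρ → (∂ᶻ ⟨$⟩ ∂ᶻ ⟨$⟩ f) ρ ≈ 0#
    ∂ᶻ∂ᶻ≈0 f ρ = trans (∂ᶻ≈∂ (mask-out member? _) ρ)
      (trans (op-cong ∂ (mask-supp member? (∂-members (mask-out member? f))) ρ) (∂∂≈0 _ ρ))

    -- In particular S f vanishes off Z.
    Local : Op (Face n) (Face n) → (ℕ → ℕ → Set) → Set (c ⊔ ℓ)
    Local S R = ∀ f ρ → (T (Z ρ) → ∀ σ → T (Z σ) → R (card σ) (card ρ) → f σ ≈ 0#) → (S ⟨$⟩ f) ρ ≈ 0#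

    ∂ᶻ-local : Local ∂ᶻ (λ s r → s ≡ suc r)
    ∂ᶻ-local f ρ f≈0 = mask-≈0 member? (∂ ⟨$⟩ m f) ρ λ ρ∈ → ∂-local _ ρ λ σ ρ⋖σ →
      mask-≈0 member? f σ λ σ∈ → f≈0 ρ∈ σ σ∈ (⋖-card ρ⋖σ)

    hᶻ-local : Local hᶻ (λ s r → suc s ≡ r)
    hᶻ-local f ρ f≈0 = mask-≈0 member? (λ σ → (h (card σ) ⟨$⟩ f) σ) ρ λ ρ∈ →
      Lin.≈0-homo (h (card ρ)) (λ σ (σ∈ , eq) → f≈0 ρ∈ σ σ∈ eq) ρ (ρ∈ , ≡.refl)

    mask-ε : ∀ f σ → m (ε ⟨$⟩ f) σ ≈ (ε ⟨$⟩ m f) σ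
    mask-ε f σ = mask-* member? (ε ⟨$⟩ f) _ f σ (λ _ → refl)

    ∂ᶻ-ε : ∀ f ρ → (∂ᶻ ⟨$⟩ ε ⟨$⟩ f) ρ ≈ - (ε ⟨$⟩ ∂ᶻ ⟨$⟩ f) ρ
    ∂ᶻ-ε f ρ = begin
      m (∂ ⟨$⟩ m (ε ⟨$⟩ f)) ρ       ≈⟨ op-cong (maskOp member? ∘ᴸ ∂) (mask-ε f) ρ ⟩
      m (∂ ⟨$⟩ ε ⟨$⟩ m f) ρ         ≈⟨ op-cong (maskOp member?) (∂-ε (m f)) ρ ⟩
      m (λ σ → - (ε ⟨$⟩ ∂ ⟨$⟩ m f) σ) ρ ≈⟨ op-neg (maskOp member?) (ε ⟨$⟩ ∂ ⟨$⟩ m f) ρ ⟩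
      - m (ε ⟨$⟩ ∂ ⟨$⟩ m f) ρ       ≈⟨ -‿cong (mask-ε (∂ ⟨$⟩ m f) ρ) ⟩
      - (ε ⟨$⟩ ∂ᶻ ⟨$⟩ f) ρ          ∎
      where open SetoidReasoning setoid

    hᶻ-ε : ∀ f ρ → (hᶻ ⟨$⟩ ε ⟨$⟩ f) ρ ≈ - (ε ⟨$⟩ hᶻ ⟨$⟩ f) ρ
    hᶻ-ε f ρ = trans (mask-* member? (λ σ → (h (card σ) ⟨$⟩ ε ⟨$⟩ f) σ) (- signPow (card ρ)) (λ σ → (h (card σ) ⟨$⟩ f) σ) ρ λ ρ∈ →
        trans (Lin.cong (h (card ρ)) sign ρ (ρ∈ , ≡.refl)) (Lin.*-homo (h (card ρ)) _ f ρ (ρ∈ , ≡.refl)))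
      (sym (-‿distribˡ-* ring _ _))
      where
      sign : ∀ σ → InC Z (card ρ) σ → signPow (card σ) * f σ ≈ (- signPow (card ρ)) * f σ
      sign σ (_ , eq) = *-congʳ (trans (sym (-‿involutive ring _)) (-‿cong (reflexive (≡.cong signPow eq))))

    Pᶻ-residue : ∀ f ρ → T (Z ρ) → card ρ ℕ.≤ k → (Pᶻ ⟨$⟩ f) ρ ≈ (Σ⊗ (residue (card ρ)) ⟨$⟩ f) ρ
    Pᶻ-residue f ρ ρ∈ ρ≤k = begin
      (f ρ + - (∂ᶻ ⟨$⟩ hᶻ ⟨$⟩ f) ρ) + - (hᶻ ⟨$⟩ ∂ᶻ ⟨$⟩ f) ρ
        ≈⟨ +-cong (+-cong (homotopy i ρ≤k f ρ (ρ∈ , ≡.refl)) (-‿cong ∂h)) (-‿cong h∂) ⟩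
      ((((boundary Z (suc i) ⟨$⟩ h (suc i) ⟨$⟩ f) ρ + (h i ⟨$⟩ boundary Z i ⟨$⟩ f) ρ) + (Σ⊗ (residue i) ⟨$⟩ f) ρ)
        + - (boundary Z (suc i) ⟨$⟩ h (suc i) ⟨$⟩ f) ρ) + - (h i ⟨$⟩ boundary Z i ⟨$⟩ f) ρ
        ≈⟨ solve 3 (λ x y z → ((((x ⊕ y) ⊕ z) ⊝ x) ⊝ y) ⊜ z) refl _ _ _ ⟩
      (Σ⊗ (residue i) ⟨$⟩ f) ρ ∎
      where
      open SetoidReasoning setoid
      i : ℕ
      i = card ρ
      ∂h : (∂ᶻ ⟨$⟩ hᶻ ⟨$⟩ f) ρ ≈ (boundary Z (suc i) ⟨$⟩ h (suc i) ⟨$⟩ f) ρ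
      ∂h = trans (mask-in member? (∂ ⟨$⟩ m (hᶻ ⟨$⟩ f)) ρ ρ∈) (∂-cong-local ρ λ σ ρ⋖σ → go σ (⋖-card ρ⋖σ))
        where
        go : ∀ σ → card σ ≡ suc i → m (hᶻ ⟨$⟩ f) σ ≈ mask (InC? Z (suc (suc i))) (h (suc i) ⟨$⟩ f) σ
        go σ eq = mask-≗ member? (InC? Z (suc (suc i))) (hᶻ ⟨$⟩ f) (h (suc i) ⟨$⟩ f) σ (λ σ∈ → σ∈ , ≡.cong suc eq) proj₁ λ σ∈ →
          trans (mask-in member? (λ σ → (h (card σ) ⟨$⟩ f) σ) σ σ∈) (reflexive (≡.cong (λ j → (h j ⟨$⟩ f) σ) eq))
      h∂ : (hᶻ ⟨$⟩ ∂ᶻ ⟨$⟩ f) ρ ≈ (h i ⟨$⟩ boundary Z i ⟨$⟩ f) ρ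
      h∂ = trans (mask-in member? (λ σ → (h (card σ) ⟨$⟩ ∂ᶻ ⟨$⟩ f) σ) ρ ρ∈) (Lin.cong (h i) same ρ (ρ∈ , ≡.refl))
        where
        same : ∀ τ → InC Z i τ → (∂ᶻ ⟨$⟩ f) τ ≈ (boundary Z i ⟨$⟩ f) τ
        same τ (τ∈ , eq) = trans (mask-in member? (∂ ⟨$⟩ m f) τ τ∈) (∂-cong-local τ λ σ τ⋖σ → go σ (≡.trans (≡.cong suc (⋖-card τ⋖σ)) (≡.cong suc eq)))
          where
          go : ∀ σ → suc (card σ) ≡ suc i → m f σ ≈ mask (InC? Z (suc i)) f σ
          go σ eq′ = mask-≗ member? (InC? Z (suc i)) f f σ (λ σ∈ → σ∈ , eq′) proj₁ (λ _ → refl)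

  -- Tensor products of complexes and of their homotopies.

  module _ {n : ℕ} {J : Set} where
    lift₁ : Op (Face n) (Face n) → Op (Face n × J) (Face n × J)
    lift₁ S = record
      { _⟨$⟩_ = λ g x → (S ⟨$⟩ (λ α → g (α , proj₂ x))) (proj₁ x)
      ; cong = λ e x _ → op-cong S (λ α → e _ tt) _
      ; +-homo = λ g g′ x _ → op-+ S _ _ _
      ; *-homo = λ a g x _ → op-* S a _ _
      }

    lift₂ : Op J J → Op (Face n × J) (Face n × J)
    lift₂ S = record
      { _⟨$⟩_ = λ g x → (S ⟨$⟩ (λ τ → g (proj₁ x , τ))) (proj₂ x)
      ; cong = λ e x _ → op-cong S (λ τ → e _ tt) _
      ; +-homo = λ g g′ x _ → op-+ S _ _ _
      ; *-homo = λ a g x _ → op-* S a _ _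
      }

    ε₁ : Op (Face n × J) (Face n × J)
    ε₁ = scaleOp (λ x → signPow (card (proj₁ x)))

    -- The second differential is a parameter: `∂` for the Künneth product, `q` for D and `lift₂ ∂`
    -- for its graded pieces.
    d⊗ : Op J J → Op (Face n × J) (Face n × J)
    d⊗ q = lift₁ ∂ +ᴸ ε₁ ∘ᴸ lift₂ q

    -- Passing `S` through `ε₁` costs the sign; operators on different factors commute by
    -- `interchange`.
    lift-anticommute : ∀ S T → (∀ f ρ → (S ⟨$⟩ ε ⟨$⟩ f) ρ ≈ - (ε ⟨$⟩ S ⟨$⟩ f) ρ) →
      ∀ g x → (lift₁ S ⟨$⟩ ε₁ ⟨$⟩ lift₂ T ⟨$⟩ g) x ≈ - (ε₁ ⟨$⟩ lift₂ T ⟨$⟩ lift₁ S ⟨$⟩ g) x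
    lift-anticommute S T anti g (α , τ) = trans (anti _ α) (-‿cong (*-congˡ (interchange S T (λ α′ τ′ → g (α′ , τ′)) α τ)))

    lift₂-ε₁ : ∀ S T g α τ →
      (ε₁ ⟨$⟩ lift₂ S ⟨$⟩ ε₁ ⟨$⟩ lift₂ T ⟨$⟩ g) (α , τ) ≈ (S ⟨$⟩ T ⟨$⟩ (λ τ′ → g (α , τ′))) τ
    lift₂-ε₁ S T g α τ = trans (*-congˡ (op-* S _ _ τ)) (trans (sym (*-assoc _ _ _)) (trans (*-congʳ (signPow² (card α))) (*-identityˡ _)))

    d⊗d⊗≈0 : ∀ q → (∀ g x → (q ⟨$⟩ q ⟨$⟩ g) x ≈ 0#) → ∀ g x → (d⊗ q ⟨$⟩ d⊗ q ⟨$⟩ g) x ≈ 0#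
    d⊗d⊗≈0 q qq≈0 g x@(α , τ) = begin
      (d⊗ q ⟨$⟩ d⊗ q ⟨$⟩ g) x
        ≈⟨ op-+ (d⊗ q) _ _ x ⟩
      ((lift₁ ∂ ⟨$⟩ lift₁ ∂ ⟨$⟩ g) x + (ε₁ ⟨$⟩ lift₂ q ⟨$⟩ lift₁ ∂ ⟨$⟩ g) x) +
      ((lift₁ ∂ ⟨$⟩ ε₁ ⟨$⟩ lift₂ q ⟨$⟩ g) x + (ε₁ ⟨$⟩ lift₂ q ⟨$⟩ ε₁ ⟨$⟩ lift₂ q ⟨$⟩ g) x)
        ≈⟨ +-cong (+-congʳ (∂∂≈0 _ α)) (+-cong (lift-anticommute ∂ q ∂-ε g x) (trans (lift₂-ε₁ q q g α τ) (qq≈0 _ τ))) ⟩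
      (0# + (ε₁ ⟨$⟩ lift₂ q ⟨$⟩ lift₁ ∂ ⟨$⟩ g) x) + (- (ε₁ ⟨$⟩ lift₂ q ⟨$⟩ lift₁ ∂ ⟨$⟩ g) x + 0#)
        ≈⟨ solve 1 (λ y → (∅ ⊕ y) ⊕ (⊖ y ⊕ ∅) ⊜ ∅) refl _ ⟩
      0# ∎
      where open SetoidReasoning setoid

  In⊗ : ∀ {n} → Family n → Family n → ℕ → Face n × Face n → Set
  In⊗ A B m (α , τ) = (T (A α) × T (B τ)) × suc (card α ℕ.+ card τ) ≡ m

  In⊗? : ∀ {n} (A B : Family n) m → Decidable (In⊗ A B m)
  In⊗? A B m (α , τ) = (Bool.T? (A α) ×-dec Bool.T? (B τ)) ×-dec (suc (card α ℕ.+ card τ) ℕ.≟ m)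

  ∂⊗ : ∀ {n} (A B : Family n) m → Lin (Fun (Face n × Face n) (In⊗ A B (suc m))) (Fun (Face n × Face n) (In⊗ A B m))
  ∂⊗ A B m = onSupport (In⊗? A B (suc m)) (d⊗ ∂)

  module Künneth {n} (A B : Family n) (closedA : Closed A) (closedB : Closed B) {k a b}
    (HA : Homotopy A k a) (HB : Homotopy B k b) where
    private
      module HA = Homotopy HA
      module HB = Homotopy HB
      module A = TotalOperators A closedA HA
      module B = TotalOperators B closedB HB
      I : Set
      I = Face n × Face n

    private
      dA dB hA hB PA PB d H : Op I I
      dA = lift₁ A.∂ᶻ
      hA = lift₁ A.hᶻ
      dB = ε₁ ∘ᴸ lift₂ B.∂ᶻ
      hB = ε₁ ∘ᴸ lift₂ B.hᶻ
      PA = idᴸ −ᴸ dA ∘ᴸ hA −ᴸ hA ∘ᴸ dA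
      PB = idᴸ −ᴸ dB ∘ᴸ hB −ᴸ hB ∘ᴸ dB
      d = dA +ᴸ dB
      H = hA +ᴸ PA ∘ᴸ hB

      plain-homotopy : ∀ v x → v x ≈ ((d ⟨$⟩ H ⟨$⟩ v) x + (H ⟨$⟩ d ⟨$⟩ v) x) + (PA ⟨$⟩ PB ⟨$⟩ v) x
      plain-homotopy v x = künneth (Fun I (λ _ → ⊤)) dA dB hA hB
        (λ v x _ → A.∂ᶻ∂ᶻ≈0 _ _)
        (λ v x _ → lift-anticommute A.∂ᶻ B.∂ᶻ A.∂ᶻ-ε v x)
        (λ v x _ → lift-anticommute A.hᶻ B.∂ᶻ A.hᶻ-ε v x)
        (λ v x _ → lift-anticommute A.∂ᶻ B.hᶻ A.∂ᶻ-ε v x) v x tt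

      lift₁-supp : ∀ S R {p q} → A.Local S R → (∀ s r t → R s r → ¬ (suc (r ℕ.+ t) ≡ q) → ¬ (suc (s ℕ.+ t) ≡ p)) →
        ∀ {w} → Supp (In⊗? A B p) w → Supp (In⊗? A B q) (lift₁ S ⟨$⟩ w)
      lift₁-supp S R loc shift supp (α , τ) x∉ = loc _ α λ α∈ σ σ∈ r → supp (σ , τ) λ ((_ , τ∈) , eq) →
        shift _ _ (card τ) r (λ e → x∉ ((α∈ , τ∈) , e)) eq

      lift₂-supp : ∀ S R {p q} → B.Local S R → (∀ s r t → R s r → ¬ (suc (t ℕ.+ r) ≡ q) → ¬ (suc (t ℕ.+ s) ≡ p)) →
        ∀ {w} → Supp (In⊗? A B p) w → Supp (In⊗? A B q) (lift₂ S ⟨$⟩ w)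
      lift₂-supp S R loc shift supp (α , τ) x∉ = loc _ τ λ τ∈ σ σ∈ r → supp (α , σ) λ ((α∈ , _) , eq) →
        shift _ _ (card α) r (λ e → x∉ ((α∈ , τ∈) , e)) eq

      ε₁-supp : ∀ {p w} → Supp (In⊗? A B p) w → Supp (In⊗? A B p) (ε₁ ⟨$⟩ w)
      ε₁-supp supp x x∉ = trans (*-congˡ (supp x x∉)) (zeroʳ _)

      −-supp : ∀ {p v w} → Supp (In⊗? A B p) v → Supp (In⊗? A B p) w → Supp (In⊗? A B p) (λ x → v x + - w x)
      −-supp sv sw x x∉ = trans (+-cong (sv x x∉) (-‿cong (sw x x∉))) (-‿inverseʳ 0#)

      +-supp : ∀ {p v w} → Supp (In⊗? A B p) v → Supp (In⊗? A B p) w → Supp (In⊗? A B p) (λ x → v x + w x)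
      +-supp sv sw x x∉ = trans (+-cong (sv x x∉) (sw x x∉)) (+-identityˡ 0#)

      dA-supp : ∀ {m w} → Supp (In⊗? A B (suc m)) w → Supp (In⊗? A B m) (dA ⟨$⟩ w)
      dA-supp = lift₁-supp A.∂ᶻ (λ s r → s ≡ suc r) A.∂ᶻ-local λ { s r t ≡.refl ne eq → ne (ℕ.suc-injective eq) }
      hA-supp : ∀ {m w} → Supp (In⊗? A B m) w → Supp (In⊗? A B (suc m)) (hA ⟨$⟩ w)
      hA-supp = lift₁-supp A.hᶻ (λ s r → suc s ≡ r) A.hᶻ-local λ { s r t ≡.refl ne eq → ne (≡.cong suc eq) }
      dB-supp : ∀ {m w} → Supp (In⊗? A B (suc m)) w → Supp (In⊗? A B m) (dB ⟨$⟩ w)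
      dB-supp {m} supp = ε₁-supp {m} (lift₂-supp B.∂ᶻ (λ s r → s ≡ suc r) B.∂ᶻ-local
        (λ { s r t ≡.refl ne eq → ne (≡.trans (≡.sym (ℕ.+-suc t r)) (ℕ.suc-injective eq)) }) supp)
      hB-supp : ∀ {m w} → Supp (In⊗? A B m) w → Supp (In⊗? A B (suc m)) (hB ⟨$⟩ w)
      hB-supp {m} supp = ε₁-supp {suc m} (lift₂-supp B.hᶻ (λ s r → suc s ≡ r) B.hᶻ-local
        (λ { s r t ≡.refl ne eq → ne (≡.cong suc (≡.trans (ℕ.+-suc t s) eq)) }) supp)

      H-supp : ∀ {m w} → Supp (In⊗? A B m) w → Supp (In⊗? A B (suc m)) (H ⟨$⟩ w)
      H-supp {m} {w} supp = +-supp {suc m} (hA-supp supp) (−-supp {suc m} (−-supp {suc m} h (dA-supp (hA-supp h))) (hA-supp (dA-supp h)))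
        where
        h : Supp (In⊗? A B (suc m)) (hB ⟨$⟩ w)
        h = hB-supp supp

      d-supp : ∀ {m w} → Supp (In⊗? A B (suc m)) w → Supp (In⊗? A B m) (d ⟨$⟩ w)
      d-supp {m} supp = +-supp {m} (dA-supp supp) (dB-supp supp)

      -- `A` and `B` are closed under subsets, so the boundary of a supported chain is supported and
      -- the masks in `d` change nothing.
      d⊗≈d : ∀ {m w} → Supp (In⊗? A B m) w → ∀ x → (d⊗ ∂ ⟨$⟩ w) x ≈ (d ⟨$⟩ w) x
      d⊗≈d supp (α , τ) = +-cong
        (sym (A.∂ᶻ≈∂ (λ σ σ∉ → supp (σ , τ) (σ∉ ∘ proj₁ ∘ proj₁)) α))
        (*-congˡ (sym (B.∂ᶻ≈∂ (λ σ σ∉ → supp (α , σ) (σ∉ ∘ proj₂ ∘ proj₁)) τ)))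

      E : Space
      E = Fun I (In⊗ A B (suc k))

      pairing : ∀ {i j} → Lin (Chains A i) 𝕂 → Lin (Chains B j) 𝕂 → Lin (Fun I (λ _ → ⊤)) 𝕂
      pairing f g = record
        { _⟨$⟩_ = λ w → f ⟨$⟩ (λ α → g ⟨$⟩ (λ τ → w (α , τ)))
        ; cong = λ e → Lin.cong f (λ α _ → Lin.cong g (λ τ _ → e (α , τ) tt))
        ; +-homo = λ v w → trans (Lin.cong f (λ α _ → Lin.+-homo g _ _)) (Lin.+-homo f _ _)
        ; *-homo = λ a v → trans (Lin.cong f (λ α _ → Lin.*-homo g a _)) (Lin.*-homo f a _)
        }

      size? : ∀ i → Decidable {A = I} (λ x → card (proj₁ x) ≡ i)
      size? i x = card (proj₁ x) ℕ.≟ i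

      -- A vector of `Chains A (suc i)` is meaningful only on faces with `i` vertices, so the
      -- product is cut down to `card α ≡ i`. The total degree in `E` then fixes the size of `τ`.
      _⊠_ : ∀ {i j} → Tensor (Chains A (suc i)) (Chains A (suc i)) → Tensor (Chains B j) (Chains B j) → Tensor E E
      _⊠_ {i} s t = (pairing (functional s) (functional t) ∘ᴸ onSupport (In⊗? A B (suc k)) idᴸ) ⊗
        mask (size? i) (λ x → vector s (proj₁ x) * vector t (proj₂ x))

      products : ∀ {i j} → List (Tensor (Chains A (suc i)) (Chains A (suc i))) → List (Tensor (Chains B j) (Chains B j)) → List (Tensor E E)
      products [] M = []
      products (s ∷ L) M = map (s ⊠_) M ++ products L M

      length-products : ∀ {i j} L M → length (products {i} {j} L M) ≡ length L ℕ.* length M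
      length-products [] M = ≡.refl
      length-products (s ∷ L) M = ≡.trans (length-++ (map (s ⊠_) M)) (≡.cong₂ ℕ._+_ (length-map (s ⊠_) M) (length-products L M))

      module _ (v : ∣ E ∣) where
        w : I → Carrier
        w = mask (In⊗? A B (suc k)) v

        Σ⊗-++-at : ∀ (L M : List (Tensor E E)) x → (Σ⊗ (L ++ M) ⟨$⟩ v) x ≈ (Σ⊗ L ⟨$⟩ v) x + (Σ⊗ M ⟨$⟩ v) x
        Σ⊗-++-at [] M x = sym (+-identityˡ _)
        Σ⊗-++-at (_ ∷ L) M x = trans (+-congˡ (Σ⊗-++-at L M x)) (sym (+-assoc _ _ _))

        Σ⊗-⊠-at : ∀ {j} α τ s (M : List (Tensor (Chains B j) (Chains B j))) →
          (Σ⊗ (map (_⊠_ {card α} s) M) ⟨$⟩ v) (α , τ) ≈ functional s ⟨$⟩ (λ α′ → (Σ⊗ M ⟨$⟩ (λ τ′ → w (α′ , τ′))) τ) * vector s α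
        Σ⊗-⊠-at α τ s [] = sym (trans (*-congʳ (Lin.0-homo (functional s))) (zeroˡ _))
        Σ⊗-⊠-at α τ s (t ∷ M) = begin
          p * mask (size? (card α)) (λ x → vector s (proj₁ x) * vector t (proj₂ x)) (α , τ) + (Σ⊗ (map (s ⊠_) M) ⟨$⟩ v) (α , τ)
            ≈⟨ +-cong (*-congˡ (mask-in (size? (card α)) (λ x → vector s (proj₁ x) * vector t (proj₂ x)) (α , τ) ≡.refl)) (Σ⊗-⊠-at α τ s M) ⟩
          p * (vector s α * vector t τ) + functional s ⟨$⟩ rest * vector s α
            ≈⟨ +-congʳ (trans (*-congˡ (*-comm _ _)) (trans (sym (*-assoc _ _ _)) (*-congʳ (*-comm _ _)))) ⟩
          (vector t τ * p) * vector s α + functional s ⟨$⟩ rest * vector s α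
            ≈⟨ distribʳ _ _ _ ⟨
          (vector t τ * p + functional s ⟨$⟩ rest) * vector s α
            ≈⟨ *-congʳ (+-congʳ (sym (trans (Lin.cong (functional s) (λ α′ _ → *-comm _ _)) (Lin.*-homo (functional s) _ _)))) ⟩
          (functional s ⟨$⟩ (λ α′ → functional t ⟨$⟩ (λ τ′ → w (α′ , τ′)) * vector t τ) + functional s ⟨$⟩ rest) * vector s α
            ≈⟨ *-congʳ (Lin.+-homo (functional s) _ _) ⟨
          functional s ⟨$⟩ (λ α′ → functional t ⟨$⟩ (λ τ′ → w (α′ , τ′)) * vector t τ + rest α′) * vector s α ∎
          where
          open SetoidReasoning setoid
          p : Carrier
          p = functional s ⟨$⟩ (λ α′ → functional t ⟨$⟩ (λ τ′ → w (α′ , τ′)))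
          rest : Face n → Carrier
          rest α′ = (Σ⊗ M ⟨$⟩ (λ τ′ → w (α′ , τ′))) τ

        products-at : ∀ {j} α τ L (M : List (Tensor (Chains B j) (Chains B j))) →
          (Σ⊗ (products {card α} L M) ⟨$⟩ v) (α , τ) ≈ (Σ⊗ L ⟨$⟩ (λ α′ → (Σ⊗ M ⟨$⟩ (λ τ′ → w (α′ , τ′))) τ)) α
        products-at α τ [] M = refl
        products-at α τ (s ∷ L) M = trans (Σ⊗-++-at (map (s ⊠_) M) (products L M) (α , τ)) (+-cong (Σ⊗-⊠-at α τ s M) (products-at α τ L M))

        products-off : ∀ {i j} α τ L (M : List (Tensor (Chains B j) (Chains B j))) → ¬ (card α ≡ i) → (Σ⊗ (products {i} L M) ⟨$⟩ v) (α , τ) ≈ 0#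
        products-off α τ [] M ne = refl
        products-off {i} α τ (s ∷ L) M ne = trans (Σ⊗-++-at (map (s ⊠_) M) (products L M) (α , τ)) (trans (+-cong (go M) (products-off α τ L M ne)) (+-identityˡ 0#))
          where
          go : ∀ M → (Σ⊗ (map (s ⊠_) M) ⟨$⟩ v) (α , τ) ≈ 0#
          go [] = refl
          go (t ∷ M) = trans (+-cong (trans (*-congˡ (mask-out (size? i) (λ x → vector s (proj₁ x) * vector t (proj₂ x)) (α , τ) ne)) (zeroʳ _)) (go M)) (+-identityˡ 0#)

      -- The part of `PA PB` in bidegree `(i, k - i)`. At `(α , τ)` only the block with `i` equal to
      -- `card α` contributes.
      block : ℕ → List (Tensor E E)
      block i = products (HA.residue i) (HB.residue (k ℕ.∸ i))

      blocks-off : ∀ v α τ is → All (λ i → ¬ (card α ≡ i)) is → (Σ⊗ (concatMap block is) ⟨$⟩ v) (α , τ) ≈ 0#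
      blocks-off v α τ [] _ = refl
      blocks-off v α τ (i ∷ is) (ne ∷ nes) = trans (Σ⊗-++-at v (block i) (concatMap block is) (α , τ))
        (trans (+-cong (products-off v α τ (HA.residue i) (HB.residue (k ℕ.∸ i)) ne) (blocks-off v α τ is nes)) (+-identityˡ 0#))

      blocks-at : ∀ v α τ is → Unique is → card α ∈ is → (Σ⊗ (concatMap block is) ⟨$⟩ v) (α , τ) ≈ (Σ⊗ (block (card α)) ⟨$⟩ v) (α , τ)
      blocks-at v α τ (i ∷ is) (ne AllPairs.∷ _) (here ≡.refl) = trans (Σ⊗-++-at v (block i) (concatMap block is) (α , τ))
        (trans (+-congˡ (blocks-off v α τ is ne)) (+-identityʳ _))
      blocks-at v α τ (i ∷ is) (ne AllPairs.∷ uniq) (there α∈) = trans (Σ⊗-++-at v (block i) (concatMap block is) (α , τ))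
        (trans (+-cong (products-off v α τ (HA.residue i) (HB.residue (k ℕ.∸ i)) (λ e → All.lookup ne α∈ (≡.sym e))) (blocks-at v α τ is uniq α∈)) (+-identityˡ _))

      blocks-length : ∀ is → (∀ {i} → i ∈ is → i ℕ.≤ k) → length (concatMap block is) ≡ sum (map (λ i → a i ℕ.* b (k ℕ.∸ i)) is)
      blocks-length [] _ = ≡.refl
      blocks-length (i ∷ is) is≤k = ≡.trans (length-++ (block i)) (≡.cong₂ ℕ._+_
        (≡.trans (length-products (HA.residue i) _) (≡.cong₂ ℕ._*_ (HA.size i (is≤k (here ≡.refl))) (HB.size (k ℕ.∸ i) (ℕ.m∸n≤m k i))))
        (blocks-length is (is≤k ∘ there)))

      residue-at : ∀ v α τ → In⊗ A B (suc k) (α , τ) → (PA ⟨$⟩ PB ⟨$⟩ w v) (α , τ) ≈ (Σ⊗ (concatMap block (upTo (suc k))) ⟨$⟩ v) (α , τ)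
      residue-at v α τ ((α∈ , τ∈) , eq) = begin
        (PA ⟨$⟩ PB ⟨$⟩ w v) (α , τ)
          -- The two signs `ε₁` in `dB hB` and in `hB dB` cancel, so `PB` acts as `B.Pᶻ` on the
          -- second factor.
          ≈⟨ op-cong A.Pᶻ (λ α′ → +-cong (+-congˡ (-‿cong (lift₂-ε₁ B.∂ᶻ B.hᶻ (w v) α′ τ))) (-‿cong (lift₂-ε₁ B.hᶻ B.∂ᶻ (w v) α′ τ))) α ⟩
        (A.Pᶻ ⟨$⟩ (λ α′ → (B.Pᶻ ⟨$⟩ (λ τ′ → w v (α′ , τ′))) τ)) α
          ≈⟨ op-cong A.Pᶻ (λ α′ → B.Pᶻ-residue _ τ τ∈ (ℕ.≤-trans (ℕ.m≤n+m (card τ) (card α)) (ℕ.≤-reflexive sizes))) α ⟩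
        (A.Pᶻ ⟨$⟩ (λ α′ → (Σ⊗ (HB.residue (card τ)) ⟨$⟩ (λ τ′ → w v (α′ , τ′))) τ)) α
          ≈⟨ A.Pᶻ-residue _ α α∈ α≤k ⟩
        (Σ⊗ (HA.residue (card α)) ⟨$⟩ (λ α′ → (Σ⊗ (HB.residue (card τ)) ⟨$⟩ (λ τ′ → w v (α′ , τ′))) τ)) α
          ≈⟨ products-at v α τ (HA.residue (card α)) (HB.residue (card τ)) ⟨
        (Σ⊗ (products (HA.residue (card α)) (HB.residue (card τ))) ⟨$⟩ v) (α , τ)
          ≡⟨ ≡.cong (λ j → (Σ⊗ (products (HA.residue (card α)) (HB.residue j)) ⟨$⟩ v) (α , τ))
               (≡.trans (≡.sym (ℕ.m+n∸m≡n (card α) (card τ))) (≡.cong (ℕ._∸ card α) sizes)) ⟩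
        (Σ⊗ (block (card α)) ⟨$⟩ v) (α , τ)
          ≈⟨ blocks-at v α τ (upTo (suc k)) (Unique.upTo⁺ (suc k)) (∈-upTo⁺ (ℕ.s≤s α≤k)) ⟨
        (Σ⊗ (concatMap block (upTo (suc k))) ⟨$⟩ v) (α , τ) ∎
        where
        open SetoidReasoning setoid
        sizes : card α ℕ.+ card τ ≡ k
        sizes = ℕ.suc-injective eq
        α≤k : card α ℕ.≤ k
        α≤k = ℕ.≤-trans (ℕ.m≤m+n (card α) (card τ)) (ℕ.≤-reflexive sizes)

    contraction : Contraction (∂⊗ A B (suc k)) (∂⊗ A B k) (sum (map (λ i → a i ℕ.* b (k ℕ.∸ i)) (upTo (suc k))))
    contraction = record
      -- `H` shifts the degree by one, so restricting this single operator to adjacent degrees gives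
      -- both maps.
      { s = onSupport (In⊗? A B (suc k)) H
      ; t = onSupport (In⊗? A B k) H
      ; residue = concatMap block (upTo (suc k))
      ; size = blocks-length (upTo (suc k)) (λ i∈ → ℕ.s≤s⁻¹ (∈-upTo⁻ i∈))
      ; homotopy = λ v x x∈ → trans (sym (mask-in (In⊗? A B (suc k)) v x x∈)) (trans (plain-homotopy (w v) x)
          (+-cong (+-cong (dH v x) (Hd v x)) (residue-at v (proj₁ x) (proj₂ x) x∈)))
      }
      where
      w-supp : ∀ v → Supp (In⊗? A B (suc k)) (w v)
      w-supp v = mask-out (In⊗? A B (suc k)) v
      dH : ∀ v x → (d ⟨$⟩ H ⟨$⟩ w v) x ≈ (d⊗ ∂ ⟨$⟩ mask (In⊗? A B (suc (suc k))) (H ⟨$⟩ w v)) x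
      dH v x = trans (sym (d⊗≈d {suc (suc k)} (H-supp (w-supp v)) x)) (op-cong (d⊗ ∂) (λ y → sym (mask-supp (In⊗? A B (suc (suc k))) (H-supp (w-supp v)) y)) x)
      Hd : ∀ v x → (H ⟨$⟩ d ⟨$⟩ w v) x ≈ (H ⟨$⟩ mask (In⊗? A B k) (d⊗ ∂ ⟨$⟩ w v)) x
      Hd v x = op-cong H (λ y → trans (sym (mask-supp (In⊗? A B k) (d-supp (w-supp v)) y))
        (mask-cong (In⊗? A B k) (d ⟨$⟩ w v) (d⊗ ∂ ⟨$⟩ w v) y (λ _ → sym (d⊗≈d {suc k} (w-supp v) y)))) x

  -- The cubical complex and its retract

  private
    Fun₂ : ℕ → Set c
    Fun₂ n = Face n → Face n → Carrier

    -- The cube [σ , σ ∪ τ] has lower facets [σ , σ ∪ τ ∖ v] and upper facets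
    -- [σ ∪ v , σ ∪ τ], for v ∈ τ; when v ∈ σ already, the two cancel.
    q₀ : ∀ {n} → Fun₂ n → Fun₂ n
    q₀ g [] [] = 0#
    q₀ g (false ∷ σ) (false ∷ τ) = q₀ (λ σ τ → g (false ∷ σ) (false ∷ τ)) σ τ + g (false ∷ σ) (true ∷ τ)
    q₀ g (true ∷ σ) (false ∷ τ) = q₀ (λ σ τ → g (true ∷ σ) (false ∷ τ)) σ τ + - g (false ∷ σ) (true ∷ τ)
    q₀ g (false ∷ σ) (true ∷ τ) = - q₀ (λ σ τ → g (false ∷ σ) (true ∷ τ)) σ τ
    q₀ g (true ∷ σ) (true ∷ τ) = - q₀ (λ σ τ → g (true ∷ σ) (true ∷ τ)) σ τ

    q₀-cong : ∀ {n} {g h : Fun₂ n} → (∀ σ τ → g σ τ ≈ h σ τ) → ∀ σ τ → q₀ g σ τ ≈ q₀ h σ τ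
    q₀-cong e [] [] = refl
    q₀-cong e (false ∷ σ) (false ∷ τ) = +-cong (q₀-cong (λ σ τ → e _ _) σ τ) (e _ _)
    q₀-cong e (true ∷ σ) (false ∷ τ) = +-cong (q₀-cong (λ σ τ → e _ _) σ τ) (-‿cong (e _ _))
    q₀-cong e (false ∷ σ) (true ∷ τ) = -‿cong (q₀-cong (λ σ τ → e _ _) σ τ)
    q₀-cong e (true ∷ σ) (true ∷ τ) = -‿cong (q₀-cong (λ σ τ → e _ _) σ τ)

    q₀-+ : ∀ {n} (g h : Fun₂ n) σ τ → q₀ (λ σ τ → g σ τ + h σ τ) σ τ ≈ q₀ g σ τ + q₀ h σ τ
    q₀-+ g h [] [] = sym (+-identityˡ 0#)
    q₀-+ g h (false ∷ σ) (false ∷ τ) = trans (+-congʳ (q₀-+ _ _ σ τ))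
      (solve 4 (λ a b c d → (a ⊕ b) ⊕ (c ⊕ d) ⊜ (a ⊕ c) ⊕ (b ⊕ d)) refl _ _ _ _)
    q₀-+ g h (true ∷ σ) (false ∷ τ) = trans (+-congʳ (q₀-+ _ _ σ τ))
      (solve 4 (λ a b c d → (a ⊕ b) ⊝ (c ⊕ d) ⊜ (a ⊝ c) ⊕ (b ⊝ d)) refl _ _ _ _)
    q₀-+ g h (false ∷ σ) (true ∷ τ) = trans (-‿cong (q₀-+ _ _ σ τ)) (solve 2 (λ a b → ⊖ (a ⊕ b) ⊜ ⊖ a ⊕ ⊖ b) refl _ _)
    q₀-+ g h (true ∷ σ) (true ∷ τ) = trans (-‿cong (q₀-+ _ _ σ τ)) (solve 2 (λ a b → ⊖ (a ⊕ b) ⊜ ⊖ a ⊕ ⊖ b) refl _ _)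

    q₀-* : ∀ {n} a (g : Fun₂ n) σ τ → q₀ (λ σ τ → a * g σ τ) σ τ ≈ a * q₀ g σ τ
    q₀-* a g [] [] = sym (zeroʳ a)
    q₀-* a g (false ∷ σ) (false ∷ τ) = trans (+-congʳ (q₀-* a _ σ τ)) (sym (distribˡ a _ _))
    q₀-* a g (true ∷ σ) (false ∷ τ) = trans (+-cong (q₀-* a _ σ τ) (-‿distribʳ-* ring a _)) (sym (distribˡ a _ _))
    q₀-* a g (false ∷ σ) (true ∷ τ) = trans (-‿cong (q₀-* a _ σ τ)) (-‿distribʳ-* ring a _)
    q₀-* a g (true ∷ σ) (true ∷ τ) = trans (-‿cong (q₀-* a _ σ τ)) (-‿distribʳ-* ring a _)

  q : ∀ {n} → Op (Face n × Face n) (Face n × Face n)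
  q = record
    { _⟨$⟩_ = λ g (σ , τ) → q₀ (λ σ τ → g (σ , τ)) σ τ
    ; cong = λ e (σ , τ) _ → q₀-cong (λ σ τ → e _ tt) σ τ
    ; +-homo = λ g h (σ , τ) _ → q₀-+ _ _ σ τ
    ; *-homo = λ a g (σ , τ) _ → q₀-* a _ σ τ
    }

  private
    uncurry₂ : ∀ {n} → Fun₂ n → Face n × Face n → Carrier
    uncurry₂ g (σ , τ) = g σ τ

    q₀-neg : ∀ {n} (g : Fun₂ n) σ τ → q₀ (λ σ τ → - g σ τ) σ τ ≈ - q₀ g σ τ
    q₀-neg g σ τ = op-neg q (uncurry₂ g) (σ , τ)

    q₀-0 : ∀ {n} (g : Fun₂ n) → (∀ σ τ → g σ τ ≈ 0#) → ∀ σ τ → q₀ g σ τ ≈ 0#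
    q₀-0 g e σ τ = op-0 q {uncurry₂ g} (λ (σ , τ) → e σ τ) (σ , τ)

    q₀q₀≈0 : ∀ {n} (g : Fun₂ n) σ τ → q₀ (q₀ g) σ τ ≈ 0#
    q₀q₀≈0 g [] [] = refl
    q₀q₀≈0 g (false ∷ σ) (false ∷ τ) = trans (+-congʳ (trans (q₀-+ _ _ σ τ) (+-congʳ (q₀q₀≈0 _ σ τ))))
      (solve 1 (λ a → (∅ ⊕ a) ⊝ a ⊜ ∅) refl _)
    q₀q₀≈0 g (true ∷ σ) (false ∷ τ) = trans (+-congʳ (trans (q₀-+ _ _ σ τ) (+-cong (q₀q₀≈0 _ σ τ) (q₀-neg _ σ τ))))
      (solve 1 (λ a → (∅ ⊝ a) ⊝ (⊖ a) ⊜ ∅) refl _)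
    q₀q₀≈0 g (false ∷ σ) (true ∷ τ) = trans (-‿cong (trans (q₀-neg _ σ τ) (-‿cong (q₀q₀≈0 _ σ τ)))) (solve 0 (⊖ (⊖ ∅) ⊜ ∅) refl)
    q₀q₀≈0 g (true ∷ σ) (true ∷ τ) = trans (-‿cong (trans (q₀-neg _ σ τ) (-‿cong (q₀q₀≈0 _ σ τ)))) (solve 0 (⊖ (⊖ ∅) ⊜ ∅) refl)

  qq≈0 : ∀ {n} (g : Face n × Face n → Carrier) x → (q ⟨$⟩ q ⟨$⟩ g) x ≈ 0#
  qq≈0 g (σ , τ) = q₀q₀≈0 (λ σ τ → g (σ , τ)) σ τ

  -- [σ , σ ∪ τ] is an upper facet of [σ′ , σ′ ∪ τ′].
  data Upper : ∀ {n} → Face n → Face n → Face n → Face n → Set where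
    here  : ∀ {n s} {σ τ : Face n} → Upper (s ∷ σ) (true ∷ τ) (true ∷ σ) (false ∷ τ)
    there : ∀ {n s t} {σ′ τ′ σ τ : Face n} → Upper σ′ τ′ σ τ → Upper (s ∷ σ′) (t ∷ τ′) (s ∷ σ) (t ∷ τ)

  private
    q₀≈∂ : ∀ {n} (g : Fun₂ n) σ τ → (∀ σ′ τ′ → Upper σ′ τ′ σ τ → g σ′ τ′ ≈ 0#) → q₀ g σ τ ≈ (∂ ⟨$⟩ g σ) τ
    q₀≈∂ g [] [] _ = refl
    q₀≈∂ g (false ∷ σ) (false ∷ τ) g≈0 = +-congʳ (q₀≈∂ _ σ τ (λ _ _ → g≈0 _ _ ∘ there))
    -- Both terms vanish by `here`: with `s = false` for a genuine upper facet, with `s = true` for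
    -- the cube whose `σ` already contains the vertex, a term that `q₀` omits but `∂` has.
    q₀≈∂ g (true ∷ σ) (false ∷ τ) g≈0 = +-cong (q₀≈∂ _ σ τ (λ _ _ → g≈0 _ _ ∘ there))
      (trans (-‿cong (g≈0 _ _ here)) (trans -0≈0 (sym (g≈0 _ _ here))))
    q₀≈∂ g (false ∷ σ) (true ∷ τ) g≈0 = -‿cong (q₀≈∂ _ σ τ (λ _ _ → g≈0 _ _ ∘ there))
    q₀≈∂ g (true ∷ σ) (true ∷ τ) g≈0 = -‿cong (q₀≈∂ _ σ τ (λ _ _ → g≈0 _ _ ∘ there))

  -- Lower facets keep `σ` and remove a vertex of `τ` with its simplicial sign. Once the upper ones
  -- contribute nothing, the boundary in `τ` is left.
  q≈∂ : ∀ {n} (g : Face n × Face n → Carrier) σ τ → (∀ σ′ τ′ → Upper σ′ τ′ σ τ → g (σ′ , τ′) ≈ 0#) →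
    (q ⟨$⟩ g) (σ , τ) ≈ (∂ ⟨$⟩ (λ τ → g (σ , τ))) τ
  q≈∂ g σ τ = q₀≈∂ (λ σ τ → g (σ , τ)) σ τ

  Upper-card : ∀ {n} {σ′ τ′ σ τ : Face n} → Upper σ′ τ′ σ τ → card τ′ ≡ suc (card τ)
  Upper-card here = ≡.refl
  Upper-card (there {t = true} u) = ≡.cong suc (Upper-card u)
  Upper-card (there {t = false} u) = Upper-card u

  Upper-⋖ : ∀ {n} {σ′ τ′ σ τ : Face n} → Upper σ′ τ′ σ τ → T (disjointᵇ τ′ σ′) → σ′ ⋖ σ
  Upper-⋖ (here {s = false}) _ = here
  Upper-⋖ (there {s = s} {t = false} u) disj = there (Upper-⋖ u disj)
  Upper-⋖ (there {s = false} {t = true} u) disj = there (Upper-⋖ u disj)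

  Upper-disjoint : ∀ {n} {σ′ τ′ σ τ : Face n} → Upper σ′ τ′ σ τ → T (disjointᵇ τ′ σ′) → T (disjointᵇ τ σ)
  Upper-disjoint (here {s = false}) disj = disj
  Upper-disjoint (there {s = s} {t = false} u) disj = Upper-disjoint u disj
  Upper-disjoint (there {s = false} {t = true} u) disj = Upper-disjoint u disj

  Upper-∪ : ∀ {n} {σ′ τ′ σ τ : Face n} → Upper σ′ τ′ σ τ → τ′ ∪ᶠ σ′ ≡ τ ∪ᶠ σ
  Upper-∪ here = ≡.refl
  Upper-∪ (there u) = ≡.cong (_ ∷_) (Upper-∪ u)

  -- The embedding `Φ`, the augmentation and the retraction `Ψ`.

  private
    -- Supported on `α = σ` disjoint from `τ`. The sign is that of the shuffle sorting `α` followed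
    -- by `τ`: each vertex of `τ` contributes one sign for every larger vertex of `α`.
    Φ₀ : ∀ {n} → (Face n → Carrier) → Face n → Fun₂ n
    Φ₀ f [] [] [] = f []
    Φ₀ f (false ∷ α) (false ∷ σ) (false ∷ τ) = Φ₀ (λ ρ → f (false ∷ ρ)) α σ τ
    Φ₀ f (false ∷ α) (false ∷ σ) (true ∷ τ) = signPow (card α) * Φ₀ (λ ρ → f (true ∷ ρ)) α σ τ
    Φ₀ f (true ∷ α) (true ∷ σ) (false ∷ τ) = Φ₀ (λ ρ → f (true ∷ ρ)) α σ τ
    Φ₀ f (false ∷ α) (true ∷ σ) (t ∷ τ) = 0#
    Φ₀ f (true ∷ α) (false ∷ σ) (t ∷ τ) = 0#
    Φ₀ f (true ∷ α) (true ∷ σ) (true ∷ τ) = 0#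

    Φ₀-cong : ∀ {n} {f g : Face n → Carrier} → (∀ ρ → f ρ ≈ g ρ) → ∀ α σ τ → Φ₀ f α σ τ ≈ Φ₀ g α σ τ
    Φ₀-cong e [] [] [] = e []
    Φ₀-cong e (false ∷ α) (false ∷ σ) (false ∷ τ) = Φ₀-cong (λ _ → e _) α σ τ
    Φ₀-cong e (false ∷ α) (false ∷ σ) (true ∷ τ) = *-congˡ (Φ₀-cong (λ _ → e _) α σ τ)
    Φ₀-cong e (true ∷ α) (true ∷ σ) (false ∷ τ) = Φ₀-cong (λ _ → e _) α σ τ
    Φ₀-cong e (false ∷ α) (true ∷ σ) (t ∷ τ) = refl
    Φ₀-cong e (true ∷ α) (false ∷ σ) (t ∷ τ) = refl
    Φ₀-cong e (true ∷ α) (true ∷ σ) (true ∷ τ) = refl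

    Φ₀-+ : ∀ {n} (f g : Face n → Carrier) α σ τ → Φ₀ (λ ρ → f ρ + g ρ) α σ τ ≈ Φ₀ f α σ τ + Φ₀ g α σ τ
    Φ₀-+ f g [] [] [] = refl
    Φ₀-+ f g (false ∷ α) (false ∷ σ) (false ∷ τ) = Φ₀-+ _ _ α σ τ
    Φ₀-+ f g (false ∷ α) (false ∷ σ) (true ∷ τ) = trans (*-congˡ (Φ₀-+ _ _ α σ τ)) (distribˡ _ _ _)
    Φ₀-+ f g (true ∷ α) (true ∷ σ) (false ∷ τ) = Φ₀-+ _ _ α σ τ
    Φ₀-+ f g (false ∷ α) (true ∷ σ) (t ∷ τ) = sym (+-identityˡ 0#)
    Φ₀-+ f g (true ∷ α) (false ∷ σ) (t ∷ τ) = sym (+-identityˡ 0#)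
    Φ₀-+ f g (true ∷ α) (true ∷ σ) (true ∷ τ) = sym (+-identityˡ 0#)

    Φ₀-* : ∀ {n} a (f : Face n → Carrier) α σ τ → Φ₀ (λ ρ → a * f ρ) α σ τ ≈ a * Φ₀ f α σ τ
    Φ₀-* a f [] [] [] = refl
    Φ₀-* a f (false ∷ α) (false ∷ σ) (false ∷ τ) = Φ₀-* a _ α σ τ
    Φ₀-* a f (false ∷ α) (false ∷ σ) (true ∷ τ) = trans (*-congˡ (Φ₀-* a _ α σ τ))
      (trans (sym (*-assoc _ _ _)) (trans (*-congʳ (*-comm _ _)) (*-assoc _ _ _)))
    Φ₀-* a f (true ∷ α) (true ∷ σ) (false ∷ τ) = Φ₀-* a _ α σ τ
    Φ₀-* a f (false ∷ α) (true ∷ σ) (t ∷ τ) = sym (zeroʳ a)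
    Φ₀-* a f (true ∷ α) (false ∷ σ) (t ∷ τ) = sym (zeroʳ a)
    Φ₀-* a f (true ∷ α) (true ∷ σ) (true ∷ τ) = sym (zeroʳ a)

  -- The chain ρ ↦ Σ ± α ⊗ [α , ρ], over all decompositions ρ = α ⊔ τ.
  Φ : ∀ {n} → Op (Face n) (Face n × (Face n × Face n))
  Φ = record
    { _⟨$⟩_ = λ f (α , σ , τ) → Φ₀ f α σ τ
    ; cong = λ e (α , σ , τ) _ → Φ₀-cong (λ ρ → e ρ tt) α σ τ
    ; +-homo = λ f g (α , σ , τ) _ → Φ₀-+ f g α σ τ
    ; *-homo = λ a f (α , σ , τ) _ → Φ₀-* a f α σ τ
    }

  private
    D₀ : ∀ {n} → (Face n → Fun₂ n) → Face n → Fun₂ n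
    D₀ g α σ τ = (∂ ⟨$⟩ (λ α → g α σ τ)) α + signPow (card α) * q₀ (g α) σ τ

    Φ₀-neg : ∀ {n} (f : Face n → Carrier) α σ τ → Φ₀ (λ ρ → - f ρ) α σ τ ≈ - Φ₀ f α σ τ
    Φ₀-neg f α σ τ = op-neg Φ f (α , σ , τ)

    ∂0 : ∀ {n} (α : Face n) → (∂ ⟨$⟩ (λ _ → 0#)) α ≈ 0#
    ∂0 = op-0 ∂ (λ _ → refl)

    q0 : ∀ {n} (σ τ : Face n) → q₀ (λ _ _ → 0#) σ τ ≈ 0#
    q0 = q₀-0 _ (λ _ _ → refl)

    -- The lower facets of the cubes `[α , ρ]` make up `Φ` of the boundary of `ρ`. A term of the
    -- boundary of `α`, with `α` losing `v`, meets the upper facet at `v` of the cube starting at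
    -- the smaller face, and the two cancel.
    D₀Φ₀ : ∀ {n} (f : Face n → Carrier) α σ τ → D₀ (Φ₀ f) α σ τ ≈ Φ₀ (∂ ⟨$⟩ f) α σ τ
    D₀Φ₀ f [] [] [] = trans (+-identityˡ _) (zeroʳ _)
    D₀Φ₀ f (false ∷ α) (false ∷ σ) (false ∷ τ) = begin
      ((∂ ⟨$⟩ (λ α → Φ₀ f₀ α σ τ)) α + 0#) + s * (q₀ (Φ₀ f₀ α) σ τ + s * Φ₀ f₁ α σ τ)
        ≈⟨ +-cong (+-identityʳ _) (trans (distribˡ _ _ _) (+-congˡ (trans (sym (*-assoc _ _ _)) (trans (*-congʳ (signPow² (card α))) (*-identityˡ _))))) ⟩
      (∂ ⟨$⟩ (λ α → Φ₀ f₀ α σ τ)) α + (s * q₀ (Φ₀ f₀ α) σ τ + Φ₀ f₁ α σ τ)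
        ≈⟨ +-assoc _ _ _ ⟨
      D₀ (Φ₀ f₀) α σ τ + Φ₀ f₁ α σ τ
        ≈⟨ +-congʳ (D₀Φ₀ f₀ α σ τ) ⟩
      Φ₀ (∂ ⟨$⟩ f₀) α σ τ + Φ₀ f₁ α σ τ
        ≈⟨ Φ₀-+ _ _ α σ τ ⟨
      Φ₀ (λ ρ → (∂ ⟨$⟩ f₀) ρ + f₁ ρ) α σ τ ∎
      where
      open SetoidReasoning setoid
      f₀ f₁ : Face _ → Carrier
      f₀ ρ = f (false ∷ ρ)
      f₁ ρ = f (true ∷ ρ)
      s : Carrier
      s = signPow (card α)
    D₀Φ₀ f (false ∷ α) (false ∷ σ) (true ∷ τ) = begin
      ((∂ ⟨$⟩ ε ⟨$⟩ (λ α → Φ₀ f₁ α σ τ)) α + 0#) + s * - q₀ (λ σ τ → s * Φ₀ f₁ α σ τ) σ τ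
        ≈⟨ +-cong (trans (+-identityʳ _) (∂-ε _ α)) (trans (*-congˡ (-‿cong (q₀-* _ _ σ τ))) (sym (-‿distribʳ-* ring _ _))) ⟩
      - (s * (∂ ⟨$⟩ (λ α → Φ₀ f₁ α σ τ)) α) + - (s * (s * q₀ (Φ₀ f₁ α) σ τ))
        ≈⟨ solve 2 (λ x y → ⊖ x ⊕ ⊖ y ⊜ ⊖ (x ⊕ y)) refl _ _ ⟩
      - (s * (∂ ⟨$⟩ (λ α → Φ₀ f₁ α σ τ)) α + s * (s * q₀ (Φ₀ f₁ α) σ τ))
        ≈⟨ -‿cong (distribˡ _ _ _) ⟨
      - (s * D₀ (Φ₀ f₁) α σ τ)
        ≈⟨ -‿cong (*-congˡ (D₀Φ₀ f₁ α σ τ)) ⟩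
      - (s * Φ₀ (∂ ⟨$⟩ f₁) α σ τ)
        ≈⟨ -‿distribʳ-* ring _ _ ⟩
      s * - Φ₀ (∂ ⟨$⟩ f₁) α σ τ
        ≈⟨ *-congˡ (Φ₀-neg _ α σ τ) ⟨
      s * Φ₀ (λ ρ → - (∂ ⟨$⟩ f₁) ρ) α σ τ ∎
      where
      open SetoidReasoning setoid
      f₁ : Face _ → Carrier
      f₁ ρ = f (true ∷ ρ)
      s : Carrier
      s = signPow (card α)
    -- Here the vertex is in `σ` and not in `α`: this is the cancelling pair.
    D₀Φ₀ f (false ∷ α) (true ∷ σ) (false ∷ τ) = begin
      ((∂ ⟨$⟩ (λ _ → 0#)) α + x) + s * (q₀ (λ _ _ → 0#) σ τ + - (s * x))
        ≈⟨ +-cong (+-congʳ (∂0 α)) (*-congˡ (+-congʳ (q0 σ τ))) ⟩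
      (0# + x) + s * (0# + - (s * x))
        ≈⟨ +-cong (+-identityˡ x) (trans (*-congˡ (+-identityˡ _)) (sym (-‿distribʳ-* ring _ _))) ⟩
      x + - (s * (s * x))
        ≈⟨ +-congˡ (-‿cong (trans (sym (*-assoc _ _ _)) (trans (*-congʳ (signPow² (card α))) (*-identityˡ _)))) ⟩
      x + - x
        ≈⟨ -‿inverseʳ x ⟩
      0# ∎
      where
      open SetoidReasoning setoid
      x s : Carrier
      x = Φ₀ (λ ρ → f (true ∷ ρ)) α σ τ
      s = signPow (card α)
    D₀Φ₀ f (false ∷ α) (true ∷ σ) (true ∷ τ) =
      trans (+-cong (trans (+-congʳ (∂0 α)) (+-identityˡ 0#)) (trans (*-congˡ (trans (-‿cong (q0 σ τ)) -0≈0)) (zeroʳ _))) (+-identityˡ 0#)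
    D₀Φ₀ f (true ∷ α) (false ∷ σ) (false ∷ τ) =
      trans (+-cong (trans (-‿cong (∂0 α)) -0≈0) (trans (*-congˡ (trans (+-congʳ (q0 σ τ)) (+-identityˡ 0#))) (zeroʳ _))) (+-identityˡ 0#)
    D₀Φ₀ f (true ∷ α) (true ∷ σ) (false ∷ τ) = begin
      - (∂ ⟨$⟩ (λ α → Φ₀ f₁ α σ τ)) α + (- s) * (q₀ (Φ₀ f₁ α) σ τ + - 0#)
        ≈⟨ +-congˡ (trans (*-congˡ (trans (+-congˡ -0≈0) (+-identityʳ _))) (sym (-‿distribˡ-* ring _ _))) ⟩
      - (∂ ⟨$⟩ (λ α → Φ₀ f₁ α σ τ)) α + - (s * q₀ (Φ₀ f₁ α) σ τ)
        ≈⟨ solve 2 (λ x y → ⊖ x ⊕ ⊖ y ⊜ ⊖ (x ⊕ y)) refl _ _ ⟩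
      - D₀ (Φ₀ f₁) α σ τ
        ≈⟨ -‿cong (D₀Φ₀ f₁ α σ τ) ⟩
      - Φ₀ (∂ ⟨$⟩ f₁) α σ τ
        ≈⟨ Φ₀-neg _ α σ τ ⟨
      Φ₀ (λ ρ → - (∂ ⟨$⟩ f₁) ρ) α σ τ ∎
      where
      open SetoidReasoning setoid
      f₁ : Face _ → Carrier
      f₁ ρ = f (true ∷ ρ)
      s : Carrier
      s = signPow (card α)
    D₀Φ₀ f (true ∷ α) (false ∷ σ) (true ∷ τ) =
      trans (+-cong (trans (-‿cong (∂0 α)) -0≈0) (trans (*-congˡ (trans (-‿cong (q0 σ τ)) -0≈0)) (zeroʳ _))) (+-identityˡ 0#)
    D₀Φ₀ f (true ∷ α) (true ∷ σ) (true ∷ τ) =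
      trans (+-cong (trans (-‿cong (∂0 α)) -0≈0) (trans (*-congˡ (trans (-‿cong (q0 σ τ)) -0≈0)) (zeroʳ _))) (+-identityˡ 0#)

  Φ-chain : ∀ {n} (f : Face n → Carrier) x → (d⊗ q ⟨$⟩ Φ ⟨$⟩ f) x ≈ (Φ ⟨$⟩ ∂ ⟨$⟩ f) x
  Φ-chain f (α , σ , τ) = D₀Φ₀ f α σ τ

  Φ-local : ∀ {n} (f : Face n → Carrier) α σ τ → (α ≡ σ → T (disjointᵇ τ σ) → f (τ ∪ᶠ σ) ≈ 0#) → (Φ ⟨$⟩ f) (α , σ , τ) ≈ 0#
  Φ-local f [] [] [] f≈0 = f≈0 ≡.refl tt
  Φ-local f (false ∷ α) (false ∷ σ) (false ∷ τ) f≈0 = Φ-local _ α σ τ (f≈0 ∘ ≡.cong (false ∷_))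
  Φ-local f (false ∷ α) (false ∷ σ) (true ∷ τ) f≈0 = trans (*-congˡ (Φ-local _ α σ τ (f≈0 ∘ ≡.cong (false ∷_)))) (zeroʳ _)
  Φ-local f (true ∷ α) (true ∷ σ) (false ∷ τ) f≈0 = Φ-local _ α σ τ (f≈0 ∘ ≡.cong (true ∷_))
  Φ-local f (false ∷ α) (true ∷ σ) (t ∷ τ) f≈0 = refl
  Φ-local f (true ∷ α) (false ∷ σ) (t ∷ τ) f≈0 = refl
  Φ-local f (true ∷ α) (true ∷ σ) (true ∷ τ) f≈0 = refl

  private
    -- The augmentation of the cubical complex: the sum over cubes of dimension zero, those with
    -- empty `τ`.
    aug₀ : ∀ {n} → Fun₂ n → Carrier
    aug₀ {zero} g = g [] []
    aug₀ {suc n} g = aug₀ (λ σ τ → g (false ∷ σ) (false ∷ τ)) + aug₀ (λ σ τ → g (true ∷ σ) (false ∷ τ))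

    aug₀-cong : ∀ {n} {g h : Fun₂ n} → (∀ σ τ → g σ τ ≈ h σ τ) → aug₀ g ≈ aug₀ h
    aug₀-cong {zero} e = e [] []
    aug₀-cong {suc n} e = +-cong (aug₀-cong {n} (λ σ τ → e (false ∷ σ) (false ∷ τ))) (aug₀-cong {n} (λ σ τ → e (true ∷ σ) (false ∷ τ)))

    aug₀-+ : ∀ {n} (g h : Fun₂ n) → aug₀ (λ σ τ → g σ τ + h σ τ) ≈ aug₀ g + aug₀ h
    aug₀-+ {zero} g h = refl
    aug₀-+ {suc n} g h = trans (+-cong (aug₀-+ {n} (λ σ τ → g (false ∷ σ) (false ∷ τ)) _) (aug₀-+ {n} (λ σ τ → g (true ∷ σ) (false ∷ τ)) _))
      (solve 4 (λ a b c d → (a ⊕ b) ⊕ (c ⊕ d) ⊜ (a ⊕ c) ⊕ (b ⊕ d)) refl _ _ _ _)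

    aug₀-* : ∀ {n} a (g : Fun₂ n) → aug₀ (λ σ τ → a * g σ τ) ≈ a * aug₀ g
    aug₀-* {zero} a g = refl
    aug₀-* {suc n} a g = trans (+-cong (aug₀-* {n} a _) (aug₀-* {n} a _)) (sym (distribˡ a _ _))

  aug : ∀ {n} → Op (Face n × Face n) ⊤
  aug {n} = record
    { _⟨$⟩_ = λ g _ → aug₀ (λ σ τ → g (σ , τ))
    ; cong = λ e _ _ → aug₀-cong {n} (λ σ τ → e (σ , τ) tt)
    ; +-homo = λ g h _ _ → aug₀-+ {n} (λ σ τ → g (σ , τ)) (λ σ τ → h (σ , τ))
    ; *-homo = λ a g _ _ → aug₀-* {n} a (λ σ τ → g (σ , τ))
    }

  private
    -- The two ends of an edge occur with opposite signs.
    aug₀q₀ : ∀ {n} (g : Fun₂ n) → aug₀ (q₀ g) ≈ 0#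
    aug₀q₀ {zero} g = refl
    aug₀q₀ {suc n} g = begin
      aug₀ (λ σ τ → q₀ (λ σ τ → g (false ∷ σ) (false ∷ τ)) σ τ + g (false ∷ σ) (true ∷ τ)) +
      aug₀ (λ σ τ → q₀ (λ σ τ → g (true ∷ σ) (false ∷ τ)) σ τ + - g (false ∷ σ) (true ∷ τ))
        ≈⟨ +-cong (aug₀-+ {n} _ (λ σ τ → g (false ∷ σ) (true ∷ τ))) (aug₀-+ {n} _ (λ σ τ → - g (false ∷ σ) (true ∷ τ))) ⟩
      (aug₀ (q₀ (λ σ τ → g (false ∷ σ) (false ∷ τ))) + aug₀ (λ σ τ → g (false ∷ σ) (true ∷ τ))) +
      (aug₀ (q₀ (λ σ τ → g (true ∷ σ) (false ∷ τ))) + aug₀ (λ σ τ → - g (false ∷ σ) (true ∷ τ)))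
        ≈⟨ +-cong (+-congʳ (aug₀q₀ {n} (λ σ τ → g (false ∷ σ) (false ∷ τ))))
             (+-cong (aug₀q₀ {n} (λ σ τ → g (true ∷ σ) (false ∷ τ))) (op-neg (aug {n}) (λ (σ , τ) → g (false ∷ σ) (true ∷ τ)) tt)) ⟩
      (0# + aug₀ (λ σ τ → g (false ∷ σ) (true ∷ τ))) + (0# + - aug₀ (λ σ τ → g (false ∷ σ) (true ∷ τ)))
        ≈⟨ solve 1 (λ x → (∅ ⊕ x) ⊕ (∅ ⊝ x) ⊜ ∅) refl _ ⟩
      0# ∎
      where open SetoidReasoning setoid

    aug₀-local : ∀ {n} (g : Fun₂ n) → (∀ σ τ → card τ ≡ 0 → g σ τ ≈ 0#) → aug₀ g ≈ 0#
    aug₀-local {zero} g g≈0 = g≈0 [] [] ≡.refl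
    aug₀-local {suc n} g g≈0 = trans (+-cong (aug₀-local {n} _ (λ σ τ → g≈0 (false ∷ σ) (false ∷ τ))) (aug₀-local {n} _ (λ σ τ → g≈0 (true ∷ σ) (false ∷ τ)))) (+-identityˡ 0#)

    -- Only the vertex `[α , α]` survives, and its shuffle sign is trivial.
    aug₀Φ₀ : ∀ {n} (f : Face n → Carrier) α → aug₀ (Φ₀ f α) ≈ f α
    aug₀Φ₀ f [] = refl
    aug₀Φ₀ {suc n} f (false ∷ α) = trans (+-cong (aug₀Φ₀ {n} _ α) (aug₀-local {n} _ (λ _ _ _ → refl))) (+-identityʳ _)
    aug₀Φ₀ {suc n} f (true ∷ α) = trans (+-cong (aug₀-local {n} _ (λ _ _ _ → refl)) (aug₀Φ₀ {n} _ α)) (+-identityˡ _)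

  Ψ : ∀ {n} → Op (Face n × (Face n × Face n)) (Face n)
  Ψ {n} = record
    { _⟨$⟩_ = λ g α → (aug ⟨$⟩ (λ x → g (α , x))) tt
    ; cong = λ {g} {h} e α _ → op-cong (aug {n}) {λ x → g (α , x)} {λ x → h (α , x)} (λ x → e _ tt) tt
    ; +-homo = λ g h α _ → op-+ (aug {n}) (λ x → g (α , x)) (λ x → h (α , x)) tt
    ; *-homo = λ a g α _ → op-* (aug {n}) a (λ x → g (α , x)) tt
    }

  Ψ-chain : ∀ {n} (g : Face n × (Face n × Face n) → Carrier) α → (∂ ⟨$⟩ Ψ ⟨$⟩ g) α ≈ (Ψ ⟨$⟩ d⊗ q ⟨$⟩ g) α
  Ψ-chain {n} g α = sym (begin
    (Ψ ⟨$⟩ d⊗ q ⟨$⟩ g) α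
      ≈⟨ op-+ Ψ (lift₁ ∂ ⟨$⟩ g) (ε₁ ⟨$⟩ lift₂ q ⟨$⟩ g) α ⟩
    (aug ⟨$⟩ (λ x → (∂ ⟨$⟩ (λ α → g (α , x))) α)) tt + (aug ⟨$⟩ (λ x → signPow (card α) * (q ⟨$⟩ (λ x → g (α , x))) x)) tt
      ≈⟨ +-cong (sym (interchange ∂ aug (λ α x → g (α , x)) α tt))
           (trans (op-* (aug {n}) (signPow (card α)) (q ⟨$⟩ (λ x → g (α , x))) tt) (trans (*-congˡ (aug₀q₀ (λ σ τ → g (α , σ , τ)))) (zeroʳ _))) ⟩
    (∂ ⟨$⟩ Ψ ⟨$⟩ g) α + 0#
      ≈⟨ +-identityʳ _ ⟩
    (∂ ⟨$⟩ Ψ ⟨$⟩ g) α ∎)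
    where open SetoidReasoning setoid

  Ψ-local : ∀ {n} (g : Face n × (Face n × Face n) → Carrier) α → (∀ σ τ → card τ ≡ 0 → g (α , σ , τ) ≈ 0#) → (Ψ ⟨$⟩ g) α ≈ 0#
  Ψ-local g α = aug₀-local (λ σ τ → g (α , σ , τ))

  ΨΦ≈id : ∀ {n} (f : Face n → Carrier) α → (Ψ ⟨$⟩ Φ ⟨$⟩ f) α ≈ f α
  ΨΦ≈id = aug₀Φ₀

  -- The filtration by σ

  _≟ᶠ_ : ∀ {n} (σ τ : Face n) → Dec (σ ≡ τ)
  _≟ᶠ_ = ≡-dec Bool._≟_

  _∈?_ : ∀ {n} (σ : Face n) L → Dec (σ ∈ L)
  _∈?_ = DecMembership._∈?_ _≟ᶠ_

  ⊆-trans : ∀ {n} (ρ σ τ : Face n) → T (ρ ⊆ᵇ σ) → T (σ ⊆ᵇ τ) → T (ρ ⊆ᵇ τ)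
  ⊆-trans [] [] [] _ _ = tt
  ⊆-trans (false ∷ ρ) (false ∷ σ) (c ∷ τ) p q = ⊆-trans ρ σ τ p q
  ⊆-trans (false ∷ ρ) (true ∷ σ) (true ∷ τ) p q = ⊆-trans ρ σ τ p q
  ⊆-trans (true ∷ ρ) (true ∷ σ) (true ∷ τ) p q = ⊆-trans ρ σ τ p q

  ∪-monoˡ : ∀ {n} (ρ τ σ : Face n) → T (ρ ⊆ᵇ τ) → T ((ρ ∪ᶠ σ) ⊆ᵇ (τ ∪ᶠ σ))
  ∪-monoˡ [] [] [] _ = tt
  ∪-monoˡ (false ∷ ρ) (b ∷ τ) (false ∷ σ) p = ∪-monoˡ ρ τ σ p
  ∪-monoˡ (false ∷ ρ) (false ∷ τ) (true ∷ σ) p = ∪-monoˡ ρ τ σ p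
  ∪-monoˡ (false ∷ ρ) (true ∷ τ) (true ∷ σ) p = ∪-monoˡ ρ τ σ p
  ∪-monoˡ (true ∷ ρ) (true ∷ τ) (c ∷ σ) p = ∪-monoˡ ρ τ σ p

  ⊆-∪ʳ : ∀ {n} (τ σ : Face n) → T (σ ⊆ᵇ (τ ∪ᶠ σ))
  ⊆-∪ʳ [] [] = tt
  ⊆-∪ʳ (b ∷ τ) (false ∷ σ) = ⊆-∪ʳ τ σ
  ⊆-∪ʳ (false ∷ τ) (true ∷ σ) = ⊆-∪ʳ τ σ
  ⊆-∪ʳ (true ∷ τ) (true ∷ σ) = ⊆-∪ʳ τ σ

  disjoint-antitone : ∀ {n} (ρ τ σ : Face n) → T (ρ ⊆ᵇ τ) → T (disjointᵇ τ σ) → T (disjointᵇ ρ σ)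
  disjoint-antitone [] [] [] _ _ = tt
  disjoint-antitone (false ∷ ρ) (false ∷ τ) (c ∷ σ) p d = disjoint-antitone ρ τ σ p d
  disjoint-antitone (false ∷ ρ) (true ∷ τ) (false ∷ σ) p d = disjoint-antitone ρ τ σ p d
  disjoint-antitone (true ∷ ρ) (true ∷ τ) (false ∷ σ) p d = disjoint-antitone ρ τ σ p d

  card-∪ : ∀ {n} (τ σ : Face n) → T (disjointᵇ τ σ) → card (τ ∪ᶠ σ) ≡ card σ ℕ.+ card τ
  card-∪ [] [] _ = ≡.refl
  card-∪ (false ∷ τ) (false ∷ σ) d = card-∪ τ σ d
  card-∪ (false ∷ τ) (true ∷ σ) d = ≡.cong suc (card-∪ τ σ d)
  card-∪ (true ∷ τ) (false ∷ σ) d = ≡.trans (≡.cong suc (card-∪ τ σ d)) (≡.sym (ℕ.+-suc _ _))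

  UpClosed : ∀ {n} → List (Face n) → Set
  UpClosed L = ∀ {σ ρ} → σ ⋖ ρ → σ ∈ L → ρ ∈ L

  -- Since the differential only enlarges `σ`, every suffix of such a list spans a subcomplex of D.
  -- The suffixes are the steps of the filtration.
  data TailsUpClosed {n} : List (Face n) → Set where
    []  : TailsUpClosed []
    _∷_ : ∀ {σ L} → UpClosed (σ ∷ L) → TailsUpClosed L → TailsUpClosed (σ ∷ L)

  head-upClosed : ∀ {n} {L : List (Face n)} → TailsUpClosed L → UpClosed L
  head-upClosed [] _ ()
  head-upClosed (up ∷ _) = up

  -- Vertex sets are listed lexicographically, hence after all their subsets.
  allFaces-tailsUpClosed : ∀ n → TailsUpClosed (allFaces n)
  allFaces-tailsUpClosed zero = (λ { () }) ∷ []
  allFaces-tailsUpClosed (suc n) = falses (allFaces-tailsUpClosed n)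
    where
    F : List (Face n)
    F = allFaces n
    true-up : ∀ {G} → UpClosed G → UpClosed (map (true ∷_) G)
    true-up up (there {b = b} c) σ∈ with ∈-map⁻ (true ∷_) σ∈
    ... | σ′ , σ′∈ , ≡.refl = ∈-map⁺ (true ∷_) (up c σ′∈)
    true-up up here σ∈ with ∈-map⁻ (true ∷_) σ∈
    ... | _ , _ , ()
    trues : ∀ {G} → TailsUpClosed G → TailsUpClosed (map (true ∷_) G)
    trues [] = []
    trues (up ∷ tails) = true-up up ∷ trues tails
    false-up : ∀ {G} → UpClosed G → UpClosed (map (false ∷_) G ++ map (true ∷_) F)
    false-up {G} up c σ∈ with ∈-++⁻ (map (false ∷_) G) σ∈
    false-up {G} up here σ∈ | inj₁ σ∈ˡ = ∈-++⁺ʳ (map (false ∷_) G) (∈-map⁺ (true ∷_) (∈-allFaces _))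
    false-up {G} up (there c) σ∈ | inj₁ σ∈ˡ with ∈-map⁻ (false ∷_) σ∈ˡ
    ... | σ′ , σ′∈ , ≡.refl = ∈-++⁺ˡ (∈-map⁺ (false ∷_) (up c σ′∈))
    false-up {G} up c σ∈ | inj₂ σ∈ʳ = ∈-++⁺ʳ (map (false ∷_) G) (true-up (λ _ _ → ∈-allFaces _) c σ∈ʳ)
    falses : ∀ {G} → TailsUpClosed G → TailsUpClosed (map (false ∷_) G ++ map (true ∷_) F)
    falses [] = trues (allFaces-tailsUpClosed n)
    falses (up ∷ tails) = false-up up ∷ falses tails

  allFaces-unique : ∀ n → Unique (allFaces n)
  allFaces-unique zero = [] AllPairs.∷ AllPairs.[]
  allFaces-unique (suc n) = Unique.++⁺ (Unique.map⁺ ∷-injectiveʳ (allFaces-unique n)) (Unique.map⁺ ∷-injectiveʳ (allFaces-unique n)) disjoint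
    where
    disjoint : ∀ {σ} → σ ∈ map (false ∷_) (allFaces n) × σ ∈ map (true ∷_) (allFaces n) → ⊥
    disjoint (σ∈ , σ∈′) with ∈-map⁻ (false ∷_) σ∈ | ∈-map⁻ (true ∷_) σ∈′
    ... | _ , _ , ≡.refl | _ , _ , ()

  module Filtration {n} (X Y : Family n) (closedX : Closed X) (closedY : Closed Y) where

    Gen : Set
    Gen = Face n × (Face n × Face n)

    -- `W` is membership in a list for a step of the filtration and equality with `σ₀` for a graded
    -- piece.
    InD : (Face n → Set) → ℕ → Gen → Set
    InD W m (α , σ , τ) = In⊗ (induced X σ) (link Y σ) m (α , τ) × W σ

    InD? : ∀ {W} → Decidable W → ∀ m → Decidable (InD W m)
    InD? W? m (α , σ , τ) = In⊗? (induced X σ) (link Y σ) m (α , τ) ×-dec W? σ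

    closed-induced : ∀ σ → Closed (induced X σ)
    closed-induced σ ρ τ ρ⊆τ τ∈ with T-∧⁻ {τ ⊆ᵇ σ} τ∈
    ... | τ⊆σ , Xτ = T-∧ (⊆-trans ρ τ σ ρ⊆τ τ⊆σ) (closedX ρ τ ρ⊆τ Xτ)

    closed-link : ∀ σ → Closed (link Y σ)
    closed-link σ ρ τ ρ⊆τ τ∈ with T-∧⁻ {Y (τ ∪ᶠ σ)} τ∈
    ... | Yτσ , disj = T-∧ (closedY (ρ ∪ᶠ σ) (τ ∪ᶠ σ) (∪-monoˡ ρ τ σ ρ⊆τ) Yτσ) (disjoint-antitone ρ τ σ ρ⊆τ disj)

    link⇒Y : ∀ {σ τ} → T (link Y σ τ) → T (Y σ)
    link⇒Y {σ} {τ} τ∈ = closedY σ (τ ∪ᶠ σ) (⊆-∪ʳ τ σ) (proj₁ (T-∧⁻ {Y (τ ∪ᶠ σ)} τ∈))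

    upper-⋖ : ∀ {σ′ τ′ σ τ} → Upper σ′ τ′ σ τ → T (link Y σ′ τ′) → σ′ ⋖ σ
    upper-⋖ {σ′} {τ′} u τ′∈ = Upper-⋖ u (proj₂ (T-∧⁻ {Y (τ′ ∪ᶠ σ′)} τ′∈))

    -- An upper facet moves a vertex from `τ′` to `σ′`. The union, and with it the condition on `Y`,
    -- is unchanged, and `α` stays inside the larger `σ`.
    upper-InD : ∀ {W m α σ′ τ′ σ τ} → (∀ {σ ρ} → σ ⋖ ρ → W σ → W ρ) → Upper σ′ τ′ σ τ → InD W (suc m) (α , σ′ , τ′) → InD W m (α , σ , τ)
    upper-InD {α = α} {σ′} {τ′} {σ} {τ} up u (((α∈ , τ′∈) , eq) , w) =
      ((T-∧ (⊆-trans α σ′ σ (proj₁ (T-∧⁻ {α ⊆ᵇ σ′} α∈)) (⋖⇒⊆ σ′⋖σ)) (proj₂ (T-∧⁻ {α ⊆ᵇ σ′} α∈))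
       , T-∧ (≡.subst (λ ρ → T (Y ρ)) (Upper-∪ u) (proj₁ (T-∧⁻ {Y (τ′ ∪ᶠ σ′)} τ′∈))) (Upper-disjoint u (proj₂ (T-∧⁻ {Y (τ′ ∪ᶠ σ′)} τ′∈))))
      , ℕ.suc-injective (≡.trans (≡.cong suc (≡.trans (≡.sym (ℕ.+-suc (card α) (card τ))) (≡.cong (card α ℕ.+_) (≡.sym (Upper-card u))))) eq))
      , up σ′⋖σ w
      where
      σ′⋖σ : σ′ ⋖ σ
      σ′⋖σ = upper-⋖ u τ′∈

    α-InD : ∀ {W m α α′ σ τ} → α ⋖ α′ → InD W (suc m) (α′ , σ , τ) → InD W m (α , σ , τ)
    α-InD {α = α} {α′} {σ} {τ} c (((α′∈ , τ∈) , eq) , w) = ((closed-induced σ α α′ (⋖⇒⊆ c) α′∈ , τ∈)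
      , ℕ.suc-injective (≡.trans (≡.cong (λ j → suc (j ℕ.+ card τ)) (≡.sym (⋖-card c))) eq)) , w

    τ-InD : ∀ {W m α σ τ τ′} → τ ⋖ τ′ → InD W (suc m) (α , σ , τ′) → InD W m (α , σ , τ)
    τ-InD {α = α} {σ} {τ} {τ′} c (((α∈ , τ′∈) , eq) , w) = ((α∈ , closed-link σ τ τ′ (⋖⇒⊆ c) τ′∈)
      , ℕ.suc-injective (≡.trans (≡.cong suc (≡.trans (≡.sym (ℕ.+-suc (card α) (card τ))) (≡.cong (card α ℕ.+_) (≡.sym (⋖-card c))))) eq)) , w

    -- A generator outside the support can be reached by shrinking `α`, by shrinking `τ` or by
    -- enlarging `σ`; the last case is where `W` has to be closed upwards.
    d-supp : ∀ {W} (W? : Decidable W) → (∀ {σ ρ} → σ ⋖ ρ → W σ → W ρ) → ∀ {m g} → Supp (InD? W? (suc m)) g → Supp (InD? W? m) (d⊗ q ⟨$⟩ g)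
    d-supp {W} W? up supp (α , σ , τ) x∉ = trans (+-cong
      (∂-local _ α λ α′ c → supp (α′ , σ , τ) (x∉ ∘ α-InD {W} c))
      (trans (*-congˡ (trans (q≈∂ _ σ τ λ σ′ τ′ u → supp (α , σ′ , τ′) (x∉ ∘ upper-InD up u))
        (∂-local _ τ λ τ′ c → supp (α , σ , τ′) (x∉ ∘ τ-InD {W} c)))) (zeroʳ _))) (+-identityˡ 0#)

    ∂ᴰ : ∀ L m → Lin (Fun Gen (InD (_∈ L) (suc m))) (Fun Gen (InD (_∈ L) m))
    ∂ᴰ L m = onSupport (InD? (_∈? L) (suc m)) (d⊗ q)

    -- The graded piece at σ₀, on which the upper facets are lost.
    ∂ᴳ : ∀ σ₀ m → Lin (Fun Gen (InD (_≡ σ₀) (suc m))) (Fun Gen (InD (_≡ σ₀) m))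
    ∂ᴳ σ₀ m = onSupport (InD? (_≟ᶠ σ₀) (suc m)) (d⊗ (lift₂ ∂))

    -- All structure maps restrict functions or extend them by zero. The inclusion is a chain map
    -- since `L` is closed upwards; the projection is one since nothing maps into `σ₀` from outside
    -- its own fibre.
    extension : ∀ σ₀ L → ¬ (σ₀ ∈ L) → UpClosed (σ₀ ∷ L) → UpClosed L → ∀ m →
      Extension (∂ᴰ L (suc m)) (∂ᴰ L m) (∂ᴰ (σ₀ ∷ L) (suc m)) (∂ᴰ (σ₀ ∷ L) m) (∂ᴳ σ₀ (suc m)) (∂ᴳ σ₀ m)
    extension σ₀ L σ₀∉L upC upA m = record
      { dd≈0 = λ v x _ → trans (op-cong (d⊗ q) (mask-supp (C? (suc m)) (d-supp (_∈? (σ₀ ∷ L)) upC (mask-out (C? (suc (suc m))) v))) x) (d⊗d⊗≈0 q qq≈0 _ x)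
      ; i₂ = onSupport (A? _) idᴸ
      ; i₁ = onSupport (A? _) idᴸ
      ; i₀ = onSupport (A? _) idᴸ
      ; p₂ = onSupport (C? _) idᴸ
      ; p₁ = onSupport (C? _) idᴸ
      ; p₀ = onSupport (C? _) idᴸ
      ; r₁ = onSupport (C? _) idᴸ
      ; r₀ = onSupport (C? _) idᴸ
      ; j₂ = onSupport (B? _) idᴸ
      ; j₁ = onSupport (B? _) idᴸ
      ; i-chain₂ = i-chain
      ; i-chain₁ = i-chain
      ; p-chain₂ = p-chain
      ; p-chain₁ = p-chain
      ; p₂j₂ = pj
      ; p₁j₁ = pj
      ; ir+jp = ir+jp
      ; r₀i₀ = λ v x x∈ → trans (mask-in (C? m) (mask (A? m) v) x (A⇒C x∈)) (mask-in (A? m) v x x∈)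
      }
      where
      A? : ∀ m → Decidable (InD (_∈ L) m)
      A? = InD? (_∈? L)
      C? : ∀ m → Decidable (InD (_∈ (σ₀ ∷ L)) m)
      C? = InD? (_∈? (σ₀ ∷ L))
      B? : ∀ m → Decidable (InD (_≡ σ₀) m)
      B? = InD? (_≟ᶠ σ₀)
      A⇒C : ∀ {m x} → InD (_∈ L) m x → InD (_∈ (σ₀ ∷ L)) m x
      A⇒C (x∈ , σ∈) = x∈ , there σ∈
      B⇒C : ∀ {m x} → InD (_≡ σ₀) m x → InD (_∈ (σ₀ ∷ L)) m x
      B⇒C (x∈ , eq) = x∈ , here eq
      i-chain : ∀ {m} v x → InD (_∈ (σ₀ ∷ L)) m x →
        (d⊗ q ⟨$⟩ mask (C? (suc m)) (mask (A? (suc m)) v)) x ≈ mask (A? m) (d⊗ q ⟨$⟩ mask (A? (suc m)) v) x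
      i-chain {m} v x _ = trans (op-cong (d⊗ q) (mask-supp (C? (suc m)) (λ y y∉ → mask-out (A? (suc m)) v y (y∉ ∘ A⇒C))) x)
        (sym (mask-supp (A? m) (d-supp (_∈? L) upA (mask-out (A? (suc m)) v)) x))
      p-chain : ∀ {m} v x → InD (_≡ σ₀) m x →
        mask (C? m) (d⊗ q ⟨$⟩ mask (C? (suc m)) v) x ≈ (d⊗ (lift₂ ∂) ⟨$⟩ mask (B? (suc m)) (mask (C? (suc m)) v)) x
      p-chain {m} v x@(α , σ , τ) x∈@(_ , ≡.refl) = trans (mask-in (C? m) (d⊗ q ⟨$⟩ w) x (B⇒C x∈)) (+-cong
        (op-cong ∂ (λ α′ → sym (fibre (α′ , σ₀ , τ) ≡.refl)) α)
        (*-congˡ (trans (q≈∂ _ σ₀ τ no-upper) (op-cong ∂ (λ τ′ → sym (fibre (α , σ₀ , τ′) ≡.refl)) τ))))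
        where
        w : Gen → Carrier
        w = mask (C? (suc m)) v
        fibre : ∀ y → proj₁ (proj₂ y) ≡ σ₀ → mask (B? (suc m)) w y ≈ w y
        fibre y eq = mask-elim (B? (suc m)) (_≈ w y) w y (λ _ → refl) λ y∉ → sym (mask-out (C? (suc m)) v y (λ (y∈ , _) → y∉ (y∈ , eq)))
        no-upper : ∀ σ′ τ′ → Upper σ′ τ′ σ₀ τ → w (α , σ′ , τ′) ≈ 0#
        -- A source in the fibre of `σ₀` is excluded by cardinality; a source in `L` would put `σ₀`
        -- into `L`.
        no-upper σ′ τ′ u = mask-≈0 (C? (suc m)) v (α , σ′ , τ′) λ
          { (((_ , τ′∈) , _) , here ≡.refl) → ⊥-elim (ℕ.1+n≢n (≡.sym (⋖-card (upper-⋖ u τ′∈))))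
          ; (((_ , τ′∈) , _) , there σ′∈) → ⊥-elim (σ₀∉L (upA (upper-⋖ u τ′∈) σ′∈)) }
      pj : ∀ {m} v x → InD (_≡ σ₀) m x → mask (C? m) (mask (B? m) v) x ≈ v x
      pj {m} v x x∈ = trans (mask-in (C? m) (mask (B? m) v) x (B⇒C x∈)) (mask-in (B? m) v x x∈)
      ir+jp : ∀ {m} v x → InD (_∈ (σ₀ ∷ L)) m x → v x ≈ mask (A? m) (mask (C? m) v) x + mask (B? m) (mask (C? m) v) x
      ir+jp {m} v x x∈@(y , here eq) = sym (trans (+-cong
        (mask-out (A? m) (mask (C? m) v) x (λ (_ , σ∈) → σ₀∉L (≡.subst (_∈ L) eq σ∈)))
        (trans (mask-in (B? m) (mask (C? m) v) x (y , eq)) (mask-in (C? m) v x x∈))) (+-identityˡ _))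
      ir+jp {m} v x x∈@(y , there σ∈) = sym (trans (+-cong
        (trans (mask-in (A? m) (mask (C? m) v) x (y , σ∈)) (mask-in (C? m) v x x∈))
        (mask-out (B? m) (mask (C? m) v) x (λ { (_ , ≡.refl) → σ₀∉L σ∈ }))) (+-identityʳ _))

    -- With `σ = σ₀` fixed, a triple is a pair `(α , τ)`. `inflate` is constant in `σ`, of which
    -- only the fibre over `σ₀` is visible.
    graded-piece : ∀ σ₀ k {N} → Contraction (∂⊗ (induced X σ₀) (link Y σ₀) (suc k)) (∂⊗ (induced X σ₀) (link Y σ₀) k) N →
      Contraction (∂ᴳ σ₀ (suc k)) (∂ᴳ σ₀ k) N
    graded-piece σ₀ k = retract (onSupport (B? _) slice) (onSupport (B? _) slice) (onSupport (E? _) inflate) (onSupport (E? _) inflate)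
      slice-chain inflate-chain
      (λ v x x∈ → trans (mask-in (E? (suc k)) (slice ⟨$⟩ mask (B? (suc k)) v) (proj₁ x , proj₂ (proj₂ x)) (B⇒E x∈)) (at-σ₀ v x x∈))
      where
      B? : ∀ m → Decidable (InD (_≡ σ₀) m)
      B? = InD? (_≟ᶠ σ₀)
      E? : ∀ m → Decidable (In⊗ (induced X σ₀) (link Y σ₀) m)
      E? = In⊗? (induced X σ₀) (link Y σ₀)
      slice : Op Gen (Face n × Face n)
      slice = record
        { _⟨$⟩_ = λ g (α , τ) → g (α , σ₀ , τ)
        ; cong = λ e (α , τ) _ → e (α , σ₀ , τ) tt
        ; +-homo = λ _ _ _ _ → refl
        ; *-homo = λ _ _ _ _ → refl
        }
      inflate : Op (Face n × Face n) Gen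
      inflate = record
        { _⟨$⟩_ = λ g (α , _ , τ) → g (α , τ)
        ; cong = λ e (α , _ , τ) _ → e (α , τ) tt
        ; +-homo = λ _ _ _ _ → refl
        ; *-homo = λ _ _ _ _ → refl
        }
      B⇒E : ∀ {m x} → InD (_≡ σ₀) m x → In⊗ (induced X σ₀) (link Y σ₀) m (proj₁ x , proj₂ (proj₂ x))
      B⇒E (x∈ , ≡.refl) = x∈
      at-σ₀ : ∀ {m} v x → InD (_≡ σ₀) m x → mask (B? m) v (proj₁ x , σ₀ , proj₂ (proj₂ x)) ≈ v x
      at-σ₀ {m} v x x∈@(_ , ≡.refl) = mask-in (B? m) v x x∈
      slice-chain : ∀ {m} v x → In⊗ (induced X σ₀) (link Y σ₀) m x →
        (d⊗ ∂ ⟨$⟩ mask (E? (suc m)) (slice ⟨$⟩ mask (B? (suc m)) v)) x ≈ (slice ⟨$⟩ mask (B? m) (d⊗ (lift₂ ∂) ⟨$⟩ mask (B? (suc m)) v)) x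
      slice-chain {m} v x@(α , τ) x∈ = trans
        (op-cong (d⊗ ∂) (mask-supp (E? (suc m)) {slice ⟨$⟩ mask (B? (suc m)) v} (λ y y∉ → mask-out (B? (suc m)) v _ (y∉ ∘ proj₁))) x)
        (sym (mask-in (B? m) (d⊗ (lift₂ ∂) ⟨$⟩ mask (B? (suc m)) v) (α , σ₀ , τ) (x∈ , ≡.refl)))
      inflate-chain : ∀ {m} v x → InD (_≡ σ₀) m x →
        (d⊗ (lift₂ ∂) ⟨$⟩ mask (B? (suc m)) (inflate ⟨$⟩ mask (E? (suc m)) v)) x ≈ (inflate ⟨$⟩ mask (E? m) (d⊗ ∂ ⟨$⟩ mask (E? (suc m)) v)) x
      inflate-chain {m} v x@(α , σ , τ) x∈@(y , ≡.refl) = trans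
        (+-cong (op-cong ∂ (λ α′ → unmask α′ τ) α) (*-congˡ (op-cong ∂ (λ τ′ → unmask α τ′) τ)))
        (sym (mask-in (E? m) (d⊗ ∂ ⟨$⟩ mask (E? (suc m)) v) (α , τ) y))
        where
        unmask : ∀ α′ τ′ → mask (B? (suc m)) (inflate ⟨$⟩ mask (E? (suc m)) v) (α′ , σ₀ , τ′) ≈ mask (E? (suc m)) v (α′ , τ′)
        unmask α′ τ′ = mask-elim (B? (suc m)) (_≈ mask (E? (suc m)) v (α′ , τ′)) (inflate ⟨$⟩ mask (E? (suc m)) v) (α′ , σ₀ , τ′) (λ _ → refl)
          λ ∉B → sym (mask-out (E? (suc m)) v (α′ , τ′) (λ ∈E → ∉B (∈E , ≡.refl)))

    module _ (k : ℕ) (a b : Face n → ℕ → ℕ)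
      (dims-a : ∀ σ → T (Y σ) → ∀ i → i ℕ.≤ k → ReducedHomDim (induced X σ) i (a σ i))
      (dims-b : ∀ σ → T (Y σ) → ∀ j → j ℕ.≤ k → ReducedHomDim (link Y σ) j (b σ j)) where

      private
        N : Face n → ℕ
        N σ = sum (map (λ i → a σ i ℕ.* b σ (k ℕ.∸ i)) (upTo (suc k)))
        Y? : Decidable (λ σ → T (Y σ))
        Y? σ = Bool.T? (Y σ)

      -- Gluing one graded piece per vertex set, starting from the zero complex of the empty list.
      filtered : ∀ L → Unique L → TailsUpClosed L → ¬ ¬ Contraction (∂ᴰ L (suc k)) (∂ᴰ L k) (sum (map N (filter Y? L)))
      filtered [] _ _ goal = goal record
        { s = 0ᴸ
        ; t = 0ᴸ
        ; residue = []
        ; size = ≡.refl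
        ; homotopy = λ { v x (_ , ()) }
        }
      filtered (σ ∷ L) (σ≢ AllPairs.∷ uniq) (up ∷ tails) goal = filtered L uniq tails λ con → piece (Y? σ) λ con′ →
        goal (≡.subst (Contraction _ _) (count (Y? σ)) (Extension.extend (extension σ L (λ σ∈ → All.lookup σ≢ σ∈ ≡.refl) up (head-upClosed tails) k) con con′))
        where
        Nᴳ : Dec (T (Y σ)) → ℕ
        Nᴳ (yes _) = N σ
        Nᴳ (no _) = 0
        count : ∀ d → Nᴳ d ℕ.+ sum (map N (filter Y? L)) ≡ sum (map N (filter Y? (σ ∷ L)))
        count (yes Yσ) = ≡.cong (sum ∘ map N) (≡.sym (filter-accept Y? Yσ))
        count (no ¬Yσ) = ≡.cong (sum ∘ map N) (≡.sym (filter-reject Y? ¬Yσ))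
        piece : ∀ d → ¬ ¬ Contraction (∂ᴳ σ (suc k)) (∂ᴳ σ k) (Nᴳ d)
        piece (yes Yσ) next =
          ReducedHomDim⇒Homotopy (induced X σ) (closed-induced σ) k (a σ) (dims-a σ Yσ) λ HA →
          ReducedHomDim⇒Homotopy (link Y σ) (closed-link σ) k (b σ) (dims-b σ Yσ) λ HB →
          next (graded-piece σ k (Künneth.contraction (induced X σ) (link Y σ) (closed-induced σ) (closed-link σ) HA HB))
        -- The list runs over all vertex sets; for `σ` outside `Y` the link is void, so the piece is
        -- the zero complex and costs nothing.
        piece (no ¬Yσ) next = next record
          { s = 0ᴸ
          ; t = 0ᴸ
          ; residue = []
          ; size = ≡.refl
          ; homotopy = λ { v (_ , _ , τ) (((_ , τ∈) , _) , ≡.refl) → ⊥-elim (¬Yσ (link⇒Y {τ = τ} τ∈)) }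
          }

    -- What remains to be checked is supports. If `σ ∪ τ` is in both complexes, then `σ` lies in
    -- `X[σ]` and `τ` in the link; conversely, if `α` is in `X` and contained in a face `σ` of `Y`,
    -- it lies in both.
    ∩-retract : ∀ k {N} → Contraction (∂ᴰ (allFaces n) (suc k)) (∂ᴰ (allFaces n) k) N →
      Contraction (boundary (X ∩ˢ Y) (suc k)) (boundary (X ∩ˢ Y) k) N
    ∩-retract k = retract (onSupport (C? _) Φ) (onSupport (C? _) Φ) (onSupport (D? _) Ψ) (onSupport (D? _) Ψ)
      (λ v x _ → trans (op-cong (d⊗ q) (mask-supp (D? (suc k)) (Φ-supp (mask-out (C? (suc k)) v))) x)
        (trans (Φ-chain _ x) (op-cong Φ (λ y → sym (mask-supp (C? k) (∂-supp (X ∩ˢ Y) closed-∩ (mask-out (C? (suc k)) v)) y)) x)))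
      (λ v x _ → trans (op-cong ∂ (mask-supp (C? (suc (suc k))) (Ψ-supp (mask-out (D? (suc (suc k))) v))) x)
        (trans (Ψ-chain _ x) (op-cong Ψ (λ y → sym (mask-supp (D? (suc k)) (d-supp (_∈? allFaces n) (λ _ _ → ∈-allFaces _) (mask-out (D? (suc (suc k))) v)) y)) x)))
      (λ v x x∈ → trans (op-cong Ψ (mask-supp (D? (suc k)) (Φ-supp (mask-out (C? (suc k)) v))) x)
        (trans (ΨΦ≈id _ x) (mask-in (C? (suc k)) v x x∈)))
      where
      C? : ∀ m → Decidable (InC (X ∩ˢ Y) m)
      C? = InC? (X ∩ˢ Y)
      D? : ∀ m → Decidable (InD (_∈ allFaces n) m)
      D? = InD? (_∈? allFaces n)
      closed-∩ : Closed (X ∩ˢ Y)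
      closed-∩ ρ τ ρ⊆τ τ∈ with T-∧⁻ {X τ} τ∈
      ... | Xτ , Yτ = T-∧ (closedX ρ τ ρ⊆τ Xτ) (closedY ρ τ ρ⊆τ Yτ)
      Φ-supp : ∀ {m f} → Supp (C? m) f → Supp (D? m) (Φ ⟨$⟩ f)
      Φ-supp {m} {f} supp (α , σ , τ) x∉ = Φ-local f α σ τ λ { ≡.refl disj → supp (τ ∪ᶠ σ) λ (τσ∈ , eq) →
        let (Xτσ , Yτσ) = T-∧⁻ {X (τ ∪ᶠ σ)} τσ∈ in
        x∉ (((T-∧ (⊆-refl σ) (closedX σ (τ ∪ᶠ σ) (⊆-∪ʳ τ σ) Xτσ) , T-∧ Yτσ disj)
            , ≡.trans (≡.cong suc (≡.sym (card-∪ τ σ disj))) eq) , ∈-allFaces σ) }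
      Ψ-supp : ∀ {m g} → Supp (D? m) g → Supp (C? m) (Ψ ⟨$⟩ g)
      Ψ-supp {m} {g} supp α α∉ = Ψ-local g α λ σ τ τ≡0 → supp (α , σ , τ) λ (((α∈ , τ∈) , eq) , _) →
        let (α⊆σ , Xα) = T-∧⁻ {α ⊆ᵇ σ} α∈ in
        α∉ (T-∧ Xα (closedY α σ α⊆σ (link⇒Y {σ} {τ} τ∈))
           , ≡.trans (≡.cong suc (≡.trans (≡.sym (ℕ.+-identityʳ _)) (≡.cong (card α ℕ.+_) (≡.sym τ≡0)))) eq)

  -- Counting faces to obtain the inequality.

  δ-diagonal : ∀ {n} (σ : Face n) → δ σ σ ≈ 1#
  δ-diagonal [] = refl
  δ-diagonal (false ∷ σ) = δ-diagonal σ
  δ-diagonal (true ∷ σ) = δ-diagonal σ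

  -- Evaluating a relation at `σ` isolates its coefficient, as the faces are distinct.
  faces-independent : ∀ {n} (Z : Family n) m S → Unique S → (∀ {σ} → σ ∈ S → InC Z m σ) → LinIndep (Chains Z m) (map δ S)
  faces-independent Z m [] _ _ [] _ _ = []
  faces-independent {n} Z m (σ ∷ S) (σ≢ AllPairs.∷ uniq) S⊆ (a ∷ as) len eq = a≈0 ∷ faces-independent Z m S uniq (S⊆ ∘ there) as (ℕ.suc-injective len)
    λ ρ ρ∈ → trans (sym (+-identityˡ _)) (trans (+-congʳ (sym (trans (*-congʳ a≈0) (zeroˡ _)))) (eq ρ ρ∈))
    where
    off : ∀ bs L → All (λ τ → ¬ (σ ≡ τ)) L → comb (Chains Z m) bs (map δ L) σ ≈ 0#
    off [] L _ = refl
    off (b ∷ bs) [] _ = refl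
    off (b ∷ bs) (τ ∷ L) (ne ∷ nes) = trans (+-cong (trans (*-congˡ (δ-off τ σ (ne ∘ ≡.sym))) (zeroʳ b)) (off bs L nes)) (+-identityˡ 0#)
    a≈0 : a ≈ 0#
    a≈0 = trans (sym (trans (+-cong (trans (*-congˡ (δ-diagonal σ)) (*-identityʳ a)) (off as S σ≢)) (+-identityʳ a))) (eq σ (S⊆ (here ≡.refl)))

open import Data.Nat using (_*_; _∸_; _≤_)

theorem1p1 : ∀ {c ℓ : Level} (K : Field c ℓ) (n : ℕ) (X Y : SimplicialComplex n)
    (k : ℕ) (d : ℕ) (a b : Face n → ℕ → ℕ) →
    LinAlg.ReducedHomDim K (mem X ∩ˢ mem Y) k d →
    (∀ σ → T (mem Y σ) → ∀ i → i ≤ k → LinAlg.ReducedHomDim K (induced (mem X) σ) i (a σ i)) →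
    (∀ σ → T (mem Y σ) → ∀ j → j ≤ k → LinAlg.ReducedHomDim K (link (mem Y) σ) j (b σ j)) →
    d ≤ sum (map (λ σ → sum (map (λ i → a σ i * b σ (k ∸ i)) (upTo (suc k)))) (faces (mem Y)))
theorem1p1 K n X Y k d a b (r₁ , r₂ , rk₁ , rk₂ , ≡.refl) dims-a dims-b = decidable-stable (_ ℕ.≤? _) λ ¬goal →
  BdryRank⇒Rank Z k rk₁ λ R₁ → BdryRank⇒Rank Z (suc k) rk₂ λ R₂ →
  -- `filter Y? (allFaces n)` unfolds to `faces (mem Y)`, so the size of `con` is the right-hand
  -- side itself.
  filtered k a b dims-a dims-b (allFaces n) (allFaces-unique n) (allFaces-tailsUpClosed n) λ con →
  contraction-bound R₁ R₂ (∩-retract k con) (map δ (facesOfSize Z k))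
    (faces-independent Z (suc k) (facesOfSize Z k) (Unique.filter⁺ _ (allFaces-unique n)) (∈-facesOfSize⁻ Z)) λ bound →
  -- The number of faces is at most `r₁ + (r₂ + N)`; moving both ranks across gives the definition
  -- of the homology dimension on the left.
  ¬goal (ℕ.m≤n+o⇒m∸n≤o _ r₂ (ℕ.m≤n+o⇒m∸n≤o _ r₁ (≡.subst (_≤ _) (length-map δ (facesOfSize Z k)) bound)))
  where
  open Homology K
  open Filtration (mem X) (mem Y) (closed X) (closed Y)
  Z : Family n
  Z = mem X ∩ˢ mem Y
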